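{- Let $a,b,n$ be positive integers with $a>b$, and define \[ t_1(an,bn,q)'=\sum_{k=an-bn-\lfloor n/2\rfloor}^{an-bn}(-1)^kq^{k(k-1)}\begin{bmatrix} an\\ k\end{bmatrix}_{q^2}\begin{bmatrix} 2an-2k\\ an-bn-k\end{bmatrix}. \] Then \[ t_1(an,bn,q)'\equiv(-1)^{an-bn}q^{(an-bn)(an-bn-1)}\begin{bmatrix} an\\ bn\end{bmatrix}_{q^2}\Big\{1-2(a-b)\big(1-\vartheta_n(q^{ -1})\big)\Big\}\pmod{\Phi_n(q)^2}, \] where \[ \vartheta_n(q)=\begin{cases} (-1)^m(1+q^{2m})q^{m(3m-5)/2}, &\text{if } n=3m,\\ (-1)^mq^{m(3m+1)/2}, &\text{if } n=3m+1,\\ (-1)^{m+1}q^{(m-1)(3m+2)/2}, &\text{if } n=3m+2.\end{cases} \]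
   Context: For integers $n,m$, the $q$-binomial coefficient is $\begin{bmatrix} n\\ m\end{bmatrix}_q=\begin{bmatrix} n\\ m\end{bmatrix}=\frac{(1-q^n)(1-q^{n-1})\cdots(1-q^{n-m+1})}{(1-q)(1-q^2)\cdots(1-q^m)}$ if $0\le m\le n$, and $0$ otherwise; $\begin{bmatrix} n\\ m\end{bmatrix}_{q^2}$ is the same with $q$ replaced by $q^2$. $\Phi_n(q)$ denotes the $n$-th cyclotomic polynomial. $\lfloor x\rfloor$ is the integer part of $x$. For rational functions (including Laurent polynomials) $A(q),B(q)$, $A\equiv B\pmod{\Phi_n(q)^2}$ means $A-B=\Phi_n(q)^2P(q)/Q(q)$ with $P,Q\in\mathbb{Z}[q]$ and $Q$ coprime to $\Phi_n(q)$. -}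

module Defs where

open import Data.Nat as ℕ using (ℕ; zero; suc; _≤?_; _∸_)
open import Data.Nat.Divisibility using (_∣?_)
open import Data.Integer as ℤ using (ℤ; +_; -[1+_])
open import Data.Integer.DivMod using (_/ℕ_)
open import Data.List using (List; []; _∷_; _++_; replicate; map; filter; foldr; upTo)
open import Data.Product using (_×_; _,_; proj₁; proj₂; Σ; ∃)
open import Relation.Nullary using (yes; no; ¬_)
open import Relation.Binary.PropositionalEquality using (_≡_)

-- Polynomials in ℤ[q]: coefficient lists, lowest degree first.
-- Trailing zeros are allowed; equality is coefficientwise (_≈ₚ_).

Poly : Set
Poly = List ℤ

coeff : Poly → ℕ → ℤ
coeff []       _       = + 0
coeff (a ∷ p)  zero    = a
coeff (a ∷ p)  (suc i) = coeff p i

infix 4 _≈ₚ_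
_≈ₚ_ : Poly → Poly → Set
p ≈ₚ r = ∀ i → coeff p i ≡ coeff r i

infixl 6 _+ₚ_ _-ₚ_
infixl 7 _*ₚ_

_+ₚ_ : Poly → Poly → Poly
[]      +ₚ r       = r
(a ∷ p) +ₚ []      = a ∷ p
(a ∷ p) +ₚ (b ∷ r) = (a ℤ.+ b) ∷ (p +ₚ r)

scaleₚ : ℤ → Poly → Poly
scaleₚ c p = map (c ℤ.*_) p

negₚ : Poly → Poly
negₚ = scaleₚ (ℤ.- (+ 1))

_-ₚ_ : Poly → Poly → Poly
p -ₚ r = p +ₚ negₚ r

_*ₚ_ : Poly → Poly → Poly
[]      *ₚ r = []
(a ∷ p) *ₚ r = scaleₚ a r +ₚ (+ 0 ∷ (p *ₚ r))

constₚ : ℤ → Poly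
constₚ c = c ∷ []

Xᵖ : ℕ → Poly
Xᵖ k = replicate k (+ 0) ++ (+ 1 ∷ [])

prodₚ : List Poly → Poly
prodₚ = foldr _*ₚ_ (constₚ (+ 1))

-- Exact division N / D in ℤ[q] when D has constant term ±1:
-- power-series long division, producing k coefficients.
-- If D divides N exactly and k ≥ deg N + 1, the result is the quotient
-- (up to trailing zeros).

tailₚ : Poly → Poly
tailₚ []      = []
tailₚ (_ ∷ p) = p

divSeries : ℕ → Poly → Poly → Poly
divSeries zero    d p = []
divSeries (suc k) d p =
  let c = coeff d 0 ℤ.* coeff p 0 in
  c ∷ divSeries k d (tailₚ (p -ₚ scaleₚ c d))

-- Cyclotomic polynomials, via  q^m - 1 = ∏_{d ∣ m} Φ_d(q):
-- Φ_m = (q^m - 1) / ∏_{d ∣ m, d < m} Φ_d.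
-- cyclos n = [(1 , Φ_1) , … , (n , Φ_n)].

cyclos : ℕ → List (ℕ × Poly)
cyclos zero    = []
cyclos (suc n) =
  let prev = cyclos n
      m    = suc n
      D    = prodₚ (map proj₂ (filter (λ x → proj₁ x ∣? m) prev))
  in prev ++ ((m , divSeries (suc m) D (Xᵖ m -ₚ constₚ (+ 1))) ∷ [])

lastPoly : List (ℕ × Poly) → Poly
lastPoly []           = constₚ (+ 1)
lastPoly (x ∷ [])     = proj₂ x
lastPoly (x ∷ y ∷ xs) = lastPoly (y ∷ xs)

-- Φ n = n-th cyclotomic polynomial (n ≥ 1; Φ 0 is an unused dummy).
Φ : ℕ → Poly
Φ n = lastPoly (cyclos n)

-- Rational functions in q: numerator / denominator (denominators used
-- below are always nonzero: products of 1 - q^i (i ≥ 1) and powers of q).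

record Frac : Set where
  constructor _//_
  field
    num : Poly
    den : Poly
open Frac public

infixl 6 _+f_ _-f_
infixl 7 _*f_

fromPoly : Poly → Frac
fromPoly p = p // constₚ (+ 1)

fromℤ : ℤ → Frac
fromℤ c = fromPoly (constₚ c)

_+f_ : Frac → Frac → Frac
(a // α) +f (b // β) = ((a *ₚ β) +ₚ (b *ₚ α)) // (α *ₚ β)

_*f_ : Frac → Frac → Frac
(a // α) *f (b // β) = (a *ₚ b) // (α *ₚ β)

negf : Frac → Frac
negf (a // α) = negₚ a // α

_-f_ : Frac → Frac → Frac
x -f y = x +f negf y

sumf : List Frac → Frac
sumf = foldr _+f_ (fromℤ (+ 0))

prodf : List Frac → Frac
prodf = foldr _*f_ (fromℤ (+ 1))

qpow : ℤ → Frac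
qpow (+ k)      = fromPoly (Xᵖ k)
qpow -[1+ k ]   = constₚ (+ 1) // Xᵖ (suc k)

sgn : ℕ → ℤ
sgn zero    = + 1
sgn (suc k) = ℤ.- sgn k

oneMinus : ℕ → Poly
oneMinus e = constₚ (+ 1) -ₚ Xᵖ e

qbinom : ℕ → ℕ → ℕ → Frac
qbinom s n m with m ≤? n
... | yes _ = prodₚ (map (λ i → oneMinus (s ℕ.* (n ∸ i))) (upTo m))
              // prodₚ (map (λ i → oneMinus (s ℕ.* suc i)) (upTo m))
... | no  _ = fromℤ (+ 0)

-- Congruence modulo Φ_n(q)^2 for rational functions:
-- A - B = Φ_n² P / Q with P, Q ∈ ℤ[q] and Q coprime to Φ_n.
-- For A = a/α, B = b/β this reads  Q (aβ - bα) = αβ Φ_n² P.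
-- Q coprime to Φ_n : U Q + V Φ_n = c for some U, V ∈ ℤ[q], c ∈ ℤ, c ≠ 0
-- (i.e. gcd 1 in ℚ[q]).

CoprimeP : Poly → Poly → Set
CoprimeP Q F = Σ Poly λ U → Σ Poly λ V → Σ ℤ λ c →
  (¬ (c ≡ + 0)) × ((U *ₚ Q) +ₚ (V *ₚ F) ≈ₚ constₚ c)

CongΦ² : ℕ → Frac → Frac → Set
CongΦ² n (a // α) (b // β) = Σ Poly λ P → Σ Poly λ Q →
  CoprimeP Q (Φ n) ×
  (Q *ₚ ((a *ₚ β) -ₚ (b *ₚ α)) ≈ₚ ((α *ₚ β) *ₚ (Φ n *ₚ Φ n)) *ₚ P)

-- ϑ_n, parametrised by the monomial map e ↦ x^e (x = q or x = q⁻¹).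

ϑ′ : (ℤ → Frac) → ℕ → Frac
ϑ′ x n with n ℕ.% 3
... | 0 = let m = n ℕ./ 3 ; mz = + m in
          fromℤ (sgn m) *f (fromℤ (+ 1) +f x (+ (2 ℕ.* m)))
            *f x ((mz ℤ.* ((+ 3) ℤ.* mz ℤ.- (+ 5))) /ℕ 2)
... | 1 = let m = n ℕ./ 3 ; mz = + m in
          fromℤ (sgn m) *f x ((mz ℤ.* ((+ 3) ℤ.* mz ℤ.+ (+ 1))) /ℕ 2)
... | _ = let m = n ℕ./ 3 ; mz = + m in
          fromℤ (sgn (suc m)) *f x (((mz ℤ.- (+ 1)) ℤ.* ((+ 3) ℤ.* mz ℤ.+ (+ 2))) /ℕ 2)

ϑ : ℕ → Frac
ϑ = ϑ′ qpow

ϑ⁻ : ℕ → Frac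
ϑ⁻ = ϑ′ (λ e → qpow (ℤ.- e))

t1′ : ℕ → ℕ → ℕ → Frac
t1′ a b n =
  let A = a ℕ.* n ; B = b ℕ.* n ; L = (A ∸ B) ∸ (n ℕ./ 2) in
  sumf (map (λ i → let k = L ℕ.+ i in
              fromℤ (sgn k) *f qpow (+ (k ℕ.* (k ∸ 1)))
                *f qbinom 2 A k *f qbinom 1 (2 ℕ.* A ∸ 2 ℕ.* k) ((A ∸ B) ∸ k))
            (upTo (suc (n ℕ./ 2))))

rhs : ℕ → ℕ → ℕ → Frac
rhs a b n =
  let A = a ℕ.* n ; B = b ℕ.* n ; D = A ∸ B in
  fromℤ (sgn D) *f qpow (+ (D ℕ.* (D ∸ 1))) *f qbinom 2 A B
    *f (fromℤ (+ 1) -f (fromℤ (+ (2 ℕ.* (a ∸ b))) *f (fromℤ (+ 1) -f ϑ⁻ n)))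

-- Let K be ℤ[q] localised at the polynomials coprime to Φ_n, modulo Φ_n². In K the element e = 1 - q^n
-- satisfies e² = 0 and q^n e = e, and 1 - q^i is invertible unless n divides i. Put D = (a-b)n. The ratio
-- of [an; D-j]_{q²} to [an; D]_{q²} contains the factor 1 - q^{2D} = 2(a-b)e for j ≥ 1, so the other factors
-- of the summand k = D-j of t₁′ matter only modulo Φ_n, where q^n = 1. It follows that t₁′ is the summand
-- k = D times 1 + 2(a-b) Σ_{j≥1} S_j, where, with p = q⁻¹ and Gaussian binomials G to the base p,
--   S_j = (-1)^j p^{j(j-1)/2} (G(n-j, j) + q^j G(n-j-1, j-1)).
-- Now 1 + Σ_{j≥1} S_j = A_n - q A_{n-2} for A_N = Σ_k (-1)^k p^{k(k-1)/2} G(N-k, k), and the two Pascal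
-- rules give A_{N+4} = A_{N+3} - p^{N+2} A_{N+1} + p^{N+1} A_N. Hence A_{3m} = (-1)^m p^{m(3m-1)/2},
-- A_{3m+1} = p^m A_{3m} and A_{3m+2} = 0, which makes A_n - q A_{n-2} equal to ϑ_n(q⁻¹).
--
-- The required facts on Φ_m are proved by induction on m. The Φ_d with d ∣ m, d < m are pairwise coprime
-- over ℚ and divide q^m - 1, hence so does their product Δ_m, and the quotient is integral because Δ_m has
-- constant term ±1. If g ∣ m and g < m, then Φ_m divides (q^m - 1)/(q^g - 1), which is congruent to the
-- constant m/g modulo q^g - 1; so Φ_m is coprime to q^g - 1, and with g = gcd(m, i) to q^i - 1.
module Submission where

open import Defs
open import Algebra.Bundles using (CommutativeRing)
import Algebra.Properties.CommutativeSemiring.Exp as Exponents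
import Algebra.Properties.Ring as RingProperties
import Algebra.Properties.Semiring.Mult.TCOptimised as NatMultiples
import Algebra.Solver.Ring as RingSolver
import Algebra.Solver.Ring.AlmostCommutativeRing as ACR
open import Data.Empty using (⊥-elim)
open import Data.Integer as ℤ using (ℤ; +_; -[1+_]; _⊖_)
open import Data.Integer.DivMod using (_/ℕ_)
import Data.Integer.Properties as ℤ
open import Data.List using (List; []; _∷_; _++_; map; filter; foldr; length; upTo; applyUpTo)
import Data.List.Properties as List
open import Data.List.Relation.Unary.All as All using (All; []; _∷_)
import Data.List.Relation.Unary.All.Properties as All
open import Data.List.Relation.Unary.AllPairs as AllPairs using (AllPairs; []; _∷_)
import Data.List.Relation.Unary.AllPairs.Properties as AllPairs
open import Data.Maybe using (Maybe; just; nothing)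
open import Data.Nat as ℕ using (ℕ; zero; suc; _∸_; _≤_; _<_; z≤n; s≤s)
open import Data.Nat.DivMod using (m*n%n≡0; m*n/n≡m; m≡m%n+[m/n]*n; m%n<n; m/n*n≤m)
open import Data.Nat.Divisibility using (_∣_; _∣?_; divides; ∣-trans; ∣-refl; ∣m+n∣m⇒∣n; ∣⇒≤; n∣m*n)
open import Data.Nat.GCD using (gcd; gcd-GCD; module Bézout; gcd[m,n]∣m; gcd[m,n]∣n)
import Data.Nat.Properties as ℕ
open import Data.Nat.Solver using (module +-*-Solver)
open import Data.Product using (_×_; _,_; proj₁; proj₂; Σ)
open import Data.Sum using (_⊎_; inj₁; inj₂)
open import Function using (_∘_)
open import Level using (0ℓ; _⊔_)
open import Relation.Binary using (Setoid)
open import Relation.Binary.PropositionalEquality as ≡ using (_≡_)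
import Relation.Binary.Reasoning.Setoid as SetoidReasoning
open import Relation.Nullary using (yes; no; ¬_)

open +-*-Solver using () renaming (solve to ℕ-solve; _:+_ to _⊞_; _:*_ to _⊠_; con to ℕ-con; _:=_ to _≐_)

-- Each S_j is itself a multiple of e: G(n-j, j) + q^j G(n-j-1, j-1) is the q-analogue of C(n-j, j)
-- + C(n-j-1, j-1) = (n/j) C(n-j-1, j-1), so S_j (1 - q^j) contains 1 - p^n = -e. On the other side,
-- the ratio of the summand k = D-j to the summand k = D comes out as 2(a-b) e times -q^(2j)
-- [2j-1; j-1] / (1 - q^j), the cofactor of e being taken modulo Φ_n. The two agree by reflection:
-- as q^n = 1 modulo Φ_n, each factor 1 - q^(j+i) of the numerator of [2j-1; j-1] becomes 1 -
-- p^(n-j-i), which is where the base p comes from. The obstacle is division. The quotient formulas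
-- have denominators that Φ_n may divide, and the ratio of base q² binomials meets 1 - q^(2j) with
-- 2j = n. Gaussian binomials are therefore defined by Pascal's rule, all their properties are
-- multiplied-out identities, and a factor is cancelled only where its exponent is not a multiple of
-- n.

-- Integer coefficients in a commutative ring

module IntegerMultiples {c ℓ} (R : CommutativeRing c ℓ) where
  open CommutativeRing R
  open RingProperties ring
  open NatMultiples semiring public using (1+×; ×-homo-+; ×1-homo-*) renaming (_×_ to _×ₙ_)
  open SetoidReasoning setoid

  -- The multiples are the variant for which `⟦ + 1 ⟧` reduces to `1#`, so that `con (+ 1)` in a
  -- solver equation is literally `1#` and the equation closes with `refl`.
  ⟦_⟧ : ℤ → Carrier
  ⟦ + m ⟧ = m ×ₙ 1#
  ⟦ -[1+ m ] ⟧ = - (suc m ×ₙ 1#)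

  ⟦⟧-⊖ : ∀ m n → ⟦ m ⊖ n ⟧ ≈ m ×ₙ 1# - n ×ₙ 1#
  ⟦⟧-⊖ m zero = sym (trans (+-congˡ -0#≈0#) (+-identityʳ _))
  ⟦⟧-⊖ zero (suc n) = sym (+-identityˡ _)
  ⟦⟧-⊖ (suc m) (suc n) = begin
    ⟦ suc m ⊖ suc n ⟧                     ≡⟨ ≡.cong ⟦_⟧ (ℤ.[1+m]⊖[1+n]≡m⊖n m n) ⟩
    ⟦ m ⊖ n ⟧                             ≈⟨ ⟦⟧-⊖ m n ⟩
    m ×ₙ 1# - n ×ₙ 1#                       ≈⟨ +-identityˡ _ ⟨
    0# + (m ×ₙ 1# - n ×ₙ 1#)                ≈⟨ +-congʳ (-‿inverseʳ 1#) ⟨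
    1# - 1# + (m ×ₙ 1# - n ×ₙ 1#)           ≈⟨ interchange 1# (- 1#) (m ×ₙ 1#) (- (n ×ₙ 1#)) ⟩
    1# + m ×ₙ 1# + (- 1# + - (n ×ₙ 1#))     ≈⟨ +-congˡ (-‿+-comm 1# (n ×ₙ 1#)) ⟩
    1# + m ×ₙ 1# - (1# + n ×ₙ 1#)           ≈⟨ +-cong (1+× m 1#) (-‿cong (1+× n 1#)) ⟨
    suc m ×ₙ 1# - suc n ×ₙ 1#               ∎
    where
    open import Algebra.Properties.CommutativeSemigroup +-commutativeSemigroup using (interchange)

  ⟦⟧-neg : ∀ x → ⟦ ℤ.- x ⟧ ≈ - ⟦ x ⟧
  ⟦⟧-neg (+ zero) = sym -0#≈0#
  ⟦⟧-neg (+ suc m) = refl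
  ⟦⟧-neg -[1+ m ] = sym (-‿involutive _)

  ⟦⟧-+ : ∀ x y → ⟦ x ℤ.+ y ⟧ ≈ ⟦ x ⟧ + ⟦ y ⟧
  ⟦⟧-+ (+ m) (+ n) = ×-homo-+ 1# m n
  ⟦⟧-+ (+ m) -[1+ n ] = ⟦⟧-⊖ m (suc n)
  ⟦⟧-+ -[1+ m ] (+ n) = trans (⟦⟧-⊖ n (suc m)) (+-comm _ _)
  ⟦⟧-+ -[1+ m ] -[1+ n ] = begin
    - (suc (suc (m ℕ.+ n)) ×ₙ 1#)      ≡⟨ ≡.cong (λ k → - (k ×ₙ 1#)) (ℕ.+-suc (suc m) n) ⟨
    - ((suc m ℕ.+ suc n) ×ₙ 1#)        ≈⟨ -‿cong (×-homo-+ 1# (suc m) (suc n)) ⟩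
    - (suc m ×ₙ 1# + suc n ×ₙ 1#)       ≈⟨ -‿+-comm _ _ ⟨
    - (suc m ×ₙ 1#) + - (suc n ×ₙ 1#)   ∎

  ⟦⟧-*-+ : ∀ m n → ⟦ + m ℤ.* + n ⟧ ≈ ⟦ + m ⟧ * ⟦ + n ⟧
  ⟦⟧-*-+ m n = trans (reflexive (≡.cong ⟦_⟧ (≡.sym (ℤ.pos-* m n)))) (×1-homo-* m n)

  ⟦⟧-* : ∀ x y → ⟦ x ℤ.* y ⟧ ≈ ⟦ x ⟧ * ⟦ y ⟧
  ⟦⟧-* (+ m) (+ n) = ⟦⟧-*-+ m n
  ⟦⟧-* (+ m) -[1+ n ] = begin
    ⟦ + m ℤ.* -[1+ n ] ⟧        ≡⟨ ≡.cong ⟦_⟧ (ℤ.neg-distribʳ-* (+ m) (+ suc n)) ⟨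
    ⟦ ℤ.- (+ m ℤ.* + suc n) ⟧   ≈⟨ ⟦⟧-neg (+ m ℤ.* + suc n) ⟩
    - ⟦ + m ℤ.* + suc n ⟧       ≈⟨ -‿cong (⟦⟧-*-+ m (suc n)) ⟩
    - (m ×ₙ 1# * suc n ×ₙ 1#)     ≈⟨ -‿distribʳ-* _ _ ⟩
    m ×ₙ 1# * - (suc n ×ₙ 1#)     ∎
  ⟦⟧-* -[1+ m ] y = begin
    ⟦ -[1+ m ] ℤ.* y ⟧          ≡⟨ ≡.cong ⟦_⟧ (ℤ.neg-distribˡ-* (+ suc m) y) ⟨
    ⟦ ℤ.- (+ suc m ℤ.* y) ⟧     ≈⟨ ⟦⟧-neg (+ suc m ℤ.* y) ⟩
    - ⟦ + suc m ℤ.* y ⟧         ≈⟨ -‿cong (⟦⟧-*+ y) ⟩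
    - ((suc m ×ₙ 1#) * ⟦ y ⟧)      ≈⟨ -‿distribˡ-* _ _ ⟩
    - (suc m ×ₙ 1#) * ⟦ y ⟧      ∎
    where
    ⟦⟧-*+ : ∀ y → ⟦ + suc m ℤ.* y ⟧ ≈ (suc m ×ₙ 1#) * ⟦ y ⟧
    ⟦⟧-*+ (+ n) = ⟦⟧-*-+ (suc m) n
    ⟦⟧-*+ -[1+ n ] = begin
      ⟦ + suc m ℤ.* -[1+ n ] ⟧        ≡⟨ ≡.cong ⟦_⟧ (ℤ.neg-distribʳ-* (+ suc m) (+ suc n)) ⟨
      ⟦ ℤ.- (+ suc m ℤ.* + suc n) ⟧   ≈⟨ ⟦⟧-neg (+ suc m ℤ.* + suc n) ⟩
      - ⟦ + suc m ℤ.* + suc n ⟧       ≈⟨ -‿cong (⟦⟧-*-+ (suc m) (suc n)) ⟩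
      - (suc m ×ₙ 1# * suc n ×ₙ 1#)     ≈⟨ -‿distribʳ-* _ _ ⟩
      suc m ×ₙ 1# * - (suc n ×ₙ 1#)     ∎

-- The ring solver with integer coefficients, so that a - a is recognised as 0.
module Solver {c ℓ} (R : CommutativeRing c ℓ) where
  open CommutativeRing R using (refl; reflexive)
  open IntegerMultiples R

  private
    _≟_ : ∀ x y → Maybe (CommutativeRing._≈_ R ⟦ x ⟧ ⟦ y ⟧)
    x ≟ y with x ℤ.≟ y
    ... | yes x≡y = just (reflexive (≡.cong ⟦_⟧ x≡y))
    ... | no _ = nothing

    almostRing = ACR.fromCommutativeRing R

    integers : ℤ.+-*-rawRing ACR.-Raw-AlmostCommutative⟶ almostRing
    integers = record
      { ⟦_⟧ = ⟦_⟧ ; +-homo = ⟦⟧-+ ; *-homo = ⟦⟧-* ; -‿homo = ⟦⟧-neg ; 0-homo = refl ; 1-homo = refl }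

  open RingSolver ℤ.+-*-rawRing almostRing integers _≟_ public
    using (solve; _:=_; con; _:+_; _:*_; _:-_; :-_; _:^_)

-- The commutative ring ℤ[q]

-- A record around _≈ₚ_ from which both polynomials can be inferred.
record _≋_ (p r : Poly) : Set where
  constructor coeffwise
  field at : p ≈ₚ r
open _≋_ public
infix 4 _≋_

coeff-+ : ∀ p r i → coeff (p +ₚ r) i ≡ coeff p i ℤ.+ coeff r i
coeff-+ [] r i = ≡.sym (ℤ.+-identityˡ _)
coeff-+ (a ∷ p) [] i = ≡.sym (ℤ.+-identityʳ _)
coeff-+ (a ∷ p) (b ∷ r) zero = ≡.refl
coeff-+ (a ∷ p) (b ∷ r) (suc i) = coeff-+ p r i

coeff-scale : ∀ c p i → coeff (scaleₚ c p) i ≡ c ℤ.* coeff p i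
coeff-scale c [] i = ≡.sym (ℤ.*-zeroʳ c)
coeff-scale c (a ∷ p) zero = ≡.refl
coeff-scale c (a ∷ p) (suc i) = coeff-scale c p i

≋-refl : ∀ {p} → p ≋ p
≋-refl .at i = ≡.refl

≋-sym : ∀ {p r} → p ≋ r → r ≋ p
≋-sym h .at i = ≡.sym (at h i)

≋-trans : ∀ {p r s} → p ≋ r → r ≋ s → p ≋ s
≋-trans h k .at i = ≡.trans (at h i) (at k i)

+ₚ-cong : ∀ {p p′ r r′} → p ≋ p′ → r ≋ r′ → p +ₚ r ≋ p′ +ₚ r′
+ₚ-cong {p} {p′} {r} {r′} h k .at i =
  ≡.trans (coeff-+ p r i) (≡.trans (≡.cong₂ ℤ._+_ (at h i) (at k i)) (≡.sym (coeff-+ p′ r′ i)))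

scaleₚ-cong : ∀ c {p p′} → p ≋ p′ → scaleₚ c p ≋ scaleₚ c p′
scaleₚ-cong c {p} {p′} h .at i =
  ≡.trans (coeff-scale c p i) (≡.trans (≡.cong (c ℤ.*_) (at h i)) (≡.sym (coeff-scale c p′ i)))

∷-cong : ∀ {a b p r} → a ≡ b → p ≋ r → a ∷ p ≋ b ∷ r
∷-cong a≡b h .at zero = a≡b
∷-cong a≡b h .at (suc i) = at h i

0∷[]≋[] : + 0 ∷ [] ≋ []
0∷[]≋[] .at zero = ≡.refl
0∷[]≋[] .at (suc i) = ≡.refl

+ₚ-assoc : ∀ p r s → (p +ₚ r) +ₚ s ≋ p +ₚ (r +ₚ s)
+ₚ-assoc p r s .at i rewrite coeff-+ (p +ₚ r) s i | coeff-+ p r i | coeff-+ p (r +ₚ s) i | coeff-+ r s i =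
  ℤ.+-assoc (coeff p i) (coeff r i) (coeff s i)

+ₚ-comm : ∀ p r → p +ₚ r ≋ r +ₚ p
+ₚ-comm p r .at i rewrite coeff-+ p r i | coeff-+ r p i = ℤ.+-comm (coeff p i) (coeff r i)

+ₚ-identityʳ : ∀ p → p +ₚ [] ≋ p
+ₚ-identityʳ p .at i = ≡.trans (coeff-+ p [] i) (ℤ.+-identityʳ _)

negₚ-inverseʳ : ∀ p → p +ₚ negₚ p ≋ []
negₚ-inverseʳ p .at i rewrite coeff-+ p (negₚ p) i | coeff-scale (ℤ.- (+ 1)) p i | ℤ.-1*i≡-i (coeff p i) =
  ℤ.+-inverseʳ (coeff p i)

+ₚ-medial : ∀ p r s t → (p +ₚ r) +ₚ (s +ₚ t) ≋ (p +ₚ s) +ₚ (r +ₚ t)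
+ₚ-medial p r s t .at i
  rewrite coeff-+ (p +ₚ r) (s +ₚ t) i | coeff-+ p r i | coeff-+ s t i
        | coeff-+ (p +ₚ s) (r +ₚ t) i | coeff-+ p s i | coeff-+ r t i =
  medial (coeff p i) (coeff r i) (coeff s i) (coeff t i)
  where
  open import Algebra.Properties.CommutativeSemigroup ℤ.+-commutativeSemigroup using ()
    renaming (interchange to medial)

scaleₚ-+ : ∀ c p r → scaleₚ c (p +ₚ r) ≋ scaleₚ c p +ₚ scaleₚ c r
scaleₚ-+ c p r .at i
  rewrite coeff-scale c (p +ₚ r) i | coeff-+ p r i | coeff-+ (scaleₚ c p) (scaleₚ c r) i
        | coeff-scale c p i | coeff-scale c r i = ℤ.*-distribˡ-+ c (coeff p i) (coeff r i)

scaleₚ-scaleₚ : ∀ c d p → scaleₚ c (scaleₚ d p) ≋ scaleₚ (c ℤ.* d) p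
scaleₚ-scaleₚ c d p .at i
  rewrite coeff-scale c (scaleₚ d p) i | coeff-scale d p i | coeff-scale (c ℤ.* d) p i =
  ≡.sym (ℤ.*-assoc c d (coeff p i))

scaleₚ-1 : ∀ p → scaleₚ (+ 1) p ≋ p
scaleₚ-1 p .at i = ≡.trans (coeff-scale (+ 1) p i) (ℤ.*-identityˡ _)

scaleₚ-0 : ∀ p → scaleₚ (+ 0) p ≋ []
scaleₚ-0 p .at i = ≡.trans (coeff-scale (+ 0) p i) (ℤ.*-zeroˡ (coeff p i))

≋-setoid : Setoid 0ℓ 0ℓ
≋-setoid = record
  { Carrier = Poly ; _≈_ = _≋_
  ; isEquivalence = record { refl = ≋-refl ; sym = ≋-sym ; trans = ≋-trans } }
private module ≋-Reasoning = SetoidReasoning ≋-setoid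

0∷-cong : ∀ {p r} → p ≋ r → + 0 ∷ p ≋ + 0 ∷ r
0∷-cong = ∷-cong ≡.refl

*ₚ-zeroʳ : ∀ p → p *ₚ [] ≋ []
*ₚ-zeroʳ [] = ≋-refl
*ₚ-zeroʳ (a ∷ p) = ≋-trans (0∷-cong (*ₚ-zeroʳ p)) 0∷[]≋[]

0∷-* : ∀ p r → (+ 0 ∷ p) *ₚ r ≋ + 0 ∷ (p *ₚ r)
0∷-* p r = +ₚ-cong (scaleₚ-0 r) ≋-refl

*ₚ-congˡ : ∀ p {r r′} → r ≋ r′ → p *ₚ r ≋ p *ₚ r′
*ₚ-congˡ [] h = ≋-refl
*ₚ-congˡ (a ∷ p) h = +ₚ-cong (scaleₚ-cong a h) (0∷-cong (*ₚ-congˡ p h))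

*ₚ-∷ : ∀ p b s → p *ₚ (b ∷ s) ≋ scaleₚ b p +ₚ (+ 0 ∷ (p *ₚ s))
*ₚ-∷ [] b s = ≋-sym 0∷[]≋[]
*ₚ-∷ (a ∷ p) b s = ∷-cong (≡.cong (ℤ._+ + 0) (ℤ.*-comm a b)) (begin
  scaleₚ a s +ₚ (p *ₚ (b ∷ s))                           ≈⟨ +ₚ-cong ≋-refl (*ₚ-∷ p b s) ⟩
  scaleₚ a s +ₚ (scaleₚ b p +ₚ (+ 0 ∷ (p *ₚ s)))          ≈⟨ +ₚ-assoc (scaleₚ a s) (scaleₚ b p) _ ⟨
  scaleₚ a s +ₚ scaleₚ b p +ₚ (+ 0 ∷ (p *ₚ s))            ≈⟨ +ₚ-cong (+ₚ-comm (scaleₚ a s) (scaleₚ b p)) ≋-refl ⟩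
  scaleₚ b p +ₚ scaleₚ a s +ₚ (+ 0 ∷ (p *ₚ s))            ≈⟨ +ₚ-assoc (scaleₚ b p) (scaleₚ a s) _ ⟩
  scaleₚ b p +ₚ (scaleₚ a s +ₚ (+ 0 ∷ (p *ₚ s)))          ∎)
  where open ≋-Reasoning

*ₚ-comm : ∀ p r → p *ₚ r ≋ r *ₚ p
*ₚ-comm [] r = ≋-sym (*ₚ-zeroʳ r)
*ₚ-comm (a ∷ p) r = ≋-trans (+ₚ-cong ≋-refl (0∷-cong (*ₚ-comm p r))) (≋-sym (*ₚ-∷ r a p))

*ₚ-cong : ∀ {p p′ r r′} → p ≋ p′ → r ≋ r′ → p *ₚ r ≋ p′ *ₚ r′
*ₚ-cong {p} {p′} {r} {r′} h k = begin
  p *ₚ r    ≈⟨ *ₚ-congˡ p k ⟩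
  p *ₚ r′   ≈⟨ *ₚ-comm p r′ ⟩
  r′ *ₚ p   ≈⟨ *ₚ-congˡ r′ h ⟩
  r′ *ₚ p′  ≈⟨ *ₚ-comm r′ p′ ⟩
  p′ *ₚ r′  ∎
  where open ≋-Reasoning

*ₚ-distribˡ : ∀ p r s → p *ₚ (r +ₚ s) ≋ p *ₚ r +ₚ p *ₚ s
*ₚ-distribˡ [] r s = ≋-refl
*ₚ-distribˡ (a ∷ p) r s = begin
  scaleₚ a (r +ₚ s) +ₚ (+ 0 ∷ (p *ₚ (r +ₚ s)))
    ≈⟨ +ₚ-cong (scaleₚ-+ a r s) (0∷-cong (*ₚ-distribˡ p r s)) ⟩
  (scaleₚ a r +ₚ scaleₚ a s) +ₚ ((+ 0 ∷ (p *ₚ r)) +ₚ (+ 0 ∷ (p *ₚ s)))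
    ≈⟨ +ₚ-medial (scaleₚ a r) (scaleₚ a s) _ _ ⟩
  (scaleₚ a r +ₚ (+ 0 ∷ (p *ₚ r))) +ₚ (scaleₚ a s +ₚ (+ 0 ∷ (p *ₚ s))) ∎
  where open ≋-Reasoning

*ₚ-distribʳ : ∀ p r s → (r +ₚ s) *ₚ p ≋ r *ₚ p +ₚ s *ₚ p
*ₚ-distribʳ p r s = begin
  (r +ₚ s) *ₚ p       ≈⟨ *ₚ-comm (r +ₚ s) p ⟩
  p *ₚ (r +ₚ s)       ≈⟨ *ₚ-distribˡ p r s ⟩
  p *ₚ r +ₚ p *ₚ s    ≈⟨ +ₚ-cong (*ₚ-comm p r) (*ₚ-comm p s) ⟩
  r *ₚ p +ₚ s *ₚ p    ∎
  where open ≋-Reasoning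

scaleₚ-* : ∀ c p r → scaleₚ c p *ₚ r ≋ scaleₚ c (p *ₚ r)
scaleₚ-* c [] r = ≋-refl
scaleₚ-* c (a ∷ p) r = begin
  scaleₚ (c ℤ.* a) r +ₚ (+ 0 ∷ (scaleₚ c p *ₚ r))
    ≈⟨ +ₚ-cong (≋-sym (scaleₚ-scaleₚ c a r)) (∷-cong (≡.sym (ℤ.*-zeroʳ c)) (scaleₚ-* c p r)) ⟩
  scaleₚ c (scaleₚ a r) +ₚ scaleₚ c (+ 0 ∷ (p *ₚ r))
    ≈⟨ scaleₚ-+ c (scaleₚ a r) (+ 0 ∷ (p *ₚ r)) ⟨
  scaleₚ c (scaleₚ a r +ₚ (+ 0 ∷ (p *ₚ r))) ∎
  where open ≋-Reasoning

*ₚ-assoc : ∀ p r s → (p *ₚ r) *ₚ s ≋ p *ₚ (r *ₚ s)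
*ₚ-assoc [] r s = ≋-refl
*ₚ-assoc (a ∷ p) r s = begin
  (scaleₚ a r +ₚ (+ 0 ∷ (p *ₚ r))) *ₚ s
    ≈⟨ *ₚ-distribʳ s (scaleₚ a r) (+ 0 ∷ (p *ₚ r)) ⟩
  scaleₚ a r *ₚ s +ₚ (+ 0 ∷ (p *ₚ r)) *ₚ s
    ≈⟨ +ₚ-cong (scaleₚ-* a r s) (≋-trans (0∷-* (p *ₚ r) s) (0∷-cong (*ₚ-assoc p r s))) ⟩
  scaleₚ a (r *ₚ s) +ₚ (+ 0 ∷ (p *ₚ (r *ₚ s))) ∎
  where open ≋-Reasoning

constₚ-* : ∀ c p → constₚ c *ₚ p ≋ scaleₚ c p
constₚ-* c p = ≋-trans (+ₚ-cong ≋-refl 0∷[]≋[]) (+ₚ-identityʳ _)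

*ₚ-identityˡ : ∀ p → constₚ (+ 1) *ₚ p ≋ p
*ₚ-identityˡ p = ≋-trans (constₚ-* (+ 1) p) (scaleₚ-1 p)

polyRing : CommutativeRing 0ℓ 0ℓ
polyRing = record
  { Carrier = Poly ; _≈_ = _≋_ ; _+_ = _+ₚ_ ; _*_ = _*ₚ_ ; -_ = negₚ ; 0# = [] ; 1# = constₚ (+ 1)
  ; isCommutativeRing = record
    { isRing = record
      { +-isAbelianGroup = record
        { isGroup = record
          { isMonoid = record
            { isSemigroup = record
              { isMagma = record
                { isEquivalence = record { refl = ≋-refl ; sym = ≋-sym ; trans = ≋-trans }
                ; ∙-cong = +ₚ-cong }
              ; assoc = +ₚ-assoc }
            ; identity = (λ p → ≋-refl) , +ₚ-identityʳ }
          ; inverse = (λ p → ≋-trans (+ₚ-comm (negₚ p) p) (negₚ-inverseʳ p)) , negₚ-inverseʳ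
          ; ⁻¹-cong = scaleₚ-cong (ℤ.- (+ 1)) }
        ; comm = +ₚ-comm }
      ; *-cong = *ₚ-cong
      ; *-assoc = *ₚ-assoc
      ; *-identity = *ₚ-identityˡ , (λ p → ≋-trans (*ₚ-comm p _) (*ₚ-identityˡ p))
      ; distrib = *ₚ-distribˡ , *ₚ-distribʳ }
    ; *-comm = *ₚ-comm } }

-- The localisation of R at the multiplicative set S, modulo the ideal generated by t.
module LocalQuotient {c ℓ s} (R : CommutativeRing c ℓ)
  (S : CommutativeRing.Carrier R → Set s) (S-1 : S (CommutativeRing.1# R))
  (S-* : ∀ {x y} → S x → S y → S (CommutativeRing._*_ R x y)) (t : CommutativeRing.Carrier R) where
  open CommutativeRing R
  open Solver R
  open SetoidReasoning setoid

  record Elem : Set (c ⊔ s) where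
    constructor elem
    field
      num den : Carrier
      den∈S   : S den
  open Elem public

  -- The multiplier `mult` makes the relation transitive: elimination of the middle fraction leaves
  -- its denominator as a factor, and that factor need not be cancellable modulo `t`. It later
  -- becomes part of the multiplier Q in `CongΦ²`.
  record _≃_ (x y : Elem) : Set (c ⊔ ℓ ⊔ s) where
    constructor congruent
    field
      quot mult : Carrier
      mult∈S    : S mult
      equal     : mult * (num x * den y - num y * den x) ≈ t * quot
  open _≃_ public
  infix 4 _≃_

  cross : ∀ {x y} → num x * den y ≈ num y * den x → x ≃ y
  cross {x} {y} h = congruent 0# 1# S-1 (begin
    1# * (num x * den y - num y * den x)  ≈⟨ *-congˡ (+-congʳ h) ⟩
    1# * (num y * den x - num y * den x)  ≈⟨ solve 2 (λ a t → con (+ 1) :* (a :- a) := t :* con (+ 0)) refl _ t ⟩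
    t * 0#                                ∎)

  -- Transitivity and the compatibility of sum and product with `_≃_` all reduce to this: the new
  -- cross difference is a linear combination of the two given ones, each of which has its own
  -- multiplier.
  combination : ∀ {Q₁ Q₂ u v P₁ P₂ w} m n → Q₁ * u ≈ t * P₁ → Q₂ * v ≈ t * P₂ → w ≈ m * u + n * v →
                (Q₁ * Q₂) * w ≈ t * (Q₂ * m * P₁ + Q₁ * n * P₂)
  combination {Q₁} {Q₂} {u} {v} {P₁} {P₂} {w} m n h k e = begin
    Q₁ * Q₂ * w                                  ≈⟨ *-congˡ e ⟩
    Q₁ * Q₂ * (m * u + n * v)                    ≈⟨ solve 6 (λ Q₁ Q₂ m n u v → Q₁ :* Q₂ :* (m :* u :+ n :* v)
                                                     := Q₂ :* m :* (Q₁ :* u) :+ Q₁ :* n :* (Q₂ :* v)) refl Q₁ Q₂ m n u v ⟩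
    Q₂ * m * (Q₁ * u) + Q₁ * n * (Q₂ * v)        ≈⟨ +-cong (*-congˡ h) (*-congˡ k) ⟩
    Q₂ * m * (t * P₁) + Q₁ * n * (t * P₂)        ≈⟨ solve 7 (λ Q₁ Q₂ m n t P₁ P₂ → Q₂ :* m :* (t :* P₁) :+ Q₁ :* n :* (t :* P₂)
                                                     := t :* (Q₂ :* m :* P₁ :+ Q₁ :* n :* P₂)) refl Q₁ Q₂ m n t P₁ P₂ ⟩
    t * (Q₂ * m * P₁ + Q₁ * n * P₂)              ∎

  ≃-refl : ∀ {x} → x ≃ x
  ≃-refl = cross refl

  ≃-sym : ∀ {x y} → x ≃ y → y ≃ x
  ≃-sym {elem a α _} {elem b β _} (congruent P Q s e) = congruent (- P) Q s (begin
    Q * (b * α - a * β)      ≈⟨ solve 5 (λ Q a α b β → Q :* (b :* α :- a :* β) := :- (Q :* (a :* β :- b :* α))) refl Q a α b β ⟩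
    - (Q * (a * β - b * α))  ≈⟨ -‿cong e ⟩
    - (t * P)                ≈⟨ solve 2 (λ t P → :- (t :* P) := t :* (:- P)) refl t P ⟩
    t * - P                  ∎)

  ≃-trans : ∀ {x y z} → x ≃ y → y ≃ z → x ≃ z
  ≃-trans {elem a α _} {elem b β sβ} {elem c γ _} (congruent P₁ Q₁ s₁ e₁) (congruent P₂ Q₂ s₂ e₂) =
    congruent _ (Q₁ * Q₂ * β) (S-* (S-* s₁ s₂) sβ)
      (trans (*-assoc (Q₁ * Q₂) β _) (combination γ α e₁ e₂
        (solve 6 (λ a α b β c γ → β :* (a :* γ :- c :* α) := γ :* (a :* β :- b :* α) :+ α :* (b :* γ :- c :* β))
          refl a α b β c γ)))

  infixl 6 _⊕_
  infixl 7 _⊛_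

  _⊕_ _⊛_ : Elem → Elem → Elem
  elem a α s ⊕ elem b β s′ = elem (a * β + b * α) (α * β) (S-* s s′)
  elem a α s ⊛ elem b β s′ = elem (a * b) (α * β) (S-* s s′)

  ⊖_ : Elem → Elem
  ⊖ elem a α s = elem (- a) α s

  embed : Carrier → Elem
  embed a = elem a 1# S-1

  ⊕-cong : ∀ {x x′ y y′} → x ≃ x′ → y ≃ y′ → x ⊕ y ≃ x′ ⊕ y′
  ⊕-cong {elem a α _} {elem a′ α′ _} {elem b β _} {elem b′ β′ _} (congruent _ _ s₁ e₁) (congruent _ _ s₂ e₂) =
    congruent _ _ (S-* s₁ s₂) (combination (β * β′) (α * α′) e₁ e₂
      (solve 8 (λ a α a′ α′ b β b′ β′ → (a :* β :+ b :* α) :* (α′ :* β′) :- (a′ :* β′ :+ b′ :* α′) :* (α :* β)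
         := β :* β′ :* (a :* α′ :- a′ :* α) :+ α :* α′ :* (b :* β′ :- b′ :* β)) refl a α a′ α′ b β b′ β′))

  ⊛-cong : ∀ {x x′ y y′} → x ≃ x′ → y ≃ y′ → x ⊛ y ≃ x′ ⊛ y′
  ⊛-cong {elem a α _} {elem a′ α′ _} {elem b β _} {elem b′ β′ _} (congruent _ _ s₁ e₁) (congruent _ _ s₂ e₂) =
    congruent _ _ (S-* s₁ s₂) (combination (b * β′) (a′ * α) e₁ e₂
      (solve 8 (λ a α a′ α′ b β b′ β′ → (a :* b) :* (α′ :* β′) :- (a′ :* b′) :* (α :* β)
         := b :* β′ :* (a :* α′ :- a′ :* α) :+ a′ :* α :* (b :* β′ :- b′ :* β)) refl a α a′ α′ b β b′ β′))

  ⊖-cong : ∀ {x y} → x ≃ y → ⊖ x ≃ ⊖ y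
  ⊖-cong {elem a α _} {elem b β _} (congruent P Q s e) = congruent (- P) Q s (begin
    Q * (- a * β - - b * α)  ≈⟨ solve 5 (λ Q a α b β → Q :* (:- a :* β :- :- b :* α) := :- (Q :* (a :* β :- b :* α))) refl Q a α b β ⟩
    - (Q * (a * β - b * α))  ≈⟨ -‿cong e ⟩
    - (t * P)                ≈⟨ solve 2 (λ t P → :- (t :* P) := t :* (:- P)) refl t P ⟩
    t * - P                  ∎)

  ⊕-assoc : ∀ x y z → (x ⊕ y) ⊕ z ≃ x ⊕ (y ⊕ z)
  ⊕-assoc (elem a α _) (elem b β _) (elem c γ _) = cross (solve 6 (λ a α b β c γ →
    ((a :* β :+ b :* α) :* γ :+ c :* (α :* β)) :* (α :* (β :* γ))
    := (a :* (β :* γ) :+ (b :* γ :+ c :* β) :* α) :* (α :* β :* γ)) refl a α b β c γ)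

  ⊕-comm : ∀ x y → x ⊕ y ≃ y ⊕ x
  ⊕-comm (elem a α _) (elem b β _) = cross (solve 4 (λ a α b β →
    (a :* β :+ b :* α) :* (β :* α) := (b :* α :+ a :* β) :* (α :* β)) refl a α b β)

  ⊕-identityˡ : ∀ x → embed 0# ⊕ x ≃ x
  ⊕-identityˡ (elem a α _) = cross (solve 2 (λ a α →
    (con (+ 0) :* α :+ a :* con (+ 1)) :* α := a :* (con (+ 1) :* α)) refl a α)

  ⊖-inverseʳ : ∀ x → x ⊕ ⊖ x ≃ embed 0#
  ⊖-inverseʳ (elem a α _) = cross (solve 2 (λ a α →
    (a :* α :+ :- a :* α) :* con (+ 1) := con (+ 0) :* (α :* α)) refl a α)

  ⊛-assoc : ∀ x y z → (x ⊛ y) ⊛ z ≃ x ⊛ (y ⊛ z)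
  ⊛-assoc (elem a α _) (elem b β _) (elem c γ _) = cross (solve 6 (λ a α b β c γ →
    (a :* b :* c) :* (α :* (β :* γ)) := (a :* (b :* c)) :* (α :* β :* γ)) refl a α b β c γ)

  ⊛-comm : ∀ x y → x ⊛ y ≃ y ⊛ x
  ⊛-comm (elem a α _) (elem b β _) = cross (solve 4 (λ a α b β →
    (a :* b) :* (β :* α) := (b :* a) :* (α :* β)) refl a α b β)

  ⊛-identityˡ : ∀ x → embed 1# ⊛ x ≃ x
  ⊛-identityˡ (elem a α _) = cross (solve 2 (λ a α →
    (con (+ 1) :* a) :* α := a :* (con (+ 1) :* α)) refl a α)

  ⊛-distribˡ : ∀ x y z → x ⊛ (y ⊕ z) ≃ x ⊛ y ⊕ x ⊛ z
  ⊛-distribˡ (elem a α _) (elem b β _) (elem c γ _) = cross (solve 6 (λ a α b β c γ →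
    (a :* (b :* γ :+ c :* β)) :* ((α :* β) :* (α :* γ))
    := (a :* b :* (α :* γ) :+ a :* c :* (α :* β)) :* (α :* (β :* γ))) refl a α b β c γ)

  localRing : CommutativeRing (c ⊔ s) (c ⊔ ℓ ⊔ s)
  localRing = record
    { Carrier = Elem ; _≈_ = _≃_ ; _+_ = _⊕_ ; _*_ = _⊛_ ; -_ = ⊖_ ; 0# = embed 0# ; 1# = embed 1#
    ; isCommutativeRing = record
      { isRing = record
        { +-isAbelianGroup = record
          { isGroup = record
            { isMonoid = record
              { isSemigroup = record
                { isMagma = record
                  { isEquivalence = record { refl = ≃-refl ; sym = ≃-sym ; trans = ≃-trans }
                  ; ∙-cong = ⊕-cong }
                ; assoc = ⊕-assoc }
              ; identity = ⊕-identityˡ , (λ x → ≃-trans (⊕-comm x _) (⊕-identityˡ x)) }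
            ; inverse = (λ x → ≃-trans (⊕-comm (⊖ x) x) (⊖-inverseʳ x)) , ⊖-inverseʳ
            ; ⁻¹-cong = ⊖-cong }
          ; comm = ⊕-comm }
        ; *-cong = ⊛-cong
        ; *-assoc = ⊛-assoc
        ; *-identity = ⊛-identityˡ , (λ x → ≃-trans (⊛-comm x _) (⊛-identityˡ x))
        ; distrib = ⊛-distribˡ , (λ x y z → ≃-trans (⊛-comm (y ⊕ z) x)
            (≃-trans (⊛-distribˡ x y z) (⊕-cong (⊛-comm x y) (⊛-comm x z)))) }
      ; *-comm = ⊛-comm } }

  embed-cong : ∀ {a b} → a ≈ b → embed a ≃ embed b
  embed-cong a≈b = cross (*-congʳ a≈b)

  embed-+ : ∀ a b → embed (a + b) ≃ embed a ⊕ embed b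
  embed-+ a b = cross (solve 2 (λ a b → (a :+ b) :* (con (+ 1) :* con (+ 1))
    := (a :* con (+ 1) :+ b :* con (+ 1)) :* con (+ 1)) refl a b)

  embed-* : ∀ a b → embed (a * b) ≃ embed a ⊛ embed b
  embed-* a b = cross (solve 2 (λ a b → (a :* b) :* (con (+ 1) :* con (+ 1)) := (a :* b) :* con (+ 1)) refl a b)

-- Finite sums

module Sums {c ℓ} (R : CommutativeRing c ℓ) where
  open CommutativeRing R hiding (zero)
  open Solver R

  ∑ : ℕ → (ℕ → Carrier) → Carrier
  ∑ zero f = 0#
  ∑ (suc n) f = f 0 + ∑ n (λ i → f (suc i))

  ∑-cong : ∀ n {f g : ℕ → Carrier} → (∀ i → i < n → f i ≈ g i) → ∑ n f ≈ ∑ n g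
  ∑-cong zero h = refl
  ∑-cong (suc n) h = +-cong (h 0 (s≤s z≤n)) (∑-cong n (λ i i<n → h (suc i) (s≤s i<n)))

  ∑-zero : ∀ n {f : ℕ → Carrier} → (∀ i → f i ≈ 0#) → ∑ n f ≈ 0#
  ∑-zero zero h = refl
  ∑-zero (suc n) h = trans (+-cong (h 0) (∑-zero n (λ i → h (suc i)))) (+-identityˡ 0#)

  ∑-*ˡ : ∀ n x {f : ℕ → Carrier} → ∑ n (λ i → x * f i) ≈ x * ∑ n f
  ∑-*ˡ zero x = sym (zeroʳ x)
  ∑-*ˡ (suc n) x = trans (+-congˡ (∑-*ˡ n x)) (sym (distribˡ x _ _))

  ∑-minus : ∀ n x {f g h : ℕ → Carrier} → (∀ i → f i ≈ g i - x * h i) → ∑ n f ≈ ∑ n g - x * ∑ n h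
  ∑-minus zero x e = solve 1 (λ x → con (+ 0) := con (+ 0) :- x :* con (+ 0)) refl x
  ∑-minus (suc n) x {f} {g} {h} e = trans (+-cong (e 0) (∑-minus n x (λ i → e (suc i))))
    (solve 5 (λ g G x h H → g :- x :* h :+ (G :- x :* H) := g :+ G :- x :* (h :+ H)) refl
      (g 0) (∑ n (λ i → g (suc i))) x (h 0) (∑ n (λ i → h (suc i))))

  ∑-snoc : ∀ n (f : ℕ → Carrier) → ∑ (suc n) f ≈ ∑ n f + f n
  ∑-snoc zero f = +-comm (f 0) 0#
  ∑-snoc (suc n) f = trans (+-congˡ (∑-snoc n (f ∘ suc))) (sym (+-assoc _ _ _))

  -- Puts the summand k = D of t₁′ in front and numbers the others by their distance j from it.
  ∑-reverse : ∀ n (f : ℕ → Carrier) → ∑ (suc n) f ≈ f n + ∑ n (λ i → f (n ∸ suc i))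
  ∑-reverse zero f = refl
  ∑-reverse (suc n) f = trans (+-congˡ (∑-reverse n (f ∘ suc))) (trans
    (solve 3 (λ a b d → a :+ (b :+ d) := b :+ (d :+ a)) refl (f 0) (f (suc n)) _)
    (+-congˡ (sym (trans (∑-snoc n (λ i → f (n ∸ i))) (+-cong
      (∑-cong n (λ i i<n → reflexive (≡.cong f (ℕ.+-∸-assoc 1 i<n))))
      (reflexive (≡.cong f (ℕ.n∸n≡0 n))))))))

  sign : ℕ → Carrier
  sign zero = 1#
  sign (suc k) = - sign k

-- Gaussian binomial coefficients

module Gaussian {c ℓ} (R : CommutativeRing c ℓ) (x : CommutativeRing.Carrier R) where
  open CommutativeRing R hiding (zero)
  open Exponents commutativeSemiring using (_^_; ^-homo-*)
  open Solver R
  open SetoidReasoning setoid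

  ⟪_⟫ : ℕ → Carrier
  ⟪ n ⟫ = 1# - x ^ n

  SquareZero : ℕ → Set ℓ
  SquareZero n = ⟪ n ⟫ * ⟪ n ⟫ ≈ 0#

  Invertible : ℕ → Set (c ⊔ ℓ)
  Invertible n = Σ Carrier λ u → ⟪ n ⟫ * u ≈ 1#

  -- Pascal's rule gives a value in every ring, also where the denominator of the quotient formula
  -- is not invertible.
  gauss : ℕ → ℕ → Carrier
  gauss n zero = 1#
  gauss zero (suc k) = 0#
  gauss (suc n) (suc k) = gauss n k + x ^ suc k * gauss n (suc k)

  ⟪+⟫ : ∀ m n → ⟪ m ⟫ + x ^ m * ⟪ n ⟫ ≈ ⟪ m ℕ.+ n ⟫
  ⟪+⟫ m n = trans
    (solve 2 (λ u v → con (+ 1) :- u :+ u :* (con (+ 1) :- v) := con (+ 1) :- u :* v) refl (x ^ m) (x ^ n))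
    (+-congˡ (-‿cong (sym (^-homo-* x m n))))

  gauss-> : ∀ {n k} → n < k → gauss n k ≈ 0#
  gauss-> {zero} {suc k} _ = refl
  gauss-> {suc n} {suc k} (s≤s n<k) = begin
    gauss n k + x ^ suc k * gauss n (suc k)  ≈⟨ +-cong (gauss-> n<k) (*-congˡ (gauss-> (ℕ.m<n⇒m<1+n n<k))) ⟩
    0# + x ^ suc k * 0#                      ≈⟨ solve 1 (λ y → con (+ 0) :+ y :* con (+ 0) := con (+ 0)) refl (x ^ suc k) ⟩
    0#                                       ∎

  gauss-diagonal : ∀ n → gauss n n ≈ 1#
  gauss-diagonal zero = refl
  gauss-diagonal (suc n) = begin
    gauss n n + x ^ suc n * gauss n (suc n)  ≈⟨ +-cong (gauss-diagonal n) (*-congˡ (gauss-> (ℕ.n<1+n n))) ⟩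
    1# + x ^ suc n * 0#                      ≈⟨ solve 1 (λ y → con (+ 1) :+ y :* con (+ 0) := con (+ 1)) refl (x ^ suc n) ⟩
    1#                                       ∎

  private
    -- The identity (k+1) + (n-k) = n+1 fails for truncated subtraction when n < k; there the factor
    -- `y` is zero and so are both sides.
    split : ∀ n k y → (n < k → y ≈ 0#) → y * (⟪ suc k ⟫ + x ^ suc k * ⟪ n ∸ k ⟫) ≈ y * ⟪ suc n ⟫
    split n k y y≈0 with k ℕ.≤? n
    ... | yes k≤n = *-congˡ (trans (⟪+⟫ (suc k) (n ∸ k)) (reflexive (≡.cong (λ m → ⟪ suc m ⟫) (ℕ.m+[n∸m]≡n k≤n))))
    ... | no k≰n = trans (*-congʳ y≈0′) (trans (zeroˡ _) (sym (trans (*-congʳ y≈0′) (zeroˡ _))))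
      where y≈0′ = y≈0 (ℕ.≰⇒> k≰n)

  mutual
    -- q-analogues of (k+1) C(n+1, k+1) = (n+1) C(n, k) and (k+1) C(n, k+1) = (n-k) C(n, k), which
    -- stand in for the quotient formula. By Pascal's rule, absorption at n follows from lowering at
    -- n, and lowering at n+1 from both at n.
    gauss-absorb : ∀ n k → gauss (suc n) (suc k) * ⟪ suc k ⟫ ≈ gauss n k * ⟪ suc n ⟫
    gauss-absorb n k = begin
      (gauss n k + x ^ suc k * gauss n (suc k)) * ⟪ suc k ⟫
        ≈⟨ solve 4 (λ g y h z → (g :+ y :* h) :* z := g :* z :+ y :* (h :* z)) refl
             (gauss n k) (x ^ suc k) (gauss n (suc k)) ⟪ suc k ⟫ ⟩
      gauss n k * ⟪ suc k ⟫ + x ^ suc k * (gauss n (suc k) * ⟪ suc k ⟫)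
        ≈⟨ +-congˡ (*-congˡ (gauss-lower n k)) ⟩
      gauss n k * ⟪ suc k ⟫ + x ^ suc k * (gauss n k * ⟪ n ∸ k ⟫)
        ≈⟨ solve 4 (λ g y h z → g :* z :+ y :* (g :* h) := g :* (z :+ y :* h)) refl
             (gauss n k) (x ^ suc k) ⟪ n ∸ k ⟫ ⟪ suc k ⟫ ⟩
      gauss n k * (⟪ suc k ⟫ + x ^ suc k * ⟪ n ∸ k ⟫)
        ≈⟨ split n k (gauss n k) gauss-> ⟩
      gauss n k * ⟪ suc n ⟫ ∎

    gauss-lower : ∀ n k → gauss n (suc k) * ⟪ suc k ⟫ ≈ gauss n k * ⟪ n ∸ k ⟫
    gauss-lower zero k = begin
      0# * ⟪ suc k ⟫            ≈⟨ zeroˡ _ ⟩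
      0#                        ≈⟨ solve 1 (λ g → con (+ 0) := g :* (con (+ 1) :- con (+ 1))) refl (gauss 0 k) ⟩
      gauss 0 k * ⟪ 0 ⟫         ≡⟨ ≡.cong (λ m → gauss 0 k * ⟪ m ⟫) (ℕ.0∸n≡0 k) ⟨
      gauss 0 k * ⟪ 0 ∸ k ⟫     ∎
    gauss-lower (suc n) zero = gauss-absorb n zero
    gauss-lower (suc n) (suc k) = begin
      gauss (suc n) (suc (suc k)) * ⟪ suc (suc k) ⟫
        ≈⟨ gauss-absorb n (suc k) ⟩
      gauss n (suc k) * ⟪ suc n ⟫
        ≈⟨ split n k (gauss n (suc k)) (λ n<k → gauss-> (ℕ.m<n⇒m<1+n n<k)) ⟨
      gauss n (suc k) * (⟪ suc k ⟫ + x ^ suc k * ⟪ n ∸ k ⟫)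
        ≈⟨ solve 4 (λ g y h z → g :* (z :+ y :* h) := g :* z :+ y :* g :* h) refl
             (gauss n (suc k)) (x ^ suc k) ⟪ n ∸ k ⟫ ⟪ suc k ⟫ ⟩
      gauss n (suc k) * ⟪ suc k ⟫ + x ^ suc k * gauss n (suc k) * ⟪ n ∸ k ⟫
        ≈⟨ +-congʳ (gauss-lower n k) ⟩
      gauss n k * ⟪ n ∸ k ⟫ + x ^ suc k * gauss n (suc k) * ⟪ n ∸ k ⟫
        ≈⟨ distribʳ ⟪ n ∸ k ⟫ _ _ ⟨
      (gauss n k + x ^ suc k * gauss n (suc k)) * ⟪ n ∸ k ⟫ ∎

  -- The lowering identity h (1 - x^(k+1)) = g (1 - x^(n-k)), expanded, converts one Pascal rule
  -- into the other without a division.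
  gauss-pascal′ : ∀ n k → gauss (suc n) (suc k) ≈ x ^ (n ∸ k) * gauss n k + gauss n (suc k)
  gauss-pascal′ n k = begin
    g + y * h                   ≈⟨ solve 3 (λ g y h → g :+ y :* h := g :+ h :- h :* (con (+ 1) :- y)) refl g y h ⟩
    g + h - h * ⟪ suc k ⟫       ≈⟨ +-congˡ (-‿cong (gauss-lower n k)) ⟩
    g + h - g * ⟪ n ∸ k ⟫       ≈⟨ solve 3 (λ g z h → g :+ h :- g :* (con (+ 1) :- z) := z :* g :+ h) refl g (x ^ (n ∸ k)) h ⟩
    x ^ (n ∸ k) * g + h         ∎
    where
    g = gauss n k
    h = gauss n (suc k)
    y = x ^ suc k

  -- Reflection exchanges the two Pascal rules. It is needed because the summand k = D contains
  -- [an; D], whereas the right side of the theorem has [an; bn].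
  gauss-sym : ∀ n i j → i ℕ.+ j ≡ n → gauss n i ≈ gauss n j
  gauss-sym n zero j ≡.refl = sym (gauss-diagonal n)
  gauss-sym n (suc i) zero e rewrite ≡.sym (≡.trans (≡.sym (ℕ.+-identityʳ (suc i))) e) = gauss-diagonal (suc i)
  gauss-sym (suc n) (suc i) (suc j) e = begin
    gauss n i + x ^ suc i * gauss n (suc i)        ≈⟨ +-cong (gauss-sym n i (suc j) e₁) (*-congˡ (gauss-sym n (suc i) j e₂)) ⟩
    gauss n (suc j) + x ^ suc i * gauss n j        ≈⟨ +-comm _ _ ⟩
    x ^ suc i * gauss n j + gauss n (suc j)        ≡⟨ ≡.cong (λ m → x ^ m * gauss n j + gauss n (suc j)) e₃ ⟨
    x ^ (n ∸ j) * gauss n j + gauss n (suc j)      ≈⟨ gauss-pascal′ n j ⟨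
    gauss (suc n) (suc j)                          ∎
    where
    e₁ : i ℕ.+ suc j ≡ n
    e₁ = ℕ.suc-injective e
    e₂ : suc i ℕ.+ j ≡ n
    e₂ = ≡.trans (≡.sym (ℕ.+-suc i j)) e₁
    e₃ : n ∸ j ≡ suc i
    e₃ rewrite ≡.sym e₂ = ℕ.m+n∸n≡m (suc i) j

-- The alternating sums A_N and the value of ϑ

-- pent m = m(3m-1)/2
pent : ℕ → ℕ
pent zero = 0
pent (suc m) = pent m ℕ.+ suc (m ℕ.* 3)

module Theta {c ℓ} (R : CommutativeRing c ℓ) (q p : CommutativeRing.Carrier R)
  (p*q≈1 : CommutativeRing._≈_ R (CommutativeRing._*_ R p q) (CommutativeRing.1# R)) where
  open CommutativeRing R hiding (zero)
  open Exponents commutativeSemiring using (_^_; ^-homo-*)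
  open Solver R
  open SetoidReasoning setoid
  open Sums R
  open Gaussian R p

  cancel-pq : ∀ l → p ^ l * q ^ l ≈ 1#
  cancel-pq zero = *-identityˡ 1#
  cancel-pq (suc l) = begin
    p * p ^ l * (q * q ^ l)    ≈⟨ solve 4 (λ p P q Q → p :* P :* (q :* Q) := p :* q :* (P :* Q)) refl p (p ^ l) q (q ^ l) ⟩
    p * q * (p ^ l * q ^ l)    ≈⟨ *-cong p*q≈1 (cancel-pq l) ⟩
    1# * 1#                    ≈⟨ *-identityˡ 1# ⟩
    1#                         ∎

  cancel-one : ∀ i j → p ^ suc i * q ^ suc j ≈ p ^ i * q ^ j
  cancel-one i j = trans (solve 4 (λ p P q Q → p :* P :* (q :* Q) := p :* q :* (P :* Q)) refl p (p ^ i) q (q ^ j))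
    (trans (*-congʳ p*q≈1) (*-identityˡ _))

  -- τ k = (-1)^k p^(k(k-1)/2)
  τ : ℕ → Carrier
  τ zero = 1#
  τ (suc k) = - (p ^ k * τ k)

  -- `M` is the number of terms. Terms with 2k > N vanish, so each `M` with 2M > N gives the same
  -- A_N; a free `M` lets the recurrence lose a term with every step. `C` is the companion sum that
  -- the second Pascal rule creates and the first one removes.
  A C : ℕ → ℕ → Carrier
  A M N = ∑ M (λ k → τ k * gauss (N ∸ k) k)
  C M N = ∑ M (λ k → τ k * q ^ k * gauss (N ∸ k) k)

  private
    0≈0-x*0 : ∀ a b x → a * 0# ≈ b * 0# - x * 0#
    0≈0-x*0 = solve 3 (λ a b x → a :* con (+ 0) := b :* con (+ 0) :- x :* con (+ 0)) refl

    beyond : ∀ {N l} → N < l → gauss (suc N ∸ l) (suc l) ≈ 0# × gauss (N ∸ l) (suc l) ≈ 0# × gauss (N ∸ l) l ≈ 0#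
    beyond {N} {suc l} N<l rewrite ℕ.m≤n⇒m∸n≡0 (ℕ.≤-pred N<l) | ℕ.m≤n⇒m∸n≡0 (ℕ.<⇒≤ N<l) =
      refl , refl , refl

    -- For 2l ≤ N the exponents add up to l + (N - 2l) = N - l, and p^(N-l) = p^N q^l separates the
    -- constant power from the weight q^l of `C`. For 2l > N the Gaussian binomial is zero.
    shift : ∀ N l → l ≤ N → p ^ l * (p ^ (N ∸ l ∸ l) * gauss (N ∸ l) l) ≈ p ^ N * q ^ l * gauss (N ∸ l) l
    shift N l l≤N with l ℕ.≤? N ∸ l
    ... | yes l≤ = begin
      p ^ l * (p ^ (N ∸ l ∸ l) * g)         ≈⟨ *-assoc _ _ _ ⟨
      p ^ l * p ^ (N ∸ l ∸ l) * g           ≈⟨ *-congʳ (^-homo-* p l (N ∸ l ∸ l)) ⟨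
      p ^ (l ℕ.+ (N ∸ l ∸ l)) * g           ≡⟨ ≡.cong (λ m → p ^ m * g) (ℕ.m+[n∸m]≡n l≤) ⟩
      p ^ (N ∸ l) * g                       ≈⟨ *-congʳ (*-identityʳ _) ⟨
      p ^ (N ∸ l) * 1# * g                  ≈⟨ *-congʳ (*-congˡ (cancel-pq l)) ⟨
      p ^ (N ∸ l) * (p ^ l * q ^ l) * g     ≈⟨ *-congʳ (*-assoc _ _ _) ⟨
      p ^ (N ∸ l) * p ^ l * q ^ l * g       ≈⟨ *-congʳ (*-congʳ (^-homo-* p (N ∸ l) l)) ⟨
      p ^ (N ∸ l ℕ.+ l) * q ^ l * g         ≡⟨ ≡.cong (λ m → p ^ m * q ^ l * g) (ℕ.m∸n+n≡m l≤N) ⟩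
      p ^ N * q ^ l * g                     ∎
      where g = gauss (N ∸ l) l
    ... | no l≰ = begin
      p ^ l * (p ^ (N ∸ l ∸ l) * gauss (N ∸ l) l)   ≈⟨ *-congˡ (*-congˡ g≈0) ⟩
      p ^ l * (p ^ (N ∸ l ∸ l) * 0#)                ≈⟨ solve 3 (λ a b d → a :* (b :* con (+ 0)) := d :* con (+ 0)) refl
                                                         (p ^ l) (p ^ (N ∸ l ∸ l)) (p ^ N * q ^ l) ⟩
      p ^ N * q ^ l * 0#                            ≈⟨ *-congˡ g≈0 ⟨
      p ^ N * q ^ l * gauss (N ∸ l) l               ∎
      where g≈0 = gauss-> (ℕ.≰⇒> l≰)

  -- `gauss-pascal′` is the rule to use here: its power of p and the p^l gained by `τ` combine to
  -- p^N q^l, whose first factor does not depend on the summation index.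
  A-step : ∀ M N → A (suc M) (2 ℕ.+ N) ≈ A (suc M) (suc N) - p ^ N * C M N
  A-step M N = trans (+-congˡ (∑-minus M (p ^ N) step)) (sym (+-assoc _ _ _))
    where
    step : ∀ l → τ (suc l) * gauss (suc N ∸ l) (suc l)
             ≈ τ (suc l) * gauss (N ∸ l) (suc l) - p ^ N * (τ l * q ^ l * gauss (N ∸ l) l)
    step l with l ℕ.≤? N
    ... | yes l≤N rewrite ℕ.+-∸-assoc 1 l≤N = begin
      τ (suc l) * gauss (suc m) (suc l)
        ≈⟨ *-congˡ (gauss-pascal′ m l) ⟩
      - (p ^ l * τ l) * (p ^ (m ∸ l) * gauss m l + gauss m (suc l))
        ≈⟨ solve 5 (λ P t Q g h → :- (P :* t) :* (Q :* g :+ h) := :- (P :* t) :* h :- t :* (P :* (Q :* g))) refl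
             (p ^ l) (τ l) (p ^ (m ∸ l)) (gauss m l) (gauss m (suc l)) ⟩
      τ (suc l) * gauss m (suc l) - τ l * (p ^ l * (p ^ (m ∸ l) * gauss m l))
        ≈⟨ +-congˡ (-‿cong (*-congˡ (shift N l l≤N))) ⟩
      τ (suc l) * gauss m (suc l) - τ l * (p ^ N * q ^ l * gauss m l)
        ≈⟨ +-congˡ (-‿cong (solve 4 (λ t P Q g → t :* (P :* Q :* g) := P :* (t :* Q :* g)) refl
             (τ l) (p ^ N) (q ^ l) (gauss m l))) ⟩
      τ (suc l) * gauss m (suc l) - p ^ N * (τ l * q ^ l * gauss m l) ∎
      where m = N ∸ l
    ... | no l≰N with beyond (ℕ.≰⇒> l≰N)
    ...   | z₁ , z₂ , z₃ = trans (*-congˡ z₁) (trans (0≈0-x*0 _ _ (p ^ N)) (sym (+-cong (*-congˡ z₂) (-‿cong (*-congˡ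
              (trans (*-congˡ z₃) (zeroʳ _)))))))

  -- Here the defining Pascal rule fits: its p^(l+1) cancels the weight q^(l+1), so that only sums
  -- of type `A` remain.
  C-step : ∀ M N → C (suc M) (2 ℕ.+ N) ≈ A (suc M) (suc N) - q * A M N
  C-step M N = trans (+-cong (*-congʳ (*-identityʳ 1#)) (∑-minus M q step)) (sym (+-assoc _ _ _))
    where
    step : ∀ l → τ (suc l) * q ^ suc l * gauss (suc N ∸ l) (suc l)
             ≈ τ (suc l) * gauss (N ∸ l) (suc l) - q * (τ l * gauss (N ∸ l) l)
    step l with l ℕ.≤? N
    ... | yes l≤N rewrite ℕ.+-∸-assoc 1 l≤N = begin
      - (p ^ l * τ l) * (q * q ^ l) * (gauss m l + p * p ^ l * gauss m (suc l))
        ≈⟨ solve 7 (λ P t q Q g p h → :- (P :* t) :* (q :* Q) :* (g :+ p :* P :* h)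
             := :- (P :* t) :* (p :* q) :* (P :* Q) :* h :- q :* (P :* Q) :* (t :* g)) refl
             (p ^ l) (τ l) q (q ^ l) (gauss m l) p (gauss m (suc l)) ⟩
      - (p ^ l * τ l) * (p * q) * (p ^ l * q ^ l) * gauss m (suc l) - q * (p ^ l * q ^ l) * (τ l * gauss m l)
        ≈⟨ +-cong (*-congʳ (*-cong (*-congˡ p*q≈1) (cancel-pq l))) (-‿cong (*-congʳ (*-congˡ (cancel-pq l)))) ⟩
      - (p ^ l * τ l) * 1# * 1# * gauss m (suc l) - q * 1# * (τ l * gauss m l)
        ≈⟨ solve 4 (λ s h q g → s :* con (+ 1) :* con (+ 1) :* h :- q :* con (+ 1) :* g := s :* h :- q :* g) refl
             (τ (suc l)) (gauss m (suc l)) q (τ l * gauss m l) ⟩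
      τ (suc l) * gauss m (suc l) - q * (τ l * gauss m l) ∎
      where m = N ∸ l
    ... | no l≰N with beyond (ℕ.≰⇒> l≰N)
    ...   | z₁ , z₂ , z₃ = trans (*-congˡ z₁) (trans (0≈0-x*0 _ _ q) (sym (+-cong (*-congˡ z₂) (-‿cong (*-congˡ
              (trans (*-congˡ z₃) (zeroʳ _)))))))

  A-recurrence : ∀ M N → A (2 ℕ.+ M) (4 ℕ.+ N) ≈
    A (2 ℕ.+ M) (3 ℕ.+ N) - p ^ (2 ℕ.+ N) * A (suc M) (suc N) + p ^ suc N * A M N
  A-recurrence M N = begin
    A (2 ℕ.+ M) (4 ℕ.+ N)
      ≈⟨ A-step (suc M) (2 ℕ.+ N) ⟩
    A₃ - p ^ (2 ℕ.+ N) * C (suc M) (2 ℕ.+ N)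
      ≈⟨ +-congˡ (-‿cong (*-congˡ (C-step M N))) ⟩
    A₃ - p * p ^ suc N * (A₁ - q * A₀)
      ≈⟨ solve 6 (λ a p P b q d → a :- p :* P :* (b :- q :* d) := a :- p :* P :* b :+ (p :* q) :* (P :* d)) refl
           A₃ p (p ^ suc N) A₁ q A₀ ⟩
    A₃ - p ^ (2 ℕ.+ N) * A₁ + p * q * (p ^ suc N * A₀)
      ≈⟨ +-congˡ (trans (*-congʳ p*q≈1) (*-identityˡ _)) ⟩
    A₃ - p ^ (2 ℕ.+ N) * A₁ + p ^ suc N * A₀ ∎
    where
    A₃ = A (2 ℕ.+ M) (3 ℕ.+ N)
    A₁ = A (suc M) (suc N)
    A₀ = A M N

  -- ω m = (-1)^m p^(m(3m-1)/2)
  ω : ℕ → Carrier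
  ω zero = 1#
  ω (suc m) = - (ω m * p ^ suc (m ℕ.* 3))

  private
    tail≈0 : ∀ M {f : ℕ → Carrier} {n k : ℕ → ℕ} → (∀ l → n l < k l) → ∑ M (λ l → f l * gauss (n l) (k l)) ≈ 0#
    tail≈0 M n<k = ∑-zero M (λ l → trans (*-congˡ (gauss-> (n<k l))) (zeroʳ _))

  -- The recurrence has order four, so the induction carries four consecutive values; the last one
  -- is `value₀` of the next stage. Each bound N < 2M says that all terms with 2k ≤ N are included.
  record Values (m : ℕ) : Set ℓ where
    field
      value₀ : ∀ M → m ℕ.* 3 < M ℕ.+ M → A M (m ℕ.* 3) ≈ ω m
      value₁ : ∀ M → 1 ℕ.+ m ℕ.* 3 < M ℕ.+ M → A M (1 ℕ.+ m ℕ.* 3) ≈ ω m * p ^ m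
      value₂ : ∀ M → 2 ℕ.+ m ℕ.* 3 < M ℕ.+ M → A M (2 ℕ.+ m ℕ.* 3) ≈ 0#
      value₃ : ∀ M → 3 ℕ.+ m ℕ.* 3 < M ℕ.+ M → A M (3 ℕ.+ m ℕ.* 3) ≈ ω (suc m)
  open Values public

  private
    unfold : ∀ {N} M → 4 ℕ.+ N < M ℕ.+ M → Σ ℕ λ M′ → M ≡ 2 ℕ.+ M′ × N < M′ ℕ.+ M′
    unfold zero ()
    unfold (suc zero) (s≤s (s≤s ()))
    unfold {N} (suc (suc M)) N<M = M , ≡.refl , ℕ.+-cancelˡ-< 4 N (M ℕ.+ M)
      (≡.subst (4 ℕ.+ N <_) (≡.trans (≡.cong (2 ℕ.+_) (ℕ.+-suc M (suc M))) (≡.cong (3 ℕ.+_) (ℕ.+-suc M M))) N<M)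

    down : ∀ {N} M → 2 ℕ.+ N < suc M ℕ.+ suc M → N < M ℕ.+ M
    down {N} M h = ℕ.+-cancelˡ-< 2 N (M ℕ.+ M) (≡.subst (2 ℕ.+ N <_) (≡.cong suc (ℕ.+-suc M M)) h)

    up : ∀ {N} M → N < M ℕ.+ M → 2 ℕ.+ N < suc M ℕ.+ suc M
    up {N} M h = ≡.subst (2 ℕ.+ N <_) (≡.sym (≡.cong suc (ℕ.+-suc M M))) (ℕ.+-monoʳ-< 2 h)

  base : Values 0
  base .value₀ (suc M) _ = trans (+-cong (*-identityˡ 1#) (tail≈0 M (λ l → s≤s (z≤n {l})))) (+-identityʳ 1#)
  base .value₁ (suc M) _ = trans
    (+-cong (*-identityˡ 1#) (tail≈0 M (λ l → s≤s (ℕ.≤-trans (ℕ.m∸n≤m 0 l) z≤n))))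
    (solve 0 (con (+ 1) :+ con (+ 0) := con (+ 1) :* con (+ 1)) refl)
  base .value₂ (suc zero) (s≤s (s≤s ()))
  base .value₂ (suc (suc M)) _ = trans
    (+-congˡ (+-congˡ (tail≈0 M (λ l → s≤s (ℕ.≤-trans (ℕ.m∸n≤m 0 l) z≤n)))))
    (solve 1 (λ x → con (+ 1) :* con (+ 1) :+ ((:- (con (+ 1) :* con (+ 1))) :* (con (+ 1) :+ x :* con (+ 0)) :+ con (+ 0))
       := con (+ 0)) refl (p ^ 1))
  base .value₃ (suc zero) (s≤s (s≤s ()))
  base .value₃ (suc (suc M)) _ = trans
    (+-congˡ (+-congˡ (tail≈0 M (λ l → s≤s (ℕ.≤-trans (ℕ.m∸n≤m 1 l) (s≤s z≤n))))))
    (solve 1 (λ x → con (+ 1) :* con (+ 1) :+ ((:- (con (+ 1) :* con (+ 1))) :* (con (+ 1) :+ (x :* con (+ 1)) :* (con (+ 1) :+ (x :* con (+ 1)) :* con (+ 0))) :+ con (+ 0))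
       := :- (con (+ 1) :* (x :* con (+ 1)))) refl p)

  advance : ∀ m → Values m → Values (suc m)
  advance m v = record { value₀ = value₃ v ; value₁ = v₁ ; value₂ = v₂ ; value₃ = v₃ }
    where
    v₁ : ∀ M → 4 ℕ.+ m ℕ.* 3 < M ℕ.+ M → A M (4 ℕ.+ m ℕ.* 3) ≈ ω (suc m) * p ^ suc m
    v₁ M h with unfold M h
    ... | M′ , ≡.refl , h′ = begin
      A (2 ℕ.+ M′) (4 ℕ.+ N)
        ≈⟨ A-recurrence M′ N ⟩
      A (2 ℕ.+ M′) (3 ℕ.+ N) - p ^ (2 ℕ.+ N) * A (suc M′) (suc N) + p ^ suc N * A M′ N
        ≈⟨ +-cong (+-cong (value₃ v (2 ℕ.+ M′) (ℕ.<-trans (ℕ.n<1+n _) h))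
             (-‿cong (*-congˡ (value₁ v (suc M′) (ℕ.<-trans (ℕ.n<1+n _) (up M′ h′))))))
             (*-congˡ (value₀ v M′ h′)) ⟩
      - (ω m * p ^ suc N) - p * p ^ suc N * (ω m * p ^ m) + p ^ suc N * ω m
        ≈⟨ solve 4 (λ w P p Q → :- (w :* P) :- p :* P :* (w :* Q) :+ P :* w := :- (w :* P) :* (p :* Q)) refl
             (ω m) (p ^ suc N) p (p ^ m) ⟩
      - (ω m * p ^ suc N) * p ^ suc m ∎
      where N = m ℕ.* 3
    v₂ : ∀ M → 5 ℕ.+ m ℕ.* 3 < M ℕ.+ M → A M (5 ℕ.+ m ℕ.* 3) ≈ 0#
    v₂ M h with unfold M h
    ... | M′ , ≡.refl , h′ = begin
      A (2 ℕ.+ M′) (5 ℕ.+ N)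
        ≈⟨ A-recurrence M′ (suc N) ⟩
      A (2 ℕ.+ M′) (4 ℕ.+ N) - p ^ (3 ℕ.+ N) * A (suc M′) (2 ℕ.+ N) + p ^ (2 ℕ.+ N) * A M′ (suc N)
        ≈⟨ +-cong (+-cong (v₁ (2 ℕ.+ M′) (ℕ.<-trans (ℕ.n<1+n _) h))
             (-‿cong (*-congˡ (value₂ v (suc M′) (ℕ.<-trans (ℕ.n<1+n _) (up M′ h′))))))
             (*-congˡ (value₁ v M′ h′)) ⟩
      - (ω m * p ^ suc N) * (p * p ^ m) - p ^ (3 ℕ.+ N) * 0# + p * p ^ suc N * (ω m * p ^ m)
        ≈⟨ solve 5 (λ w P p Q d → :- (w :* P) :* (p :* Q) :- d :* con (+ 0) :+ p :* P :* (w :* Q) := con (+ 0)) refl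
             (ω m) (p ^ suc N) p (p ^ m) (p ^ (3 ℕ.+ N)) ⟩
      0# ∎
      where N = m ℕ.* 3
    v₃ : ∀ M → 6 ℕ.+ m ℕ.* 3 < M ℕ.+ M → A M (6 ℕ.+ m ℕ.* 3) ≈ ω (2 ℕ.+ m)
    v₃ M h with unfold M h
    ... | M′ , ≡.refl , h′ = begin
      A (2 ℕ.+ M′) (6 ℕ.+ N)
        ≈⟨ A-recurrence M′ (2 ℕ.+ N) ⟩
      A (2 ℕ.+ M′) (5 ℕ.+ N) - p ^ (4 ℕ.+ N) * A (suc M′) (3 ℕ.+ N) + p ^ (3 ℕ.+ N) * A M′ (2 ℕ.+ N)
        ≈⟨ +-cong (+-cong (v₂ (2 ℕ.+ M′) (ℕ.<-trans (ℕ.n<1+n _) h))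
             (-‿cong (*-congˡ (value₃ v (suc M′) (ℕ.<-trans (ℕ.n<1+n _) (up M′ h′))))))
             (*-congˡ (value₂ v M′ h′)) ⟩
      0# - p ^ (4 ℕ.+ N) * ω (suc m) + p ^ (3 ℕ.+ N) * 0#
        ≈⟨ solve 3 (λ w P d → con (+ 0) :- P :* w :+ d :* con (+ 0) := :- (w :* P)) refl (ω (suc m)) (p ^ (4 ℕ.+ N)) (p ^ (3 ℕ.+ N)) ⟩
      - (ω (suc m) * p ^ (4 ℕ.+ N)) ∎
      where N = m ℕ.* 3

  values : ∀ m → Values m
  values zero = base
  values (suc m) = advance m (values m)

  -- This is S_j for j = l+1, because q^(l+1) τ (l+1) = - q τ l.
  θterm : ℕ → ℕ → Carrier
  θterm n l = τ (suc l) * gauss (n ∸ suc l) (suc l) - q * (τ l * gauss (n ∸ 2 ∸ l) l)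

  θ-sum : ∀ h n → 1# + ∑ h (θterm n) ≈ A (suc h) n - q * A h (n ∸ 2)
  θ-sum h n = begin
    1# + ∑ h (θterm n)                  ≈⟨ +-congˡ (∑-minus h q (λ l → refl)) ⟩
    1# + (S - q * A h (n ∸ 2))          ≈⟨ +-assoc _ _ _ ⟨
    1# + S - q * A h (n ∸ 2)            ≈⟨ +-congʳ (+-congʳ (*-identityˡ 1#)) ⟨
    A (suc h) n - q * A h (n ∸ 2)       ∎
    where S = ∑ h (λ l → τ (suc l) * gauss (n ∸ suc l) (suc l))

  -- With n+2 as the modulus and j = l+1, a q-analogue of C(n+2-j, j) + C(n+1-j, j-1) = ((n+2)/j)
  -- C(n+1-j, j-1), cleared of its denominator. Absorption makes both terms multiples of the same
  -- Gaussian binomial, and their cofactors combine to q (1 - p^(n+2)).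
  θterm-* : ∀ n l → l ≤ n → θterm (2 ℕ.+ n) l * ⟪ suc l ⟫ ≈ - (τ l * gauss (n ∸ l) l * (q * (1# - p ^ (2 ℕ.+ n))))
  θterm-* n l l≤n rewrite ℕ.+-∸-assoc 1 l≤n = begin
    (- (P * t) * gauss (suc m) (suc l) - q * (t * g)) * (1# - p * P)
      ≈⟨ solve 6 (λ P t G q g p → (:- (P :* t) :* G :- q :* (t :* g)) :* (con (+ 1) :- p :* P)
           := :- (P :* t) :* (G :* (con (+ 1) :- p :* P)) :- t :* g :* (q :- (p :* q) :* P)) refl P t (gauss (suc m) (suc l)) q g p ⟩
    - (P * t) * (gauss (suc m) (suc l) * ⟪ suc l ⟫) - t * g * (q - p * q * P)
      ≈⟨ +-cong (*-congˡ (gauss-absorb m l)) (-‿cong (*-congˡ (+-congˡ (-‿cong (trans (*-congʳ p*q≈1) (*-identityˡ P)))))) ⟩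
    - (P * t) * (g * (1# - p ^ suc m)) - t * g * (q - P)
      ≈⟨ solve 5 (λ P t g M q → :- (P :* t) :* (g :* (con (+ 1) :- M)) :- t :* g :* (q :- P)
           := :- (t :* g :* (q :- P :* M))) refl P t g (p ^ suc m) q ⟩
    - (t * g * (q - P * p ^ suc m))
      ≈⟨ -‿cong (*-congˡ (+-congˡ (-‿cong powers))) ⟩
    - (t * g * (q - q * p ^ (2 ℕ.+ n)))
      ≈⟨ solve 4 (λ t g q M → :- (t :* g :* (q :- q :* M)) := :- (t :* g :* (q :* (con (+ 1) :- M)))) refl t g q (p ^ (2 ℕ.+ n)) ⟩
    - (t * g * (q * (1# - p ^ (2 ℕ.+ n)))) ∎
    where
    m = n ∸ l
    P = p ^ l
    t = τ l
    g = gauss m l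
    powers : p ^ l * p ^ suc m ≈ q * p ^ (2 ℕ.+ n)
    powers = begin
      p ^ l * p ^ suc m          ≈⟨ ^-homo-* p l (suc m) ⟨
      p ^ (l ℕ.+ suc m)          ≡⟨ ≡.cong (p ^_) (≡.trans (ℕ.+-suc l m) (≡.cong suc (ℕ.m+[n∸m]≡n l≤n))) ⟩
      p ^ suc n                  ≈⟨ *-identityˡ _ ⟨
      1# * p ^ suc n             ≈⟨ *-congʳ p*q≈1 ⟨
      p * q * p ^ suc n          ≈⟨ solve 3 (λ p q P → p :* q :* P := q :* (p :* P)) refl p q (p ^ suc n) ⟩
      q * p ^ (2 ℕ.+ n)          ∎

  ω-sign : ∀ m → ω m ≈ sign m * p ^ pent m
  ω-sign zero = sym (*-identityˡ 1#)
  ω-sign (suc m) = begin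
    - (ω m * p ^ suc (m ℕ.* 3))                           ≈⟨ -‿cong (*-congʳ (ω-sign m)) ⟩
    - (sign m * p ^ pent m * p ^ suc (m ℕ.* 3))           ≈⟨ solve 3 (λ s P Q → :- (s :* P :* Q) := :- s :* (P :* Q)) refl
                                                               (sign m) (p ^ pent m) (p ^ suc (m ℕ.* 3)) ⟩
    - sign m * (p ^ pent m * p ^ suc (m ℕ.* 3))           ≈⟨ *-congˡ (^-homo-* p (pent m) (suc (m ℕ.* 3))) ⟨
    - sign m * p ^ pent (suc m)                           ∎

  -- Only for 3 ∣ n are A_n and A_(n-2) both nonzero, whence the two terms of ϑ. Since p^m =
  -- p^(3m+1) q^(2m+1), the second one contains ω (m+1) as well. The exponent of ϑ can be negative,
  -- so it is kept as a power of p times a power of q.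
  θ-value₀ : ∀ h m → 3 ℕ.+ m ℕ.* 3 < suc h ℕ.+ suc h → A (suc h) (3 ℕ.+ m ℕ.* 3) - q * A h (1 ℕ.+ m ℕ.* 3) ≈
    sign (suc m) * (1# + p ^ (2 ℕ.* suc m)) * (p ^ pent (suc m) * q ^ (2 ℕ.* suc m))
  θ-value₀ h m bound = begin
    A (suc h) (3 ℕ.+ m ℕ.* 3) - q * A h (1 ℕ.+ m ℕ.* 3)
      ≈⟨ +-cong (value₃ (values m) (suc h) bound) (-‿cong (*-congˡ (value₁ (values m) h (down h bound)))) ⟩
    ω (suc m) - q * (ω m * p ^ m)
      ≈⟨ +-cong (trans (*-congˡ (cancel-pq (2 ℕ.* suc m))) (*-identityʳ _)) (-‿cong (*-congˡ (*-congˡ p^m))) ⟨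
    ω (suc m) * (P * Q) - q * (ω m * (p ^ suc (m ℕ.* 3) * q ^ suc (2 ℕ.* m)))
      ≈⟨ solve 6 (λ w s P Q q R → :- (w :* s) :* (P :* Q) :- q :* (w :* (s :* R)) := :- (w :* s) :* (P :* Q :+ q :* R)) refl
           (ω m) (p ^ suc (m ℕ.* 3)) P Q q (q ^ suc (2 ℕ.* m)) ⟩
    ω (suc m) * (P * Q + q * q ^ suc (2 ℕ.* m))
      ≡⟨ ≡.cong (λ k → ω (suc m) * (P * Q + q ^ k)) (ℕ.*-distribˡ-+ 2 1 m) ⟨
    ω (suc m) * (P * Q + Q)
      ≈⟨ *-congʳ (ω-sign (suc m)) ⟩
    sign (suc m) * p ^ pent (suc m) * (P * Q + Q)
      ≈⟨ solve 4 (λ s w P Q → s :* w :* (P :* Q :+ Q) := s :* (con (+ 1) :+ P) :* (w :* Q)) refl (sign (suc m)) (p ^ pent (suc m)) P Q ⟩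
    sign (suc m) * (1# + P) * (p ^ pent (suc m) * Q) ∎
    where
    P = p ^ (2 ℕ.* suc m)
    Q = q ^ (2 ℕ.* suc m)
    p^m : p ^ suc (m ℕ.* 3) * q ^ suc (2 ℕ.* m) ≈ p ^ m
    p^m = begin
      p ^ suc (m ℕ.* 3) * q ^ suc (2 ℕ.* m)
        ≡⟨ ≡.cong (λ k → p ^ k * q ^ suc (2 ℕ.* m)) (ℕ-solve 1 (λ m → ℕ-con 1 ⊞ m ⊠ ℕ-con 3 ≐ m ⊞ (ℕ-con 1 ⊞ ℕ-con 2 ⊠ m)) ≡.refl m) ⟩
      p ^ (m ℕ.+ suc (2 ℕ.* m)) * q ^ suc (2 ℕ.* m)
        ≈⟨ *-congʳ (^-homo-* p m (suc (2 ℕ.* m))) ⟩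
      p ^ m * p ^ suc (2 ℕ.* m) * q ^ suc (2 ℕ.* m)
        ≈⟨ trans (*-assoc _ _ _) (*-congˡ (cancel-pq (suc (2 ℕ.* m)))) ⟩
      p ^ m * 1#
        ≈⟨ *-identityʳ _ ⟩
      p ^ m ∎

  θ-value₁ : ∀ h m → 1 ℕ.+ m ℕ.* 3 < suc h ℕ.+ suc h → h ℕ.+ h ≤ 1 ℕ.+ m ℕ.* 3 → A (suc h) (1 ℕ.+ m ℕ.* 3) - q * A h (1 ℕ.+ m ℕ.* 3 ∸ 2) ≈
    sign m * (p ^ (pent m ℕ.+ m) * q ^ 0)
  θ-value₁ h m bound bound′ = begin
    A (suc h) (1 ℕ.+ m ℕ.* 3) - q * A h (1 ℕ.+ m ℕ.* 3 ∸ 2)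
      ≈⟨ +-cong (value₁ (values m) (suc h) bound) (-‿cong (*-congˡ (vanish h m bound bound′))) ⟩
    ω m * p ^ m - q * 0#
      ≈⟨ +-congʳ (*-congʳ (ω-sign m)) ⟩
    sign m * p ^ pent m * p ^ m - q * 0#
      ≈⟨ solve 4 (λ s P Q q → s :* P :* Q :- q :* con (+ 0) := s :* (P :* Q :* con (+ 1))) refl (sign m) (p ^ pent m) (p ^ m) q ⟩
    sign m * (p ^ pent m * p ^ m * 1#)
      ≈⟨ *-congˡ (*-congʳ (^-homo-* p (pent m) m)) ⟨
    sign m * (p ^ (pent m ℕ.+ m) * 1#) ∎
    where
    -- For n = 1 the truncated n ∸ 2 would name A_0, which is 1; but 2h ≤ 1 forces h = 0 and the sum
    -- is empty. Otherwise n - 2 is 2 modulo 3.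
    vanish : ∀ h m → 1 ℕ.+ m ℕ.* 3 < suc h ℕ.+ suc h → h ℕ.+ h ≤ 1 ℕ.+ m ℕ.* 3 → A h (1 ℕ.+ m ℕ.* 3 ∸ 2) ≈ 0#
    vanish zero m _ _ = refl
    vanish (suc h) zero _ (s≤s h+1+h≤0) with ℕ.m+n≤o⇒n≤o h h+1+h≤0
    ... | ()
    vanish h@(suc _) (suc m) bound _ = value₂ (values m) h (down h bound)

  θ-value₂ : ∀ h m → 2 ℕ.+ m ℕ.* 3 < suc h ℕ.+ suc h → A (suc h) (2 ℕ.+ m ℕ.* 3) - q * A h (m ℕ.* 3) ≈
    sign (suc m) * (p ^ pent m * q ^ 1)
  θ-value₂ h m bound = begin
    A (suc h) (2 ℕ.+ m ℕ.* 3) - q * A h (m ℕ.* 3)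
      ≈⟨ +-cong (value₂ (values m) (suc h) bound) (-‿cong (*-congˡ (value₀ (values m) h (down h bound)))) ⟩
    0# - q * ω m
      ≈⟨ +-congˡ (-‿cong (*-congˡ (ω-sign m))) ⟩
    0# - q * (sign m * p ^ pent m)
      ≈⟨ solve 3 (λ q s P → con (+ 0) :- q :* (s :* P) := :- s :* (P :* (q :* con (+ 1)))) refl q (sign m) (p ^ pent m) ⟩
    - sign m * (p ^ pent m * (q * 1#)) ∎

-- The sum t₁′ in a ring with (1 - q^n)² = 0

-- Here e = 1 - q^n plays the role of a multiple of Φ_n modulo Φ_n²; then e * x ≈ e * y says that
-- x and y agree modulo Φ_n.
module Congruence {c ℓ} (R : CommutativeRing c ℓ) (q p : CommutativeRing.Carrier R)
  (p*q≈1 : CommutativeRing._≈_ R (CommutativeRing._*_ R p q) (CommutativeRing.1# R))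
  (n : ℕ) (e²≈0 : Gaussian.SquareZero R q n) (unit : ∀ i → ¬ n ∣ i → Gaussian.Invertible R q i) where
  open CommutativeRing R hiding (zero)
  open Exponents commutativeSemiring using (_^_; ^-homo-*; ^-assocʳ)
  open IntegerMultiples R using (_×ₙ_; 1+×)
  open Solver R
  open SetoidReasoning setoid
  open Sums R
  open Gaussian R q
  module Gₚ = Gaussian R p
  module G² = Gaussian R (q ^ 2)
  open Theta R q p p*q≈1 using (cancel-pq; τ; θterm; θterm-*)

  e : Carrier
  e = ⟪ n ⟫

  e*-* : ∀ {x x′ y y′} → e * x ≈ e * x′ → e * y ≈ e * y′ → e * (x * y) ≈ e * (x′ * y′)
  e*-* {x} {x′} {y} {y′} h k = begin
    e * (x * y)      ≈⟨ *-assoc _ _ _ ⟨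
    e * x * y        ≈⟨ *-congʳ h ⟩
    e * x′ * y       ≈⟨ solve 3 (λ e x y → e :* x :* y := x :* (e :* y)) refl e x′ y ⟩
    x′ * (e * y)     ≈⟨ *-congˡ k ⟩
    x′ * (e * y′)    ≈⟨ solve 3 (λ e x y → x :* (e :* y) := e :* (x :* y)) refl e x′ y′ ⟩
    e * (x′ * y′)    ∎

  e*-minus : ∀ {x x′} → e * x ≈ e * x′ → e * (1# - x) ≈ e * (1# - x′)
  e*-minus {x} {x′} h = trans (distrib- x) (trans (+-congˡ (-‿cong h)) (sym (distrib- x′)))
    where
    distrib- : ∀ x → e * (1# - x) ≈ e - e * x
    distrib- x = solve 2 (λ e x → e :* (con (+ 1) :- x) := e :- e :* x) refl e x

  e*qⁿ : e * q ^ n ≈ e * 1#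
  e*qⁿ = begin
    e * q ^ n      ≈⟨ solve 1 (λ x → (con (+ 1) :- x) :* x := (con (+ 1) :- x) :* con (+ 1) :- (con (+ 1) :- x) :* (con (+ 1) :- x)) refl (q ^ n) ⟩
    e * 1# - e * e ≈⟨ +-congˡ (-‿cong e²≈0) ⟩
    e * 1# - 0#    ≈⟨ solve 1 (λ x → x :- con (+ 0) := x) refl (e * 1#) ⟩
    e * 1#         ∎

  e*qᵏⁿ : ∀ k → e * q ^ (k ℕ.* n) ≈ e * 1#
  e*qᵏⁿ zero = refl
  e*qᵏⁿ (suc k) = begin
    e * q ^ (n ℕ.+ k ℕ.* n)          ≈⟨ *-congˡ (^-homo-* q n (k ℕ.* n)) ⟩
    e * (q ^ n * q ^ (k ℕ.* n))      ≈⟨ e*-* e*qⁿ (e*qᵏⁿ k) ⟩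
    e * (1# * 1#)                    ≈⟨ *-congˡ (*-identityˡ 1#) ⟩
    e * 1#                           ∎

  e*periodic : ∀ i k → e * q ^ (i ℕ.+ k ℕ.* n) ≈ e * q ^ i
  e*periodic i k = begin
    e * q ^ (i ℕ.+ k ℕ.* n)          ≈⟨ *-congˡ (^-homo-* q i (k ℕ.* n)) ⟩
    e * (q ^ i * q ^ (k ℕ.* n))      ≈⟨ e*-* refl (e*qᵏⁿ k) ⟩
    e * (q ^ i * 1#)                 ≈⟨ *-congˡ (*-identityʳ _) ⟩
    e * q ^ i                        ∎

  -- Each further power q^n acts as 1 on e, so this holds exactly in the ring. With k = 2(a-b) it is
  -- the source of the coefficient in the theorem.
  ⟪multiple⟫ : ∀ k → ⟪ k ℕ.* n ⟫ ≈ (k ×ₙ 1#) * e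
  ⟪multiple⟫ zero = solve 1 (λ e → con (+ 1) :- con (+ 1) := con (+ 0) :* e) refl e
  ⟪multiple⟫ (suc k) = begin
    ⟪ n ℕ.+ k ℕ.* n ⟫                ≈⟨ ⟪+⟫ n (k ℕ.* n) ⟨
    e + q ^ n * ⟪ k ℕ.* n ⟫          ≈⟨ +-congˡ (*-congˡ (⟪multiple⟫ k)) ⟩
    e + q ^ n * ((k ×ₙ 1#) * e)      ≈⟨ solve 3 (λ e Q k → e :+ Q :* (k :* e) := e :+ k :* (e :* Q)) refl e (q ^ n) (k ×ₙ 1#) ⟩
    e + (k ×ₙ 1#) * (e * q ^ n)      ≈⟨ +-congˡ (*-congˡ e*qⁿ) ⟩
    e + (k ×ₙ 1#) * (e * 1#)         ≈⟨ solve 2 (λ e k → e :+ k :* (e :* con (+ 1)) := (con (+ 1) :+ k) :* e) refl e (k ×ₙ 1#) ⟩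
    (1# + (k ×ₙ 1#)) * e             ≈⟨ *-congʳ (1+× k 1#) ⟨
    (suc k ×ₙ 1#) * e                ∎

  cancel : ∀ i k {x y} → 0 < i → i < n → x * ⟪ i ℕ.+ k ℕ.* n ⟫ ≈ y * ⟪ i ℕ.+ k ℕ.* n ⟫ → x ≈ y
  cancel i@(suc _) k {x} {y} 0<i i<n h with unit (i ℕ.+ k ℕ.* n) n∤
    where
    n∤ : ¬ n ∣ i ℕ.+ k ℕ.* n
    n∤ n∣ = ℕ.<⇒≱ i<n (∣⇒≤ (∣m+n∣m⇒∣n (≡.subst (n ∣_) (ℕ.+-comm i (k ℕ.* n)) n∣) (n∣m*n k)))
  ... | u , inverse = begin
    x                                    ≈⟨ *-identityʳ x ⟨
    x * 1#                               ≈⟨ *-congˡ inverse ⟨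
    x * (⟪ i ℕ.+ k ℕ.* n ⟫ * u)          ≈⟨ *-assoc _ _ _ ⟨
    x * ⟪ i ℕ.+ k ℕ.* n ⟫ * u            ≈⟨ *-congʳ h ⟩
    y * ⟪ i ℕ.+ k ℕ.* n ⟫ * u            ≈⟨ *-assoc _ _ _ ⟩
    y * (⟪ i ℕ.+ k ℕ.* n ⟫ * u)          ≈⟨ *-congˡ inverse ⟩
    y * 1#                               ≈⟨ *-identityʳ y ⟩
    y                                    ∎

  cancel′ : ∀ i {x y} → 0 < i → i < n → x * ⟪ i ⟫ ≈ y * ⟪ i ⟫ → x ≈ y
  cancel′ i {x} {y} 0<i i<n = cancel i 0 0<i i<n ∘ ≡.subst (λ m → x * ⟪ m ⟫ ≈ y * ⟪ m ⟫) (≡.sym (ℕ.+-identityʳ i))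

  -- Lowering the index to zero passes through the factors 1 - q^(N-i), which on e depend on N
  -- modulo n only, and through denominators 1 - q^(i+1) with i+1 < n, which are units. The bound i
  -- ≤ N keeps N ∸ i an honest difference.
  e*gauss-periodic : ∀ N k i → i < n → i ≤ N → e * gauss (N ℕ.+ k ℕ.* n) i ≈ e * gauss N i
  e*gauss-periodic N k zero _ _ = refl
  e*gauss-periodic N k (suc i) i<n i<N = cancel′ (suc i) (s≤s z≤n) i<n (begin
    e * gauss N′ (suc i) * ⟪ suc i ⟫      ≈⟨ *-assoc _ _ _ ⟩
    e * (gauss N′ (suc i) * ⟪ suc i ⟫)    ≈⟨ *-congˡ (gauss-lower N′ i) ⟩
    e * (gauss N′ i * ⟪ N′ ∸ i ⟫)         ≡⟨ ≡.cong (λ m → e * (gauss N′ i * ⟪ m ⟫)) (ℕ.+-∸-comm (k ℕ.* n) (ℕ.<⇒≤ i<N)) ⟩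
    e * (gauss N′ i * ⟪ (N ∸ i) ℕ.+ k ℕ.* n ⟫)
      ≈⟨ e*-* (e*gauss-periodic N k i (ℕ.<-trans (ℕ.n<1+n i) i<n) (ℕ.<⇒≤ i<N)) (e*-minus (e*periodic (N ∸ i) k)) ⟩
    e * (gauss N i * ⟪ N ∸ i ⟫)           ≈⟨ *-congˡ (gauss-lower N i) ⟨
    e * (gauss N (suc i) * ⟪ suc i ⟫)     ≈⟨ *-assoc _ _ _ ⟨
    e * gauss N (suc i) * ⟪ suc i ⟫       ∎)
    where N′ = N ℕ.+ k ℕ.* n

  e*p : ∀ i j k → i ℕ.+ j ≡ k ℕ.* n → e * p ^ i ≈ e * q ^ j
  e*p i j k i+j≡kn = begin
    e * p ^ i                               ≈⟨ *-congˡ (*-identityʳ _) ⟨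
    e * (p ^ i * 1#)                        ≈⟨ e*-* refl (e*qᵏⁿ k) ⟨
    e * (p ^ i * q ^ (k ℕ.* n))             ≡⟨ ≡.cong (λ m → e * (p ^ i * q ^ m)) i+j≡kn ⟨
    e * (p ^ i * q ^ (i ℕ.+ j))             ≈⟨ *-congˡ (*-congˡ (^-homo-* q i j)) ⟩
    e * (p ^ i * (q ^ i * q ^ j))           ≈⟨ *-congˡ (*-assoc _ _ _) ⟨
    e * (p ^ i * q ^ i * q ^ j)             ≈⟨ *-congˡ (*-congʳ (cancel-pq i)) ⟩
    e * (1# * q ^ j)                        ≈⟨ *-congˡ (*-identityˡ _) ⟩
    e * q ^ j                               ∎

  ⟪⟫ₚ : ∀ i → - (p ^ i * ⟪ i ⟫) ≈ Gₚ.⟪ i ⟫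
  ⟪⟫ₚ i = begin
    - (p ^ i * (1# - q ^ i))     ≈⟨ solve 2 (λ P Q → :- (P :* (con (+ 1) :- Q)) := P :* Q :- P) refl (p ^ i) (q ^ i) ⟩
    p ^ i * q ^ i - p ^ i        ≈⟨ +-congʳ (cancel-pq i) ⟩
    1# - p ^ i                   ∎

  -- ρ i = (-1)^i p^(i(i+1)/2)
  ρ : ℕ → Carrier
  ρ zero = 1#
  ρ (suc i) = - (p ^ suc i * ρ i)

  ρ-τ : ∀ i → ρ i ≈ τ i * p ^ i
  ρ-τ zero = sym (*-identityˡ 1#)
  ρ-τ (suc i) = begin
    - (p ^ suc i * ρ i)               ≈⟨ -‿cong (*-congˡ (ρ-τ i)) ⟩
    - (p ^ suc i * (τ i * p ^ i))     ≈⟨ solve 3 (λ Q t P → :- (Q :* (t :* P)) := :- (P :* t) :* Q) refl (p ^ suc i) (τ i) (p ^ i) ⟩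
    - (p ^ i * τ i) * p ^ suc i       ∎

  -- The reflection C(-k-1, i) = (-1)^i C(k+i, i), with N in the role of -k-1 modulo n. On e the
  -- numerator factors 1 - p^(N-i) and 1 - q^(k+i+1) coincide, as their exponents sum to n; every
  -- denominator factor changes base at the cost of -p^(i+1), and these costs multiply to `ρ`.
  e*gaussₚ : ∀ N k i → suc (N ℕ.+ k) ≡ n → i ≤ N → e * (ρ i * Gₚ.gauss N i) ≈ e * gauss (k ℕ.+ i) i
  e*gaussₚ N k zero _ _ = *-congˡ (*-identityˡ 1#)
  e*gaussₚ N k (suc i) N+k≡n i<N rewrite ℕ.+-suc k i = cancel′ (suc i) (s≤s z≤n) i<n (begin
    e * (- (P * ρ i) * Gₚ.gauss N (suc i)) * ⟪ suc i ⟫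
      ≈⟨ solve 5 (λ e P r g z → e :* (:- (P :* r) :* g) :* z := e :* (r :* (g :* (:- (P :* z))))) refl
           e P (ρ i) (Gₚ.gauss N (suc i)) ⟪ suc i ⟫ ⟩
    e * (ρ i * (Gₚ.gauss N (suc i) * - (P * ⟪ suc i ⟫)))
      ≈⟨ *-congˡ (*-congˡ (trans (*-congˡ (⟪⟫ₚ (suc i))) (Gₚ.gauss-lower N i))) ⟩
    e * (ρ i * (Gₚ.gauss N i * Gₚ.⟪ N ∸ i ⟫))
      ≈⟨ *-congˡ (*-assoc _ _ _) ⟨
    e * (ρ i * Gₚ.gauss N i * Gₚ.⟪ N ∸ i ⟫)
      ≈⟨ e*-* (e*gaussₚ N k i N+k≡n (ℕ.<⇒≤ i<N)) (e*-minus (e*p (N ∸ i) (suc (k ℕ.+ i)) 1 exponents)) ⟩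
    e * (gauss (k ℕ.+ i) i * ⟪ suc (k ℕ.+ i) ⟫)
      ≈⟨ *-congˡ (gauss-absorb (k ℕ.+ i) i) ⟨
    e * (gauss (suc (k ℕ.+ i)) (suc i) * ⟪ suc i ⟫)
      ≈⟨ *-assoc _ _ _ ⟨
    e * gauss (suc (k ℕ.+ i)) (suc i) * ⟪ suc i ⟫ ∎)
    where
    P = p ^ suc i
    i<n : suc i < n
    i<n = ≡.subst (suc i <_) N+k≡n (s≤s (ℕ.≤-trans i<N (ℕ.m≤m+n N k)))
    exponents : (N ∸ i) ℕ.+ suc (k ℕ.+ i) ≡ 1 ℕ.* n
    exponents = ≡.trans
      (ℕ-solve 3 (λ m k i → m ⊞ (ℕ-con 1 ⊞ (k ⊞ i)) ≐ ℕ-con 1 ⊞ (m ⊞ i ⊞ k)) ≡.refl (N ∸ i) k i)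
      (≡.trans (≡.cong (λ m → suc (m ℕ.+ k)) (ℕ.m∸n+n≡m (ℕ.<⇒≤ i<N)))
        (≡.trans N+k≡n (≡.sym (ℕ.*-identityˡ n))))

  -- σ j = (-1)^j p^(j(j+1))
  σ : ℕ → Carrier
  σ zero = 1#
  σ (suc j) = - (p ^ (2 ℕ.* suc j) * σ j)

  -- Here m stands for a - b, so that an = D + B and bn = B need no truncated subtraction.
  module _ (m b : ℕ) where
    D B N : ℕ
    D = m ℕ.* n
    B = b ℕ.* n
    N = D ℕ.+ B

    β κ : Carrier
    β = G².gauss N D
    κ = β * ((2 ℕ.* m) ×ₙ 1#)

    private
      ⟪⟫² : ∀ i → G².⟪ i ⟫ ≈ ⟪ 2 ℕ.* i ⟫
      ⟪⟫² i = +-congˡ (-‿cong (^-assocʳ q 2 i))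

      complement : ∀ c i → c ℕ.+ i ≡ D → G².⟪ N ∸ c ⟫ ≈ ⟪ 2 ℕ.* i ℕ.+ (2 ℕ.* b) ℕ.* n ⟫
      complement c i c+i≡D = trans (⟪⟫² (N ∸ c)) (reflexive (≡.cong ⟪_⟫ (≡.trans (≡.cong (2 ℕ.*_) N∸c)
        (ℕ-solve 3 (λ i b n → ℕ-con 2 ⊠ (i ⊞ b ⊠ n) ≐ ℕ-con 2 ⊠ i ⊞ (ℕ-con 2 ⊠ b) ⊠ n) ≡.refl i b n))))
        where
        N∸c : N ∸ c ≡ i ℕ.+ B
        N∸c = ≡.trans (≡.cong (λ d → d ℕ.+ B ∸ c) (≡.sym c+i≡D))
          (≡.trans (≡.cong (_∸ c) (ℕ.+-assoc c i B)) (ℕ.m+n∸m≡n c (i ℕ.+ B)))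

      2D : 2 ℕ.* D ≡ (2 ℕ.* m) ℕ.* n
      2D = ≡.sym (ℕ.*-assoc 2 m n)

      e*q²ᶜ : ∀ j c → c ℕ.+ j ≡ D → e * q ^ (2 ℕ.* c) ≈ e * p ^ (2 ℕ.* j)
      e*q²ᶜ j c c+j≡D = sym (e*p (2 ℕ.* j) (2 ℕ.* c) (2 ℕ.* m) (≡.trans
        (ℕ-solve 2 (λ j c → ℕ-con 2 ⊠ j ⊞ ℕ-con 2 ⊠ c ≐ ℕ-con 2 ⊠ (c ⊞ j)) ≡.refl j c)
        (≡.trans (≡.cong (2 ℕ.*_) c+j≡D) 2D)))

    -- The factor on the left stays there because it is not invertible when 2 (suc j) = n.
    gauss²-ratio : ∀ j c → c ℕ.+ suc j ≡ D → 2 ℕ.* suc j ≤ n →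
      G².gauss N c * ⟪ 2 ℕ.* suc j ℕ.+ (2 ℕ.* b) ℕ.* n ⟫ ≈ κ * (e * σ j)
    gauss²-ratio zero c c+1≡D _ = begin
      G².gauss N c * ⟪ 2 ℕ.+ (2 ℕ.* b) ℕ.* n ⟫           ≈⟨ *-congˡ (complement c 1 c+1≡D) ⟨
      G².gauss N c * G².⟪ N ∸ c ⟫                         ≈⟨ G².gauss-lower N c ⟨
      G².gauss N (suc c) * G².⟪ suc c ⟫                   ≡⟨ ≡.cong (λ d → G².gauss N d * G².⟪ d ⟫) (≡.trans (ℕ.+-comm 1 c) c+1≡D) ⟩
      β * G².⟪ D ⟫                                        ≈⟨ *-congˡ (trans (⟪⟫² D) (reflexive (≡.cong ⟪_⟫ 2D))) ⟩
      β * ⟪ (2 ℕ.* m) ℕ.* n ⟫                             ≈⟨ *-congˡ (⟪multiple⟫ (2 ℕ.* m)) ⟩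
      β * (((2 ℕ.* m) ×ₙ 1#) * e)                         ≈⟨ solve 3 (λ b c e → b :* (c :* e) := b :* c :* (e :* con (+ 1))) refl β ((2 ℕ.* m) ×ₙ 1#) e ⟩
      κ * (e * 1#)                                        ∎
    -- The factor `Z` left over by the preceding index is restored and cancelled: its exponent is
    -- 2(j+1) modulo n, and 0 < 2(j+1) < n because 2(j+2) ≤ n. Only the newest factor, where 2(j+2)
    -- = n can occur, stays.
    gauss²-ratio (suc j) c c+j≡D 2j≤n = cancel (2 ℕ.* suc j) (2 ℕ.* b) (s≤s z≤n) 2j<n (begin
      G².gauss N c * ⟪ 2 ℕ.* suc (suc j) ℕ.+ (2 ℕ.* b) ℕ.* n ⟫ * Z
        ≈⟨ *-congʳ (*-congˡ (complement c (suc (suc j)) c+j≡D)) ⟨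
      G².gauss N c * G².⟪ N ∸ c ⟫ * Z
        ≈⟨ *-congʳ (G².gauss-lower N c) ⟨
      G².gauss N (suc c) * G².⟪ suc c ⟫ * Z
        ≈⟨ solve 3 (λ g y z → g :* y :* z := g :* z :* y) refl (G².gauss N (suc c)) G².⟪ suc c ⟫ Z ⟩
      G².gauss N (suc c) * Z * G².⟪ suc c ⟫
        ≈⟨ *-cong (gauss²-ratio j (suc c) c′ (ℕ.<⇒≤ 2j<n)) (⟪⟫² (suc c)) ⟩
      κ * (e * σ j) * ⟪ 2 ℕ.* suc c ⟫
        ≈⟨ solve 4 (λ k e s z → k :* (e :* s) :* z := k :* s :* (e :* z)) refl κ e (σ j) ⟪ 2 ℕ.* suc c ⟫ ⟩
      κ * σ j * (e * ⟪ 2 ℕ.* suc c ⟫)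
        ≈⟨ *-congˡ (e*-minus (e*q²ᶜ (suc j) (suc c) c′)) ⟩
      κ * σ j * (e * Gₚ.⟪ 2 ℕ.* suc j ⟫)
        ≈⟨ *-congˡ (*-congˡ (⟪⟫ₚ (2 ℕ.* suc j))) ⟨
      κ * σ j * (e * - (P * ⟪ 2 ℕ.* suc j ⟫))
        ≈⟨ solve 5 (λ k s e P z → k :* s :* (e :* (:- (P :* z))) := :- (k :* s :* P) :* (e :* z)) refl κ (σ j) e P ⟪ 2 ℕ.* suc j ⟫ ⟩
      - (κ * σ j * P) * (e * ⟪ 2 ℕ.* suc j ⟫)
        ≈⟨ *-congˡ (e*-minus (e*periodic (2 ℕ.* suc j) (2 ℕ.* b))) ⟨
      - (κ * σ j * P) * (e * Z)
        ≈⟨ solve 5 (λ k s P e z → (:- (k :* s :* P)) :* (e :* z) := k :* (e :* (:- (P :* s))) :* z) refl κ (σ j) P e Z ⟩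
      κ * (e * σ (suc j)) * Z ∎)
      where
      Z = ⟪ 2 ℕ.* suc j ℕ.+ (2 ℕ.* b) ℕ.* n ⟫
      P = p ^ (2 ℕ.* suc j)
      c′ : suc c ℕ.+ suc j ≡ D
      c′ = ≡.trans (≡.sym (ℕ.+-suc c (suc j))) c+j≡D
      2j<n : 2 ℕ.* suc j < n
      2j<n = ℕ.<-≤-trans (ℕ.*-monoʳ-< 2 (ℕ.n<1+n (suc j))) 2j≤n

    private
      e*q^c[c-1] : ∀ j c → c ℕ.+ j ≡ D → e * q ^ (c ℕ.* (c ∸ 1)) ≈ e * (q ^ (suc c ℕ.* c) * q ^ (2 ℕ.* j))
      e*q^c[c-1] j c c+j≡D = sym (begin
        e * (q ^ (suc c ℕ.* c) * q ^ (2 ℕ.* j))          ≈⟨ *-congˡ (^-homo-* q (suc c ℕ.* c) (2 ℕ.* j)) ⟨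
        e * q ^ (suc c ℕ.* c ℕ.+ 2 ℕ.* j)                ≡⟨ ≡.cong (λ k → e * q ^ k) (exponents c) ⟩
        e * q ^ (c ℕ.* (c ∸ 1) ℕ.+ 2 ℕ.* (c ℕ.+ j))      ≡⟨ ≡.cong (λ k → e * q ^ (c ℕ.* (c ∸ 1) ℕ.+ k)) (≡.trans (≡.cong (2 ℕ.*_) c+j≡D) 2D) ⟩
        e * q ^ (c ℕ.* (c ∸ 1) ℕ.+ (2 ℕ.* m) ℕ.* n)      ≈⟨ e*periodic (c ℕ.* (c ∸ 1)) (2 ℕ.* m) ⟩
        e * q ^ (c ℕ.* (c ∸ 1))                          ∎)
        where
        exponents : ∀ c → suc c ℕ.* c ℕ.+ 2 ℕ.* j ≡ c ℕ.* (c ∸ 1) ℕ.+ 2 ℕ.* (c ℕ.+ j)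
        exponents zero = ≡.refl
        exponents (suc c) = ℕ-solve 2 (λ c j → (ℕ-con 2 ⊞ c) ⊠ (ℕ-con 1 ⊞ c) ⊞ ℕ-con 2 ⊠ j
          ≐ (ℕ-con 1 ⊞ c) ⊠ c ⊞ ℕ-con 2 ⊠ (ℕ-con 1 ⊞ c ⊞ j)) ≡.refl c j

    -- Put J = j+1, so c = D - J. Then c(c-1) = D(D-1) - 2JD + J(J+1), where q^(2JD) acts as 1 on e,
    -- and the factor p^(J(J-1)) of σ j reduces q^(J(J+1)) to q^(2J).
    sign-powers : ∀ j c → c ℕ.+ suc j ≡ D → sign c * (e * (q ^ (c ℕ.* (c ∸ 1)) * σ j)) ≈
      - (sign D * (e * (q ^ (D ℕ.* (D ∸ 1)) * q ^ (2 ℕ.* suc j))))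
    sign-powers zero c c+1≡D = begin
      sign c * (e * (q ^ (c ℕ.* (c ∸ 1)) * 1#))
        ≈⟨ *-congˡ (*-congˡ (*-identityʳ _)) ⟩
      sign c * (e * q ^ (c ℕ.* (c ∸ 1)))
        ≈⟨ *-congˡ (e*q^c[c-1] 1 c c+1≡D) ⟩
      sign c * (e * (q ^ (suc c ℕ.* c) * q ^ 2))
        ≈⟨ solve 2 (λ s x → s :* x := :- (:- s :* x)) refl (sign c) _ ⟩
      - (- sign c * (e * (q ^ (suc c ℕ.* c) * q ^ 2)))
        ≡⟨ ≡.cong (λ d → - (sign d * (e * (q ^ (d ℕ.* (d ∸ 1)) * q ^ 2)))) (≡.trans (ℕ.+-comm 1 c) c+1≡D) ⟩
      - (sign D * (e * (q ^ (D ℕ.* (D ∸ 1)) * q ^ 2))) ∎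
    sign-powers (suc j) c c+j≡D = begin
      sign c * (e * (q ^ (c ℕ.* (c ∸ 1)) * - (P * σ j)))
        ≈⟨ solve 5 (λ s e x P t → s :* (e :* (x :* (:- (P :* t)))) := :- s :* t :* P :* (e :* x)) refl
             (sign c) e (q ^ (c ℕ.* (c ∸ 1))) P (σ j) ⟩
      - sign c * σ j * P * (e * q ^ (c ℕ.* (c ∸ 1)))
        ≈⟨ *-congˡ (e*q^c[c-1] (suc (suc j)) c c+j≡D) ⟩
      - sign c * σ j * P * (e * (y * q ^ (2 ℕ.* suc (suc j))))
        ≈⟨ *-congˡ (*-congˡ (*-congˡ (trans (reflexive (≡.cong (q ^_) (ℕ.*-distribˡ-+ 2 1 (suc j)))) (^-homo-* q 2 (2 ℕ.* suc j))))) ⟩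
      - sign c * σ j * P * (e * (y * (q ^ 2 * Q)))
        ≈⟨ solve 7 (λ s t P e y u Q → :- s :* t :* P :* (e :* (y :* (u :* Q))) := :- s :* (e :* (y :* t)) :* u :* (P :* Q)) refl
             (sign c) (σ j) P e y (q ^ 2) Q ⟩
      - sign c * (e * (y * σ j)) * q ^ 2 * (P * Q)
        ≈⟨ *-cong (*-congʳ (sign-powers j (suc c) (≡.trans (≡.sym (ℕ.+-suc c (suc j))) c+j≡D))) (cancel-pq (2 ℕ.* suc j)) ⟩
      - (sign D * (e * (q ^ (D ℕ.* (D ∸ 1)) * Q))) * q ^ 2 * 1#
        ≈⟨ solve 5 (λ s e y Q u → :- (s :* (e :* (y :* Q))) :* u :* con (+ 1) := :- (s :* (e :* (y :* (u :* Q))))) refl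
             (sign D) e (q ^ (D ℕ.* (D ∸ 1))) Q (q ^ 2) ⟩
      - (sign D * (e * (q ^ (D ℕ.* (D ∸ 1)) * (q ^ 2 * Q))))
        ≈⟨ -‿cong (*-congˡ (*-congˡ (*-congˡ (trans (reflexive (≡.cong (q ^_) (ℕ.*-distribˡ-+ 2 1 (suc j)))) (^-homo-* q 2 (2 ℕ.* suc j)))))) ⟨
      - (sign D * (e * (q ^ (D ℕ.* (D ∸ 1)) * q ^ (2 ℕ.* suc (suc j))))) ∎
      where
      P = p ^ (2 ℕ.* suc j)
      Q = q ^ (2 ℕ.* suc j)
      y = q ^ (suc c ℕ.* c)

    private
      2l≤n⇒ : ∀ l → 2 ℕ.* suc l ≤ n → Σ ℕ λ n′ → n ≡ 2 ℕ.+ n′ × l ℕ.+ l ≤ n′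
      2l≤n⇒ l h = n ∸ 2 , ≡.sym (ℕ.m+[n∸m]≡n (ℕ.≤-trans (ℕ.*-monoʳ-≤ 2 (s≤s (z≤n {l}))) h)) ,
        ≡.subst (_≤ n ∸ 2) (≡.trans (≡.cong (_∸ 2) (ℕ.*-distribˡ-+ 2 1 l)) (≡.cong (l ℕ.+_) (ℕ.+-identityʳ l))) (ℕ.∸-monoˡ-≤ 2 h)

    -- Brings S_j, j = l+1, to the shape that the summands of t₁′ take. The factor 1 - p^n of
    -- `θterm-*` equals -e, after which the base p binomial may be reflected to [2j-1; j-1] in base
    -- q. The change of 1 - q^j to base p and the conversion of `τ` to `ρ` together produce q^(2j).
    θterm-mod : ∀ l → 2 ℕ.* suc l ≤ n → θterm n l * ⟪ suc l ⟫ ≈ - (q ^ (2 ℕ.* suc l) * (e * gauss (suc l ℕ.+ l) l))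
    θterm-mod l h with 2l≤n⇒ l h
    ... | n′ , n≡ , 2l≤n′ = begin
      θterm n l * ⟪ suc l ⟫
        ≈⟨ *-congˡ (trans (*-congʳ (cancel-pq (suc l))) (*-identityˡ _)) ⟨
      θterm n l * (p ^ suc l * q ^ suc l * ⟪ suc l ⟫)
        ≈⟨ solve 4 (λ t P Q z → t :* (P :* Q :* z) := :- (Q :* (t :* (:- (P :* z))))) refl (θterm n l) (p ^ suc l) (q ^ suc l) ⟪ suc l ⟫ ⟩
      - (q ^ suc l * (θterm n l * - (p ^ suc l * ⟪ suc l ⟫)))
        ≈⟨ -‿cong (*-congˡ (*-congˡ (⟪⟫ₚ (suc l)))) ⟩
      - (q ^ suc l * (θterm n l * Gₚ.⟪ suc l ⟫))
        ≈⟨ -‿cong (*-congˡ (≡.subst (λ n → θterm n l * Gₚ.⟪ suc l ⟫ ≈ - (τ l * Gₚ.gauss (n′ ∸ l) l * (q * Gₚ.⟪ n ⟫)))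
             (≡.sym n≡) (θterm-* n′ l (ℕ.≤-trans (ℕ.m≤m+n l l) 2l≤n′)))) ⟩
      - (q ^ suc l * - (τ l * g * (q * Gₚ.⟪ n ⟫)))
        ≈⟨ -‿cong (*-congˡ (-‿cong (*-congˡ (*-congˡ ⟪n⟫ₚ)))) ⟩
      - (q ^ suc l * - (τ l * g * (q * - e)))
        ≈⟨ solve 5 (λ Q t g q e → :- (q :* Q :* (:- (t :* g :* (q :* (:- e))))) := :- (q :* q :* Q :* con (+ 1) :* (e :* (t :* g)))) refl (q ^ l) (τ l) g q e ⟩
      - (q * q * q ^ l * 1# * (e * (τ l * g)))
        ≈⟨ -‿cong (*-congʳ (*-congˡ (cancel-pq l))) ⟨
      - (q * q * q ^ l * (p ^ l * q ^ l) * (e * (τ l * g)))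
        ≈⟨ solve 6 (λ q Q P e t g → :- (q :* q :* Q :* (P :* Q) :* (e :* (t :* g)))
             := :- ((q :* Q) :* (q :* Q) :* (e :* (t :* P :* g)))) refl q (q ^ l) (p ^ l) e (τ l) g ⟩
      - (q ^ suc l * q ^ suc l * (e * (τ l * p ^ l * g)))
        ≈⟨ -‿cong (*-cong (^-homo-* q (suc l) (suc l)) (*-congˡ (*-congʳ (ρ-τ l)))) ⟨
      - (q ^ (suc l ℕ.+ suc l) * (e * (ρ l * g)))
        ≈⟨ -‿cong (*-cong (reflexive (≡.cong (λ k → q ^ (suc l ℕ.+ k)) (≡.sym (ℕ.+-identityʳ (suc l)))))
             (e*gaussₚ (n′ ∸ l) (suc l) l (≡.trans (≡.cong suc (≡.trans (ℕ.+-suc (n′ ∸ l) l)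
               (≡.cong suc (ℕ.m∸n+n≡m (ℕ.≤-trans (ℕ.m≤m+n l l) 2l≤n′))))) (≡.sym n≡))
               (ℕ.m+n≤o⇒m≤o∸n l 2l≤n′))) ⟩
      - (q ^ (2 ℕ.* suc l) * (e * gauss (suc l ℕ.+ l) l)) ∎
      where
      g = Gₚ.gauss (n′ ∸ l) l
      ⟪n⟫ₚ : Gₚ.⟪ n ⟫ ≈ - e
      ⟪n⟫ₚ = begin
        Gₚ.⟪ n ⟫              ≈⟨ ⟪⟫ₚ n ⟨
        - (p ^ n * e)         ≈⟨ -‿cong (*-comm (p ^ n) e) ⟩
        - (e * p ^ n)         ≈⟨ -‿cong (e*p n 0 1 (≡.trans (ℕ.+-identityʳ n) (≡.sym (ℕ.*-identityˡ n)))) ⟩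
        - (e * 1#)            ≈⟨ -‿cong (*-identityʳ e) ⟩
        - e                   ∎

    term : ℕ → Carrier
    term k = sign k * q ^ (k ℕ.* (k ∸ 1)) * G².gauss N k * gauss (2 ℕ.* N ∸ 2 ℕ.* k) (D ∸ k)

    prefactor : Carrier
    prefactor = sign D * q ^ (D ℕ.* (D ∸ 1)) * β

    -- Both sides are compared after multiplication by the unit 1 - q^j, j = l+1. Absorption then
    -- extracts 1 - q^(2N-2c) from the second binomial, which is precisely the factor that the first
    -- binomial needs for `gauss²-ratio`. From there on e is present, and everything else may be
    -- reduced modulo Φ_n.
    term-mod : ∀ l c → c ℕ.+ suc l ≡ D → 2 ℕ.* suc l ≤ n → term c ≈ prefactor * ((2 ℕ.* m) ×ₙ 1#) * θterm n l
    term-mod l c c+l≡D h = cancel′ (suc l) (s≤s z≤n) l<n (begin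
      sign c * x * G².gauss N c * gauss (2 ℕ.* N ∸ 2 ℕ.* c) (D ∸ c) * ⟪ suc l ⟫
        ≡⟨ ≡.cong₂ (λ k i → sign c * x * G².gauss N c * gauss k i * ⟪ suc l ⟫) upper lower ⟩
      sign c * x * G².gauss N c * gauss (suc M) (suc l) * ⟪ suc l ⟫
        ≈⟨ *-assoc _ _ _ ⟩
      sign c * x * G².gauss N c * (gauss (suc M) (suc l) * ⟪ suc l ⟫)
        ≈⟨ *-congˡ (gauss-absorb M l) ⟩
      sign c * x * G².gauss N c * (gauss M l * ⟪ suc M ⟫)
        ≈⟨ solve 5 (λ s x G g z → s :* x :* G :* (g :* z) := s :* x :* (G :* z) :* g) refl (sign c) x (G².gauss N c) (gauss M l) ⟪ suc M ⟫ ⟩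
      sign c * x * (G².gauss N c * ⟪ suc M ⟫) * gauss M l
        ≡⟨ ≡.cong (λ k → sign c * x * (G².gauss N c * ⟪ k ⟫) * gauss M l) sucM ⟩
      sign c * x * (G².gauss N c * ⟪ 2 ℕ.* suc l ℕ.+ (2 ℕ.* b) ℕ.* n ⟫) * gauss M l
        ≈⟨ *-congʳ (*-congˡ (gauss²-ratio l c c+l≡D h)) ⟩
      sign c * x * (β * w * (e * σ l)) * gauss M l
        ≈⟨ solve 7 (λ s x b w e t g → s :* x :* (b :* w :* (e :* t)) :* g := b :* w :* (s :* (e :* (x :* t))) :* g) refl
             (sign c) x β w e (σ l) (gauss M l) ⟩
      β * w * (sign c * (e * (x * σ l))) * gauss M l
        ≈⟨ *-congʳ (*-congˡ (sign-powers l c c+l≡D)) ⟩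
      β * w * (- (sign D * (e * (X * Q)))) * gauss M l
        ≈⟨ solve 7 (λ b w s e X Q g → b :* w :* (:- (s :* (e :* (X :* Q)))) :* g := s :* X :* b :* w :* (:- (Q :* (e :* g)))) refl
             β w (sign D) e X Q (gauss M l) ⟩
      sign D * X * β * w * (- (Q * (e * gauss M l)))
        ≈⟨ *-congˡ (-‿cong (*-congˡ (e*gauss-periodic (suc l ℕ.+ l) (2 ℕ.* b) l (ℕ.<-trans (ℕ.n<1+n l) l<n) (ℕ.m≤n+m l (suc l))))) ⟩
      sign D * X * β * w * (- (Q * (e * gauss (suc l ℕ.+ l) l)))
        ≈⟨ *-congˡ (θterm-mod l h) ⟨
      sign D * X * β * w * (θterm n l * ⟪ suc l ⟫)
        ≈⟨ *-assoc _ _ _ ⟨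
      sign D * X * β * w * θterm n l * ⟪ suc l ⟫ ∎)
      where
      x = q ^ (c ℕ.* (c ∸ 1))
      X = q ^ (D ℕ.* (D ∸ 1))
      Q = q ^ (2 ℕ.* suc l)
      w = (2 ℕ.* m) ×ₙ 1#
      M = suc l ℕ.+ l ℕ.+ (2 ℕ.* b) ℕ.* n
      l<n : suc l < n
      l<n = ℕ.<-≤-trans (≡.subst (suc l <_) (≡.cong (suc l ℕ.+_) (≡.sym (ℕ.+-identityʳ (suc l)))) (ℕ.m<m+n (suc l) (s≤s z≤n))) h
      sucM : suc M ≡ 2 ℕ.* suc l ℕ.+ (2 ℕ.* b) ℕ.* n
      sucM = ℕ-solve 2 (λ l x → ℕ-con 1 ⊞ (ℕ-con 1 ⊞ l ⊞ l ⊞ x) ≐ ℕ-con 2 ⊠ (ℕ-con 1 ⊞ l) ⊞ x) ≡.refl l ((2 ℕ.* b) ℕ.* n)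
      lower : D ∸ c ≡ suc l
      lower = ≡.trans (≡.cong (_∸ c) (≡.sym c+l≡D)) (ℕ.m+n∸m≡n c (suc l))
      upper : 2 ℕ.* N ∸ 2 ℕ.* c ≡ suc M
      upper = ≡.trans (≡.cong (λ d → 2 ℕ.* (d ℕ.+ B) ∸ 2 ℕ.* c) (≡.sym c+l≡D))
        (≡.trans (≡.cong (_∸ 2 ℕ.* c) (ℕ-solve 4 (λ c l b n → ℕ-con 2 ⊠ (c ⊞ (ℕ-con 1 ⊞ l) ⊞ b ⊠ n)
           ≐ ℕ-con 2 ⊠ c ⊞ (ℕ-con 1 ⊞ (ℕ-con 1 ⊞ l ⊞ l ⊞ (ℕ-con 2 ⊠ b) ⊠ n))) ≡.refl c l b n))
          (ℕ.m+n∸m≡n (2 ℕ.* c) (suc M)))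

    sum-mod : ∀ h → 2 ℕ.* h ≤ n → h ≤ D →
      ∑ (suc h) (λ i → term (D ∸ h ℕ.+ i)) ≈
      prefactor * (1# - ((2 ℕ.* m) ×ₙ 1#) * (1# - (1# + ∑ h (θterm n))))
    sum-mod h 2h≤n h≤D = begin
      ∑ (suc h) (λ i → term (D ∸ h ℕ.+ i))
        ≈⟨ ∑-reverse h (λ i → term (D ∸ h ℕ.+ i)) ⟩
      term (D ∸ h ℕ.+ h) + ∑ h (λ l → term (D ∸ h ℕ.+ (h ∸ suc l)))
        ≈⟨ +-cong last (trans (∑-cong h others) (∑-*ˡ h (prefactor * w))) ⟩
      prefactor + prefactor * w * ∑ h (θterm n)
        ≈⟨ solve 3 (λ P w s → P :+ P :* w :* s := P :* (con (+ 1) :- w :* (con (+ 1) :- (con (+ 1) :+ s)))) refl prefactor w (∑ h (θterm n)) ⟩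
      prefactor * (1# - w * (1# - (1# + ∑ h (θterm n)))) ∎
      where
      w = (2 ℕ.* m) ×ₙ 1#
      last : term (D ∸ h ℕ.+ h) ≈ prefactor
      last rewrite ℕ.m∸n+n≡m h≤D | ℕ.n∸n≡0 D = *-identityʳ _
      others : ∀ l → l < h → term (D ∸ h ℕ.+ (h ∸ suc l)) ≈ prefactor * w * θterm n l
      others l l<h = term-mod l (D ∸ h ℕ.+ (h ∸ suc l))
        (≡.trans (ℕ.+-assoc (D ∸ h) (h ∸ suc l) (suc l)) (≡.trans (≡.cong (D ∸ h ℕ.+_) (ℕ.m∸n+n≡m l<h)) (ℕ.m∸n+n≡m h≤D)))
        (ℕ.≤-trans (ℕ.*-monoʳ-≤ 2 l<h) 2h≤n)

-- Coprimality through Bézout identities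

module Coprimality {c ℓ k} (R : CommutativeRing c ℓ)
  (Constant : CommutativeRing.Carrier R → Set k) (1-constant : Constant (CommutativeRing.1# R))
  (*-constant : ∀ {x y} → Constant x → Constant y → Constant (CommutativeRing._*_ R x y)) where
  open CommutativeRing R hiding (zero)
  open Solver R
  open SetoidReasoning setoid

  -- The value need not be 1: with nonzero integers as `Constant`, this is coprimality over ℚ
  -- expressed by integral polynomials.
  record Coprime (f g : Carrier) : Set (c ⊔ ℓ ⊔ k) where
    constructor bezout
    field
      {u v value} : Carrier
      constant : Constant value
      identity : u * f + v * g ≈ value

  record Divides (f g : Carrier) : Set (c ⊔ ℓ) where
    constructor factored
    field
      {cofactor} : Carrier
      equation   : f * cofactor ≈ g

  divides-trans : ∀ {f g h} → Divides f g → Divides g h → Divides f h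
  divides-trans (factored fa≈g) (factored gb≈h) = factored (trans (sym (*-assoc _ _ _)) (trans (*-congʳ fa≈g) gb≈h))

  coprime-sym : ∀ {f g} → Coprime f g → Coprime g f
  coprime-sym (bezout k e) = bezout k (trans (+-comm _ _) e)

  coprime-1 : ∀ {f} → Coprime 1# f
  coprime-1 {f} = bezout {u = 1#} {v = 0#} 1-constant
    (solve 1 (λ f → con (+ 1) :* con (+ 1) :+ con (+ 0) :* f := con (+ 1)) refl f)

  coprime-* : ∀ {f g h} → Coprime f h → Coprime g h → Coprime (f * g) h
  coprime-* {f} {g} {h} (bezout {u} {v} {a} k e) (bezout {u′} {v′} {a′} k′ e′) =
    bezout {u = u * u′} {v = u * f * v′ + v * (u′ * g + v′ * h)} (*-constant k k′) (begin
      u * u′ * (f * g) + (u * f * v′ + v * (u′ * g + v′ * h)) * h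
        ≈⟨ solve 7 (λ u v u′ v′ f g h → u :* u′ :* (f :* g) :+ (u :* f :* v′ :+ v :* (u′ :* g :+ v′ :* h)) :* h
             := (u :* f :+ v :* h) :* (u′ :* g :+ v′ :* h)) refl u v u′ v′ f g h ⟩
      (u * f + v * h) * (u′ * g + v′ * h)
        ≈⟨ *-cong e e′ ⟩
      a * a′ ∎)

  coprime-divisor : ∀ {f g h} → Divides f g → Coprime g h → Coprime f h
  coprime-divisor {f} {g} {h} (factored {d} fd≈g) (bezout {u} {v} {a} k e) = bezout {u = u * d} {v = v} k (begin
    u * d * f + v * h      ≈⟨ +-congʳ (solve 3 (λ u d f → u :* d :* f := u :* (f :* d)) refl u d f) ⟩
    u * (f * d) + v * h    ≈⟨ +-congʳ (*-congˡ fd≈g) ⟩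
    u * g + v * h          ≈⟨ e ⟩
    a                      ∎)

  product : List Carrier → Carrier
  product = foldr _*_ 1#

  coprime-product : ∀ {f fs} → All (Coprime f) fs → Coprime f (product fs)
  coprime-product [] = coprime-sym coprime-1
  coprime-product (c ∷ cs) = coprime-sym (coprime-* (coprime-sym c) (coprime-sym (coprime-product cs)))

  -- If u f + v P = b with N = f d and a N = P h, then b a N = u f (P h) + a v P (f d) is a multiple
  -- of f P. The constants accumulate, so this is divisibility over ℚ until `integral-quotient`
  -- removes them.
  product-divides : ∀ {N fs} → AllPairs Coprime fs → All (λ f → Divides f N) fs →
                    Σ Carrier λ a → Constant a × Divides (product fs) (a * N)
  product-divides {N} [] [] = 1# , 1-constant , factored (*-identityˡ _)
  product-divides {N} {f ∷ fs} (c ∷ cs) (factored {d} fd≈N ∷ ds) with product-divides cs ds | coprime-product c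
  ... | a , ka , factored {h} Ph≈aN | bezout {u} {v} {b} kb e = b * a , *-constant kb ka , factored {cofactor = u * h + a * (v * d)} (begin
    f * P * (u * h + a * (v * d))
      ≈⟨ solve 7 (λ f P u h a v d → f :* P :* (u :* h :+ a :* (v :* d)) := u :* f :* (P :* h) :+ a :* (v :* P :* (f :* d)))
           refl f P u h a v d ⟩
    u * f * (P * h) + a * (v * P * (f * d))
      ≈⟨ +-cong (*-congˡ Ph≈aN) (*-congˡ (*-congˡ fd≈N)) ⟩
    u * f * (a * N) + a * (v * P * N)
      ≈⟨ solve 6 (λ f P u a v N → u :* f :* (a :* N) :+ a :* (v :* P :* N) := (u :* f :+ v :* P) :* a :* N) refl f P u a v N ⟩
    (u * f + v * P) * a * N
      ≈⟨ *-congʳ (*-congʳ e) ⟩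
    b * a * N ∎)
    where P = product fs

  product-++ : ∀ fs gs → product (fs ++ gs) ≈ product fs * product gs
  product-++ [] gs = sym (*-identityˡ _)
  product-++ (f ∷ fs) gs = trans (*-congˡ (product-++ fs gs)) (sym (*-assoc _ _ _))

-- Powers minus one and the gcd of exponents

module PowerMinusOne {c ℓ} (R : CommutativeRing c ℓ) (x : CommutativeRing.Carrier R) where
  open CommutativeRing R hiding (zero)
  open Exponents commutativeSemiring using (_^_; ^-homo-*)
  open IntegerMultiples R using (_×ₙ_; 1+×)
  open Solver R
  open SetoidReasoning setoid

  _−1 : ℕ → Carrier
  n −1 = x ^ n - 1#

  geometric : ℕ → ℕ → Carrier
  geometric g zero = 0#
  geometric g (suc k) = 1# + x ^ g * geometric g k

  geometric-* : ∀ g k → (g −1) * geometric g k ≈ (k ℕ.* g) −1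
  geometric-* g zero = solve 1 (λ y → (y :- con (+ 1)) :* con (+ 0) := con (+ 1) :- con (+ 1)) refl (x ^ g)
  geometric-* g (suc k) = begin
    (g −1) * (1# + x ^ g * geometric g k)
      ≈⟨ solve 2 (λ y s → (y :- con (+ 1)) :* (con (+ 1) :+ y :* s) := y :- con (+ 1) :+ y :* ((y :- con (+ 1)) :* s)) refl (x ^ g) (geometric g k) ⟩
    (g −1) + x ^ g * ((g −1) * geometric g k)
      ≈⟨ +-congˡ (*-congˡ (geometric-* g k)) ⟩
    (g −1) + x ^ g * ((k ℕ.* g) −1)
      ≈⟨ solve 2 (λ y z → y :- con (+ 1) :+ y :* (z :- con (+ 1)) := y :* z :- con (+ 1)) refl (x ^ g) (x ^ (k ℕ.* g)) ⟩
    x ^ g * x ^ (k ℕ.* g) - 1#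
      ≈⟨ +-congʳ (^-homo-* x g (k ℕ.* g)) ⟨
    (suc k ℕ.* g) −1 ∎

  geometric-mod : ∀ g k → Σ Carrier λ t → geometric g k + t * (g −1) ≈ k ×ₙ 1#
  geometric-mod g zero = 0# , solve 1 (λ y → con (+ 0) :+ con (+ 0) :* y := con (+ 0)) refl (g −1)
  geometric-mod g (suc k) with geometric-mod g k
  ... | t , e = t - geometric g k , (begin
    1# + x ^ g * s + (t - s) * (g −1)
      ≈⟨ solve 3 (λ y s t → con (+ 1) :+ y :* s :+ (t :- s) :* (y :- con (+ 1)) := con (+ 1) :+ (s :+ t :* (y :- con (+ 1)))) refl (x ^ g) s t ⟩
    1# + (s + t * (g −1))      ≈⟨ +-congˡ e ⟩
    1# + (k ×ₙ 1#)             ≈⟨ 1+× k 1# ⟨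
    suc k ×ₙ 1#                ∎)
    where s = geometric g k

  private
    difference : ∀ g a b → g ℕ.+ a ≡ b → (b −1) - (a −1) * x ^ g ≈ g −1
    difference g a _ ≡.refl = begin
      (x ^ (g ℕ.+ a) - 1#) - (x ^ a - 1#) * x ^ g
        ≈⟨ +-congʳ (+-congʳ (^-homo-* x g a)) ⟩
      (x ^ g * x ^ a - 1#) - (x ^ a - 1#) * x ^ g
        ≈⟨ solve 2 (λ y z → (y :* z :- con (+ 1)) :- (z :- con (+ 1)) :* y := y :- con (+ 1)) refl (x ^ g) (x ^ a) ⟩
      x ^ g - 1# ∎

  -- An integer relation g + b n = a m gives x^g - 1 = (x^(am) - 1) - x^g (x^(bn) - 1), and
  -- geometric sums make the right side a combination of x^m - 1 and x^n - 1. The library states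
  -- Bézout over ℕ with two possible signs, hence two cases.
  gcd-combination : ∀ m n → Σ Carrier λ u → Σ Carrier λ v → u * (m −1) + v * (n −1) ≈ gcd m n −1
  gcd-combination m n with Bézout.identity (gcd-GCD m n)
  ... | Bézout.+- a b e = geometric m a , - (geometric n b * x ^ gcd m n) , (begin
    geometric m a * (m −1) + - (geometric n b * x ^ gcd m n) * (n −1)
      ≈⟨ solve 5 (λ s M t y N → s :* M :+ :- (t :* y) :* N := M :* s :- N :* t :* y) refl
           (geometric m a) (m −1) (geometric n b) (x ^ gcd m n) (n −1) ⟩
    (m −1) * geometric m a - (n −1) * geometric n b * x ^ gcd m n
      ≈⟨ +-cong (geometric-* m a) (-‿cong (*-congʳ (geometric-* n b))) ⟩
    ((a ℕ.* m) −1) - ((b ℕ.* n) −1) * x ^ gcd m n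
      ≈⟨ difference (gcd m n) (b ℕ.* n) (a ℕ.* m) e ⟩
    gcd m n −1 ∎)
  ... | Bézout.-+ a b e = - (geometric m a * x ^ gcd m n) , geometric n b , (begin
    - (geometric m a * x ^ gcd m n) * (m −1) + geometric n b * (n −1)
      ≈⟨ solve 5 (λ s M t y N → :- (s :* y) :* M :+ t :* N := N :* t :- M :* s :* y) refl
           (geometric m a) (m −1) (geometric n b) (x ^ gcd m n) (n −1) ⟩
    (n −1) * geometric n b - (m −1) * geometric m a * x ^ gcd m n
      ≈⟨ +-cong (geometric-* n b) (-‿cong (*-congʳ (geometric-* m a))) ⟩
    ((b ℕ.* n) −1) - ((a ℕ.* m) −1) * x ^ gcd m n
      ≈⟨ difference (gcd m n) (a ℕ.* m) (b ℕ.* n) e ⟩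
    gcd m n −1 ∎)

-- Stated for an abstract ring, because the solver is slow on the concrete operations of ℤ[q].
module Identities {c ℓ} (R : CommutativeRing c ℓ) where
  open CommutativeRing R hiding (zero)
  open Solver R
  open SetoidReasoning setoid

  bezout-combine : ∀ a u v b I D F → a * v * I + (a * u * D + b) * F ≈ a * (u * (D * F) + v * I) + b * F
  bezout-combine = solve 7 (λ a u v b I D F → a :* v :* I :+ (a :* u :* D :+ b) :* F
    := a :* (u :* (D :* F) :+ v :* I) :+ b :* F) refl

  medial : ∀ a b c d → (a * b) * (c * d) ≈ (a * c) * (b * d)
  medial = solve 4 (λ a b c d → (a :* b) :* (c :* d) := (a :* c) :* (b :* d)) refl

  sum-transfer : ∀ a β b α γ δ c d → a * γ ≈ α * c → b * δ ≈ β * d → (a * β + b * α) * (γ * δ) ≈ (α * β) * (c * δ + d * γ)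
  sum-transfer a β b α γ δ c d h h′ = begin
    (a * β + b * α) * (γ * δ)                    ≈⟨ solve 6 (λ a β b α γ δ → (a :* β :+ b :* α) :* (γ :* δ)
                                                      := (a :* γ) :* (β :* δ) :+ (b :* δ) :* (α :* γ)) refl a β b α γ δ ⟩
    (a * γ) * (β * δ) + (b * δ) * (α * γ)        ≈⟨ +-cong (*-congʳ h) (*-congʳ h′) ⟩
    (α * c) * (β * δ) + (β * d) * (α * γ)        ≈⟨ solve 6 (λ c β d α γ δ → (α :* c) :* (β :* δ) :+ (β :* d) :* (α :* γ)
                                                      := (α :* β) :* (c :* δ :+ d :* γ)) refl c β d α γ δ ⟩
    (α * β) * (c * δ + d * γ)                    ∎

  difference-transfer : ∀ Q γ δ a β b α c d t P → a * γ ≈ α * c → b * δ ≈ β * d → Q * (c * δ - d * γ) ≈ t * P →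
                        Q * (γ * δ) * (a * β - b * α) ≈ (α * β * t) * P
  difference-transfer Q γ δ a β b α c d t P h h′ e = begin
    Q * (γ * δ) * (a * β - b * α)                      ≈⟨ solve 7 (λ Q γ δ a β b α → Q :* (γ :* δ) :* (a :* β :- b :* α)
                                                            := Q :* ((a :* γ) :* (δ :* β) :- (b :* δ) :* (γ :* α))) refl Q γ δ a β b α ⟩
    Q * ((a * γ) * (δ * β) - (b * δ) * (γ * α))        ≈⟨ *-congˡ (+-cong (*-congʳ h) (-‿cong (*-congʳ h′))) ⟩
    Q * ((α * c) * (δ * β) - (β * d) * (γ * α))        ≈⟨ solve 7 (λ Q γ δ c β d α → Q :* ((α :* c) :* (δ :* β) :- (β :* d) :* (γ :* α))
                                                            := α :* β :* (Q :* (c :* δ :- d :* γ))) refl Q γ δ c β d α ⟩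
    α * β * (Q * (c * δ - d * γ))                      ≈⟨ *-congˡ e ⟩
    α * β * (t * P)                                    ≈⟨ *-assoc (α * β) t P ⟨
    (α * β * t) * P                                    ∎

  times-minus-one : ∀ y → (1# - y) * - 1# ≈ y - 1#
  times-minus-one = solve 1 (λ y → (con (+ 1) :- y) :* (:- con (+ 1)) := y :- con (+ 1)) refl

  factor-square : ∀ y D F → D * F ≈ y - 1# → (1# - y) * (1# - y) ≈ (F * F) * (D * D)
  factor-square y D F e = begin
    (1# - y) * (1# - y)      ≈⟨ solve 1 (λ y → (con (+ 1) :- y) :* (con (+ 1) :- y) := (y :- con (+ 1)) :* (y :- con (+ 1))) refl y ⟩
    (y - 1#) * (y - 1#)      ≈⟨ *-cong e e ⟨
    (D * F) * (D * F)        ≈⟨ solve 2 (λ D F → (D :* F) :* (D :* F) := (F :* F) :* (D :* D)) refl D F ⟩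
    (F * F) * (D * D)        ∎

  factor-unit : ∀ x y D F → D * F ≈ x * y - 1# → y * x + - D * F ≈ 1#
  factor-unit x y D F e = begin
    y * x + - D * F          ≈⟨ solve 4 (λ x y D F → y :* x :+ :- D :* F := x :* y :- D :* F) refl x y D F ⟩
    x * y - D * F            ≈⟨ +-congˡ (-‿cong e) ⟩
    x * y - (x * y - 1#)     ≈⟨ solve 1 (λ z → z :- (z :- con (+ 1)) := con (+ 1)) refl (x * y) ⟩
    1#                       ∎

-- Division in ℤ[q]

VanishesFrom : ℕ → Poly → Set
VanishesFrom k p = ∀ i → k ≤ i → coeff p i ≡ + 0

vanishes-length : ∀ p → VanishesFrom (length p) p
vanishes-length [] i _ = ≡.refl
vanishes-length (a ∷ p) (suc i) (s≤s h) = vanishes-length p i h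

coeff-∷-+ : ∀ a d x i → coeff (d *ₚ (a ∷ x)) (suc i) ≡ a ℤ.* coeff d (suc i) ℤ.+ coeff (d *ₚ x) i
coeff-∷-+ a d x i = ≡.trans (at (*ₚ-∷ d a x) (suc i)) (≡.trans (coeff-+ (scaleₚ a d) _ (suc i))
  (≡.cong (ℤ._+ coeff (d *ₚ x) i) (coeff-scale a d (suc i))))

coeff-*-0 : ∀ p r → coeff (p *ₚ r) 0 ≡ coeff p 0 ℤ.* coeff r 0
coeff-*-0 [] r = ≡.sym (ℤ.*-zeroˡ (coeff r 0))
coeff-*-0 (a ∷ p) r = ≡.trans (coeff-+ (scaleₚ a r) _ 0) (≡.trans (ℤ.+-identityʳ _) (coeff-scale a r 0))

coeff-minus : ∀ x y i → coeff (x -ₚ y) i ≡ coeff x i ℤ.- coeff y i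
coeff-minus x y i = ≡.trans (coeff-+ x _ i) (≡.cong (λ w → coeff x i ℤ.+ w) (≡.trans (coeff-scale (ℤ.- (+ 1)) y i) (ℤ.-1*i≡-i _)))

coeff-tail : ∀ p i → coeff (tailₚ p) i ≡ coeff p (suc i)
coeff-tail [] i = ≡.refl
coeff-tail (a ∷ p) i = ≡.refl

-- A nonzero constant term makes d invertible as a power series over ℚ.
series-cancel : ∀ d x K → ¬ coeff d 0 ≡ + 0 → (∀ i → i < K → coeff (d *ₚ x) i ≡ + 0) → ∀ i → i < K → coeff x i ≡ + 0
series-cancel d [] K d₀≢0 h i i<K = ≡.refl
series-cancel d (a ∷ x) (suc K) d₀≢0 h i i<K with ℤ.i*j≡0⇒i≡0∨j≡0 (coeff d 0) (≡.trans (≡.sym (coeff-*-0 d (a ∷ x))) (h 0 (s≤s z≤n)))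
... | inj₁ d₀≡0 = ⊥-elim (d₀≢0 d₀≡0)
... | inj₂ ≡.refl with i | i<K
...   | zero | _ = ≡.refl
...   | suc i | s≤s i<K = series-cancel d x K d₀≢0
  (λ i i<K → ≡.trans (≡.sym (≡.trans (coeff-∷-+ (+ 0) d x i) (≡.trans (≡.cong (ℤ._+ coeff (d *ₚ x) i) (ℤ.*-zeroˡ (coeff d (suc i)))) (ℤ.+-identityˡ _))))
    (h (suc i) (s≤s i<K))) i i<K

divSeries-tail : ∀ d p c i → coeff (tailₚ (p -ₚ scaleₚ c d)) i ≡ coeff p (suc i) ℤ.- c ℤ.* coeff d (suc i)
divSeries-tail d p c i = ≡.trans (coeff-tail (p -ₚ scaleₚ c d) i) (≡.trans (coeff-+ p _ (suc i)) (≡.cong (λ w → coeff p (suc i) ℤ.+ w)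
  (≡.trans (coeff-scale (ℤ.- (+ 1)) (scaleₚ c d) (suc i)) (≡.trans (ℤ.-1*i≡-i _) (≡.cong ℤ.-_ (coeff-scale c d (suc i)))))))

-- A constant term ±1 is its own inverse, so d₀ p₀ is the correct first coefficient of the quotient,
-- and the remainder loses its constant term at each step.
divSeries-agrees : ∀ K d p → coeff d 0 ℤ.* coeff d 0 ≡ + 1 → ∀ i → i < K → coeff (d *ₚ divSeries K d p) i ≡ coeff p i
divSeries-agrees (suc K) d p d₀² zero i<K = ≡.trans (coeff-*-0 d _) (≡.trans (≡.sym (ℤ.*-assoc (coeff d 0) (coeff d 0) (coeff p 0)))
  (≡.trans (≡.cong (ℤ._* coeff p 0) d₀²) (ℤ.*-identityˡ _)))
divSeries-agrees (suc K) d p d₀² (suc i) (s≤s i<K) = ≡.trans (coeff-∷-+ c d _ i) (≡.trans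
  (≡.cong (λ w → c ℤ.* coeff d (suc i) ℤ.+ w) (≡.trans (divSeries-agrees K d _ d₀² i i<K) (divSeries-tail d p c i)))
  (cancel (c ℤ.* coeff d (suc i)) (coeff p (suc i))))
  where
  c = coeff d 0 ℤ.* coeff p 0
  cancel : ∀ x y → x ℤ.+ (y ℤ.- x) ≡ y
  cancel x y = ≡.trans (ℤ.+-comm x _) (≡.trans (ℤ.+-assoc y (ℤ.- x) x) (≡.trans (≡.cong (λ w → y ℤ.+ w) (ℤ.+-inverseˡ x)) (ℤ.+-identityʳ y)))

divSeries-length : ∀ K d p → VanishesFrom K (divSeries K d p)
divSeries-length zero d p i _ = ≡.refl
divSeries-length (suc K) d p (suc i) (s≤s h) = divSeries-length K d _ i h

*ₚ-vanishes : ∀ d x → d ≋ [] → d *ₚ x ≋ []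
*ₚ-vanishes d x d≋0 = *ₚ-cong d≋0 (≋-refl {x})

leading-coeff : ∀ d x f e → VanishesFrom (suc f) d → VanishesFrom (suc e) x →
                coeff (d *ₚ x) (f ℕ.+ e) ≡ coeff d f ℤ.* coeff x e
leading-coeff [] x f e _ _ = ≡.sym (ℤ.*-zeroˡ (coeff x e))
leading-coeff (a ∷ d) x zero e hd hx = ≡.trans (coeff-+ (scaleₚ a x) _ e)
  (≡.trans (≡.cong₂ ℤ._+_ (coeff-scale a x e) (at {p = + 0 ∷ (d *ₚ x)} {r = []}
     (≋-trans (0∷-cong (*ₚ-vanishes d x (coeffwise (λ i → hd (suc i) (s≤s z≤n))))) 0∷[]≋[]) e)) (ℤ.+-identityʳ _))
leading-coeff (a ∷ d) x (suc f) e hd hx = ≡.trans (coeff-+ (scaleₚ a x) _ (suc f ℕ.+ e))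
  (≡.trans (≡.cong₂ ℤ._+_ (≡.trans (coeff-scale a x (suc f ℕ.+ e)) (≡.trans (≡.cong (a ℤ.*_) (hx (suc f ℕ.+ e) (s≤s (ℕ.m≤n+m e f)))) (ℤ.*-zeroʳ a)))
     (leading-coeff d x f e (λ i h → hd (suc i) (s≤s h)) hx)) (ℤ.+-identityˡ _))

degree : ∀ p → p ≋ [] ⊎ Σ ℕ λ f → (¬ coeff p f ≡ + 0) × VanishesFrom (suc f) p
degree [] = inj₁ ≋-refl
degree (a ∷ p) with degree p
... | inj₂ (f , p_f≢0 , v) = inj₂ (suc f , p_f≢0 , λ { (suc i) (s≤s h) → v i h })
... | inj₁ p≋0 with a ℤ.≟ + 0
...   | yes ≡.refl = inj₁ (≋-trans (0∷-cong p≋0) 0∷[]≋[])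
...   | no a≢0 = inj₂ (0 , a≢0 , λ { (suc i) _ → at p≋0 i })

-- If the last nonzero coefficient of s stood at or beyond k, its product with that of d would be a
-- nonzero coefficient of p at or beyond k. Hence cutting the quotient series at k loses nothing.
quotient-vanishes : ∀ d s p k → ¬ coeff d 0 ≡ + 0 → d *ₚ s ≋ p → VanishesFrom k p → VanishesFrom k s
quotient-vanishes d s p k d₀≢0 ds≋p v i k≤i with degree s | degree d
... | inj₁ s≋0 | _ = at s≋0 i
... | inj₂ _ | inj₁ d≋0 = ⊥-elim (d₀≢0 (at d≋0 0))
... | inj₂ (e , s≢0 , vs) | inj₂ (f , d≢0 , vd) with suc e ℕ.≤? i
...   | yes e<i = vs i e<i
...   | no e≮i with ℤ.i*j≡0⇒i≡0∨j≡0 (coeff d f) (≡.trans (≡.sym (leading-coeff d s f e vd vs))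
          (≡.trans (at ds≋p (f ℕ.+ e)) (v (f ℕ.+ e) (ℕ.≤-trans k≤i (ℕ.≤-trans (ℕ.≮⇒≥ e≮i) (ℕ.m≤n+m e f))))))
...     | inj₁ d≡0 = ⊥-elim (d≢0 d≡0)
...     | inj₂ s≡0 = ⊥-elim (s≢0 s≡0)

scaleₚ-cancel : ∀ {c p r} → ¬ c ≡ + 0 → scaleₚ c p ≋ scaleₚ c r → p ≋ r
scaleₚ-cancel {c} {p} {r} c≢0 h .at i = ℤ.*-cancelˡ-≡ c (coeff p i) (coeff r i) {{ℤ.≢-nonZero c≢0}}
  (≡.trans (≡.sym (coeff-scale c p i)) (≡.trans (at h i) (coeff-scale c r i)))

*ₚ-scaleₚ : ∀ c p r → p *ₚ scaleₚ c r ≋ scaleₚ c (p *ₚ r)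
*ₚ-scaleₚ c p r = ≋-trans (*ₚ-comm p (scaleₚ c r)) (≋-trans (scaleₚ-* c r p) (scaleₚ-cong c (*ₚ-comm r p)))

private
  ±1≢0 : ∀ {x} → x ℤ.* x ≡ + 1 → ¬ x ≡ + 0
  ±1≢0 () ≡.refl

-- Divisibility over ℚ by a polynomial with constant term ±1 is divisibility over ℤ, since
-- the quotient is then the integral power series.
integral-quotient : ∀ d E p c → coeff d 0 ℤ.* coeff d 0 ≡ + 1 → ¬ c ≡ + 0 → d *ₚ E ≋ scaleₚ c p → Σ Poly λ s → d *ₚ s ≋ p
integral-quotient d E p c d₀² c≢0 dE≋cp = s , scaleₚ-cancel c≢0
  (≋-trans (≋-sym (*ₚ-scaleₚ c d s)) (≋-trans (*ₚ-congˡ d cs≋E) dE≋cp))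
  where
  -- `E` vanishes from here on, and so does the series cut at the same place; below it, power series
  -- cancellation gives c s = E.
  K = length E
  s = divSeries K d p
  below : ∀ i → i < K → coeff (d *ₚ (E -ₚ scaleₚ c s)) i ≡ + 0
  below i i<K = ≡.trans (at (*ₚ-distribˡ d E (negₚ (scaleₚ c s))) i)
    (≡.trans (coeff-+ (d *ₚ E) _ i) (≡.trans (≡.cong₂ ℤ._+_ (≡.trans (at dE≋cp i) (coeff-scale c p i))
      (≡.trans (at (*ₚ-scaleₚ (ℤ.- (+ 1)) d (scaleₚ c s)) i) (≡.trans (coeff-scale (ℤ.- (+ 1)) (d *ₚ scaleₚ c s) i)
        (≡.trans (ℤ.-1*i≡-i _) (≡.cong ℤ.-_ (≡.trans (at (*ₚ-scaleₚ c d s) i) (≡.trans (coeff-scale c (d *ₚ s) i)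
          (≡.cong (c ℤ.*_) (divSeries-agrees K d p d₀² i i<K)))))))))
      (ℤ.+-inverseʳ (c ℤ.* coeff p i))))
  cs≋E : scaleₚ c s ≋ E
  cs≋E .at i with i ℕ.<? K
  ... | yes i<K = ≡.sym (ℤ.i-j≡0⇒i≡j (coeff E i) (coeff (scaleₚ c s) i)
    (≡.trans (≡.sym (coeff-minus E (scaleₚ c s) i)) (series-cancel d (E -ₚ scaleₚ c s) K (±1≢0 d₀²) below i i<K)))
  ... | no i≮K = ≡.trans (coeff-scale c s i) (≡.trans (≡.cong (c ℤ.*_) (divSeries-length K d p i (ℕ.≮⇒≥ i≮K)))
    (≡.trans (ℤ.*-zeroʳ c) (≡.sym (vanishes-length E i (ℕ.≮⇒≥ i≮K)))))

-- The truncated series and the known quotient agree below k by cancellation of `d`, and both vanish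
-- from k on.
divSeries-exact : ∀ k d s p → coeff d 0 ℤ.* coeff d 0 ≡ + 1 → d *ₚ s ≋ p → VanishesFrom k p → d *ₚ divSeries k d p ≋ p
divSeries-exact k d s p d₀² ds≋p v = ≋-trans (*ₚ-congˡ d quotient) ds≋p
  where
  s-vanishes = quotient-vanishes d s p k (±1≢0 d₀²) ds≋p v
  t = divSeries k d p
  below : ∀ i → i < k → coeff (d *ₚ (t -ₚ s)) i ≡ + 0
  below i i<k = ≡.trans (at (*ₚ-distribˡ d t (negₚ s)) i) (≡.trans (coeff-+ (d *ₚ t) _ i)
    (≡.trans (≡.cong₂ ℤ._+_ (divSeries-agrees k d p d₀² i i<k)
      (≡.trans (at (*ₚ-scaleₚ (ℤ.- (+ 1)) d s) i) (≡.trans (coeff-scale (ℤ.- (+ 1)) (d *ₚ s) i)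
        (≡.trans (ℤ.-1*i≡-i _) (≡.cong ℤ.-_ (at ds≋p i)))))) (ℤ.+-inverseʳ (coeff p i))))
  quotient : t ≋ s
  quotient .at i with i ℕ.<? k
  ... | yes i<k = ℤ.i-j≡0⇒i≡j (coeff t i) (coeff s i)
    (≡.trans (≡.sym (coeff-minus t s i)) (series-cancel d (t -ₚ s) k (±1≢0 d₀²) below i i<k))
  ... | no i≮k = ≡.trans (divSeries-length k d p i (ℕ.≮⇒≥ i≮k)) (≡.sym (s-vanishes i (ℕ.≮⇒≥ i≮k)))

-- Cyclotomic polynomials

NonzeroConstant : Poly → Set
NonzeroConstant p = Σ ℤ λ c → (¬ c ≡ + 0) × p ≋ constₚ c

*-NonzeroConstant : ∀ {p r} → NonzeroConstant p → NonzeroConstant r → NonzeroConstant (p *ₚ r)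
*-NonzeroConstant {p} {r} (c , c≢0 , p≋c) (d , d≢0 , r≋d) = c ℤ.* d , cd≢0 ,
  ≋-trans (*ₚ-cong p≋c r≋d) (constₚ-* c (constₚ d))
  where
  cd≢0 : ¬ c ℤ.* d ≡ + 0
  cd≢0 e with ℤ.i*j≡0⇒i≡0∨j≡0 c e
  ... | inj₁ c≡0 = c≢0 c≡0
  ... | inj₂ d≡0 = d≢0 d≡0

open Coprimality polyRing NonzeroConstant (+ 1 , (λ ()) , ≋-refl) *-NonzeroConstant public
open PowerMinusOne polyRing (Xᵖ 1) public
private module Pℤ = IntegerMultiples polyRing
open Exponents (CommutativeRing.commutativeSemiring polyRing) using () renaming (_^_ to _^ₚ_) public

Xᵖ-suc : ∀ k → Xᵖ (suc k) ≋ Xᵖ 1 *ₚ Xᵖ k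
Xᵖ-suc k = ≋-sym (≋-trans (0∷-* (constₚ (+ 1)) (Xᵖ k)) (0∷-cong (*ₚ-identityˡ (Xᵖ k))))

Xᵖ-^ : ∀ k → Xᵖ k ≋ Xᵖ 1 ^ₚ k
Xᵖ-^ zero = ≋-refl
Xᵖ-^ (suc k) = ≋-trans (Xᵖ-suc k) (*ₚ-congˡ (Xᵖ 1) (Xᵖ-^ k))

Xᵖ-1 : ∀ k → Xᵖ k -ₚ constₚ (+ 1) ≋ k −1
Xᵖ-1 k = +ₚ-cong (Xᵖ-^ k) ≋-refl

×ₙ-constₚ : ∀ k → k Pℤ.×ₙ constₚ (+ 1) ≋ constₚ (+ k)
×ₙ-constₚ zero = ≋-sym 0∷[]≋[]
×ₙ-constₚ (suc k) = ≋-trans (Pℤ.1+× k (constₚ (+ 1))) (+ₚ-cong (≋-refl {constₚ (+ 1)}) (×ₙ-constₚ k))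

Xᵖ-vanishes : ∀ m → VanishesFrom (suc m) (Xᵖ m)
Xᵖ-vanishes zero (suc i) _ = ≡.refl
Xᵖ-vanishes (suc m) (suc i) (s≤s h) = Xᵖ-vanishes m i h

Xᵖ-1-vanishes : ∀ m → VanishesFrom (suc m) (Xᵖ m -ₚ constₚ (+ 1))
Xᵖ-1-vanishes m (suc i) h = ≡.trans (coeff-+ (Xᵖ m) (negₚ (constₚ (+ 1))) (suc i)) (≡.cong (ℤ._+ + 0) (Xᵖ-vanishes m (suc i) h))

properDivisors : ℕ → List (ℕ × Poly)
properDivisors m = filter (λ x → proj₁ x ∣? m) (cyclos (ℕ.pred m))

Δ : ℕ → Poly
Δ m = prodₚ (map proj₂ (properDivisors m))

lastPoly-snoc : ∀ xs x → lastPoly (xs ++ x ∷ []) ≡ proj₂ x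
lastPoly-snoc [] x = ≡.refl
lastPoly-snoc (y ∷ []) x = ≡.refl
lastPoly-snoc (y ∷ z ∷ xs) x = lastPoly-snoc (z ∷ xs) x

Φ-suc : ∀ n → Φ (suc n) ≡ divSeries (suc (suc n)) (Δ (suc n)) (Xᵖ (suc n) -ₚ constₚ (+ 1))
Φ-suc n = lastPoly-snoc (cyclos n) _

cyclos-suc : ∀ n → cyclos (suc n) ≡ cyclos n ++ (suc n , Φ (suc n)) ∷ []
cyclos-suc n = ≡.cong (λ P → cyclos n ++ (suc n , P) ∷ []) (≡.sym (Φ-suc n))

Entry : ℕ → ℕ × Poly → Set
Entry n (d , P) = 1 ≤ d × d ≤ n × P ≡ Φ d

cyclos-entries : ∀ n → All (Entry n) (cyclos n)
cyclos-entries zero = []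
cyclos-entries (suc n) rewrite cyclos-suc n = All.++⁺
  (All.map (λ { (1≤d , d≤n , e) → 1≤d , ℕ.m≤n⇒m≤1+n d≤n , e }) (cyclos-entries n))
  ((s≤s z≤n , ℕ.≤-refl , ≡.refl) ∷ [])

cyclos-sorted : ∀ n → AllPairs (λ x y → proj₁ x < proj₁ y) (cyclos n)
cyclos-sorted zero = []
cyclos-sorted (suc n) rewrite cyclos-suc n = AllPairs.++⁺ (cyclos-sorted n) ([] ∷ [])
  (All.map (λ { (1≤d , d≤n , e) → s≤s d≤n ∷ [] }) (cyclos-entries n))

-- The three facts support each other in one strong induction: for larger indices `coprime` makes
-- the factors of Δ pairwise coprime, `factor` makes them divide q^m - 1, and `constant` makes the
-- quotient integral.
record IsCyclotomic (m : ℕ) : Set where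
  field
    factor   : Δ m *ₚ Φ m ≋ m −1
    constant : coeff (Φ m) 0 ℤ.* coeff (Φ m) 0 ≡ + 1
    coprime  : ∀ i → ¬ m ∣ i → Coprime (i −1) (Φ m)
open IsCyclotomic public

divides-Φ : ∀ {m} → IsCyclotomic m → Divides (Φ m) (m −1)
divides-Φ {m} C = factored (≋-trans (*ₚ-comm (Φ m) (Δ m)) (factor C))

divides-power : ∀ {d m} → d ∣ m → Divides (d −1) (m −1)
divides-power {d} (divides k ≡.refl) = factored (geometric-* d k)

AllPairs-map-with : ∀ {A : Set} {P : A → Set} {R S : A → A → Set} → (∀ {x y} → P x → P y → R x y → S x y) →
                    ∀ {xs} → All P xs → AllPairs R xs → AllPairs S xs
AllPairs-map-with f [] [] = []
AllPairs-map-with f (p ∷ ps) (r ∷ rs) = All.zipWith (λ { (q , r) → f p q r }) (ps , r) ∷ AllPairs-map-with f ps rs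

prodₚ-filter-∣ : ∀ {g m} → g ∣ m → ∀ xs → Divides (prodₚ (map proj₂ (filter (λ x → proj₁ x ∣? g) xs)))
                                                    (prodₚ (map proj₂ (filter (λ x → proj₁ x ∣? m) xs)))
prodₚ-filter-∣ g∣m [] = factored {cofactor = constₚ (+ 1)} (*ₚ-identityˡ (constₚ (+ 1)))
prodₚ-filter-∣ {g} {m} g∣m ((d , P) ∷ xs) with prodₚ-filter-∣ g∣m xs | d ∣? g | d ∣? m
... | factored {h} e | yes d∣g | yes d∣m = factored (≋-trans (*ₚ-assoc P _ h) (*ₚ-congˡ P e))
... | _ | yes d∣g | no d∤m = ⊥-elim (d∤m (∣-trans d∣g g∣m))
... | e | no d∤g | no d∤m = e
... | factored {h} e | no d∤g | yes d∣m = factored {cofactor = h *ₚ P}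
  (≋-trans (≋-sym (*ₚ-assoc (prodₚ (map proj₂ (filter (λ x → proj₁ x ∣? g) xs))) h P)) (≋-trans (*ₚ-cong e ≋-refl) (*ₚ-comm _ P)))

prodₚ-filter-prefix : ∀ m xs ys → Divides (prodₚ (map proj₂ (filter (λ x → proj₁ x ∣? m) xs)))
                                           (prodₚ (map proj₂ (filter (λ x → proj₁ x ∣? m) (xs ++ ys))))
prodₚ-filter-prefix m xs ys
  rewrite List.filter-++ (λ x → proj₁ x ∣? m) xs ys
        | List.map-++ proj₂ (filter (λ x → proj₁ x ∣? m) xs) (filter (λ x → proj₁ x ∣? m) ys) =
  factored (≋-sym (product-++ (map proj₂ (filter (λ x → proj₁ x ∣? m) xs)) _))

cyclos-prefix : ∀ {k n} → k ℕ.≤′ n → Σ (List (ℕ × Poly)) λ ys → cyclos n ≡ cyclos k ++ ys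
cyclos-prefix ℕ.≤′-refl = [] , ≡.sym (List.++-identityʳ _)
cyclos-prefix {k} {suc n} (ℕ.≤′-step k≤n) with cyclos-prefix k≤n
... | ys , e = ys ++ (suc n , Φ (suc n)) ∷ [] ,
  ≡.trans (cyclos-suc n) (≡.trans (≡.cong (_++ (suc n , Φ (suc n)) ∷ []) e) (List.++-assoc (cyclos k) ys _))

prodₚ-filter-snoc : ∀ m xs P → prodₚ (map proj₂ (filter (λ x → proj₁ x ∣? m) (xs ++ (m , P) ∷ []))) ≋
                               prodₚ (map proj₂ (filter (λ x → proj₁ x ∣? m) xs)) *ₚ P
prodₚ-filter-snoc m xs P
  rewrite List.filter-++ (λ x → proj₁ x ∣? m) xs ((m , P) ∷ [])
        | List.filter-accept (λ x → proj₁ x ∣? m) {x = m , P} {xs = []} ∣-refl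
        | List.map-++ proj₂ (filter (λ x → proj₁ x ∣? m) xs) ((m , P) ∷ []) =
  ≋-trans (product-++ (map proj₂ (filter (λ x → proj₁ x ∣? m) xs)) (P ∷ []))
    (*ₚ-congˡ (prodₚ (map proj₂ (filter (λ x → proj₁ x ∣? m) xs))) (≋-trans (*ₚ-comm P (constₚ (+ 1))) (*ₚ-identityˡ P)))

Δ-Φ : ∀ g → prodₚ (map proj₂ (filter (λ x → proj₁ x ∣? suc g) (cyclos (suc g)))) ≋ Δ (suc g) *ₚ Φ (suc g)
Δ-Φ g = ≡.subst (λ xs → prodₚ (map proj₂ (filter (λ x → proj₁ x ∣? suc g) xs)) ≋ Δ (suc g) *ₚ Φ (suc g))
  (≡.sym (cyclos-suc g)) (prodₚ-filter-snoc (suc g) (cyclos g) (Φ (suc g)))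

-- For r = g+1, q^r - 1 is the product of the Φ_d with d ∣ r. These factors all occur in Δ, since
-- `cyclos r` is a prefix of `cyclos n` and every divisor of r divides n+1.
divides-Δ : ∀ {g n} → IsCyclotomic (suc g) → suc g ∣ suc n → suc g ≤ n → Divides (suc g −1) (Δ (suc n))
divides-Δ {g} {n} C g∣n g≤n with cyclos-prefix (ℕ.≤⇒≤′ g≤n)
... | ys , e = divides-trans (factored (≋-trans (*ₚ-comm (suc g −1) (constₚ (+ 1))) (≋-trans (*ₚ-identityˡ (suc g −1))
                 (≋-sym (≋-trans (Δ-Φ g) (factor C))))))
  (divides-trans (prodₚ-filter-∣ g∣n (cyclos (suc g)))
    (≡.subst (λ xs → Divides (prodₚ (map proj₂ (filter (λ x → proj₁ x ∣? suc n) (cyclos (suc g)))))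
                              (prodₚ (map proj₂ (filter (λ x → proj₁ x ∣? suc n) xs)))) (≡.sym e)
      (prodₚ-filter-prefix (suc n) (cyclos (suc g)) ys)))

-- The constant term of q^(g+1) - 1 is -1, so it can be cancelled as a power series.
cancel-−1 : ∀ g {x y} → (suc g −1) *ₚ x ≋ (suc g −1) *ₚ y → x ≋ y
cancel-−1 g {x} {y} h .at i = ℤ.i-j≡0⇒i≡j (coeff x i) (coeff y i) (≡.trans (≡.sym (coeff-minus x y i))
  (series-cancel (suc g −1) (x -ₚ y) (suc i)
    (λ e → -1≢0 (≡.trans (at (Xᵖ-1 (suc g)) 0) e))
    (λ j _ → ≡.trans (at (*ₚ-distribˡ (suc g −1) x (negₚ y)) j) (≡.trans (coeff-+ ((suc g −1) *ₚ x) _ j)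
      (≡.trans (≡.cong₂ ℤ._+_ (at h j) (≡.trans (at (*ₚ-scaleₚ (ℤ.- (+ 1)) (suc g −1) y) j)
        (≡.trans (coeff-scale (ℤ.- (+ 1)) ((suc g −1) *ₚ y) j) (ℤ.-1*i≡-i _)))) (ℤ.+-inverseʳ (coeff ((suc g −1) *ₚ y) j)))))
    i (ℕ.n<1+n i)))
  where
  -1≢0 : ¬ -[1+ 0 ] ≡ + 0
  -1≢0 ()

module _ (n : ℕ) (below : ∀ d → 1 ≤ d → d ≤ n → IsCyclotomic d) where
  private
    m = suc n

    Proper : ℕ × Poly → Set
    Proper (d , P) = Entry n (d , P) × d ∣ m

    proper : All Proper (properDivisors m)
    proper = All.zipWith (λ { (a , b) → a , b })
      (All.filter⁺ (λ x → proj₁ x ∣? m) (cyclos-entries n) , All.all-filter (λ x → proj₁ x ∣? m) (cyclos n))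

    pairwise : AllPairs Coprime (map proj₂ (properDivisors m))
    pairwise = AllPairs.map⁺ (AllPairs-map-with coprime-pair proper
      (AllPairs.filter⁺ (λ x → proj₁ x ∣? m) (cyclos-sorted n)))
      where
      coprime-pair : ∀ {x y} → Proper x → Proper y → proj₁ x < proj₁ y → Coprime (proj₂ x) (proj₂ y)
      -- Φ_d divides q^d - 1, and d < d′ rules out d′ ∣ d, so q^d - 1 is coprime to Φ_d′.
      coprime-pair {d@(suc _) , _} {d′ , _} ((1≤d , d≤n , ≡.refl) , _) ((1≤d′ , d′≤n , ≡.refl) , _) d<d′ =
        coprime-divisor (divides-Φ (below d 1≤d d≤n))
          (coprime (below d′ 1≤d′ d′≤n) d (λ d′∣d → ℕ.<⇒≱ d<d′ (∣⇒≤ d′∣d)))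

    dividing : All (λ P → Divides P (m −1)) (map proj₂ (properDivisors m))
    dividing = All.map⁺ (All.map divisor proper)
      where
      divisor : ∀ {x} → Proper x → Divides (proj₂ x) (m −1)
      divisor {d , _} ((1≤d , d≤n , ≡.refl) , d∣m) = divides-trans (divides-Φ (below d 1≤d d≤n)) (divides-power d∣m)

    units : ∀ {xs} → All Proper xs → coeff (prodₚ (map proj₂ xs)) 0 ℤ.* coeff (prodₚ (map proj₂ xs)) 0 ≡ + 1
    units [] = ≡.refl
    units {(d , P) ∷ xs} (((1≤d , d≤n , ≡.refl) , _) ∷ ps) = ≡.trans
      (≡.cong (λ z → z ℤ.* z) (coeff-*-0 P (prodₚ (map proj₂ xs))))
      (≡.trans (interchange (coeff P 0) _ (coeff P 0) _) (≡.cong₂ ℤ._*_ (constant (below d 1≤d d≤n)) (units ps)))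
      where
      open import Algebra.Properties.CommutativeSemigroup ℤ.*-commutativeSemigroup using (interchange)

    Δ² : coeff (Δ m) 0 ℤ.* coeff (Δ m) 0 ≡ + 1
    Δ² = units proper

    integral : Σ Poly λ s → Δ m *ₚ s ≋ Xᵖ m -ₚ constₚ (+ 1)
    integral with product-divides pairwise dividing
    ... | a , (c , c≢0 , a≋c) , factored {E} h = integral-quotient (Δ m) E (Xᵖ m -ₚ constₚ (+ 1)) c Δ² c≢0
      (≋-trans h (≋-trans (*ₚ-cong a≋c (≋-sym (Xᵖ-1 m))) (constₚ-* c (Xᵖ m -ₚ constₚ (+ 1)))))

    factorₘ : Δ m *ₚ Φ m ≋ Xᵖ m -ₚ constₚ (+ 1)
    factorₘ rewrite Φ-suc n with integral
    ... | s , e = divSeries-exact (suc m) (Δ m) s (Xᵖ m -ₚ constₚ (+ 1)) Δ² e (Xᵖ-1-vanishes m)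

    constantₘ : coeff (Φ m) 0 ℤ.* coeff (Φ m) 0 ≡ + 1
    constantₘ = ≡.trans (≡.sym (ℤ.*-identityˡ _)) (≡.trans (≡.cong (ℤ._* (coeff (Φ m) 0 ℤ.* coeff (Φ m) 0)) (≡.sym Δ²))
      (≡.trans (interchange (coeff (Δ m) 0) (coeff (Δ m) 0) (coeff (Φ m) 0) (coeff (Φ m) 0))
        (≡.cong (λ z → z ℤ.* z) (≡.trans (≡.sym (coeff-*-0 (Δ m) (Φ m))) (at factorₘ 0)))))
      where
      open import Algebra.Properties.CommutativeSemigroup ℤ.*-commutativeSemigroup using (interchange)

    coprime-below : ∀ g → suc g ∣ m → suc g ≤ n → Coprime (suc g −1) (Φ m)
    coprime-below g g∣m@(divides k m≡kg) g≤n with divides-Δ (below (suc g) (s≤s z≤n) g≤n) g∣m g≤n | geometric-mod (suc g) k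
    ... | factored {h} gh≋Δ | t , e = coprime-sym (coprime-divisor (factored Φh≋S) coprime-S)
      where
      k≢0 : ¬ + k ≡ + 0
      k≢0 e = ℕ.1+n≢0 (≡.trans m≡kg (≡.cong (ℕ._* suc g) (ℤ.+-injective e)))
      coprime-S : Coprime (geometric (suc g) k) (suc g −1)
      coprime-S = bezout {u = constₚ (+ 1)} {v = t} (+ k , k≢0 , ×ₙ-constₚ k)
        (≋-trans (+ₚ-cong (*ₚ-identityˡ (geometric (suc g) k)) ≋-refl) e)
      -- With r = g+1 and Δ = (q^r - 1) h, the factorisation of q^m - 1 reads (q^r - 1) h Φ = (q^r -
      -- 1) S, and q^r - 1 cancels.
      Φh≋S : Φ m *ₚ h ≋ geometric (suc g) k
      Φh≋S = cancel-−1 g (≋-trans (*ₚ-congˡ (suc g −1) (*ₚ-comm (Φ m) h)) (≋-trans (≋-sym (*ₚ-assoc (suc g −1) h (Φ m)))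
        (≋-trans (*ₚ-cong gh≋Δ ≋-refl) (≋-trans factorₘ (≋-trans (Xᵖ-1 m)
          (≋-trans (≡.subst (λ j → m −1 ≋ j −1) m≡kg ≋-refl) (≋-sym (geometric-* (suc g) k))))))))

    coprimeₘ : ∀ i → ¬ m ∣ i → Coprime (i −1) (Φ m)
    coprimeₘ i m∤i with gcd m i in g≡ | gcd[m,n]∣m m i | gcd[m,n]∣n m i | gcd-combination m i
    ... | zero | divides k m≡k0 | _ | _ = ⊥-elim (ℕ.1+n≢0 (≡.trans m≡k0 (ℕ.*-zeroʳ k)))
    ... | suc g | g∣m | g∣i | u , v , e = combine (coprime-below g g∣m (ℕ.≤-pred (ℕ.≤∧≢⇒< (∣⇒≤ g∣m)
        (λ g≡m → m∤i (≡.subst (_∣ i) g≡m g∣i)))))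
      where
      combine : Coprime (suc g −1) (Φ m) → Coprime (i −1) (Φ m)
      combine (bezout {a} {b} {w} k e′) = bezout {u = a *ₚ v} {v = a *ₚ u *ₚ Δ m +ₚ b} k
        (≋-trans (Identities.bezout-combine polyRing a u v b (i −1) (Δ m) (Φ m)) (≋-trans (+ₚ-cong (*ₚ-congˡ a
          (≋-trans (+ₚ-cong (*ₚ-congˡ u (≋-trans factorₘ (Xᵖ-1 m))) ≋-refl) e)) ≋-refl) e′))

  cyclotomic-step : IsCyclotomic m
  cyclotomic-step = record { factor = ≋-trans factorₘ (Xᵖ-1 m) ; constant = constantₘ ; coprime = coprimeₘ }

cyclotomic-≤ : ∀ n d → 1 ≤ d → d ≤ n → IsCyclotomic d
cyclotomic-≤ (suc n) d 1≤d d≤1+n with ℕ.m≤n⇒m<n∨m≡n d≤1+n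
... | inj₁ (s≤s d≤n) = cyclotomic-≤ n d 1≤d d≤n
... | inj₂ ≡.refl = cyclotomic-step n (cyclotomic-≤ n)
cyclotomic-≤ zero zero () _

cyclotomic : ∀ n → 1 ≤ n → IsCyclotomic n
cyclotomic n 1≤n = cyclotomic-≤ n n 1≤n ℕ.≤-refl

-- The exponents of ϑ

/ℕ-double : ∀ y → (y ℤ.* + 2) /ℕ 2 ≡ y
/ℕ-double (+ k) = ≡.trans (≡.cong (_/ℕ 2) (≡.sym (ℤ.pos-* k 2))) (≡.cong +_ (m*n/n≡m k 2))
-- Negative exponents do occur: m(3m-5)/2 is -1 for m = 1. On negative arguments `_/ℕ_` inspects the
-- remainder before rounding; here it is zero.
/ℕ-double -[1+ k ] with (suc k ℕ.* 2) ℕ.% 2 | m*n%n≡0 (suc k) 2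
... | .0 | ≡.refl = ≡.cong (λ j → ℤ.- (+ j)) (m*n/n≡m (suc k) 2)

private
  open Solver ℤ.+-*-commutativeRing

  +pent-suc : ∀ m → + pent (suc m) ≡ + pent m ℤ.+ (+ 1 ℤ.+ + m ℤ.* + 3)
  +pent-suc m = ≡.trans (ℤ.pos-+ (pent m) (suc (m ℕ.* 3)))
    (≡.cong (λ z → + pent m ℤ.+ z) (≡.trans (ℤ.pos-+ 1 (m ℕ.* 3)) (≡.cong (λ z → + 1 ℤ.+ z) (ℤ.pos-* m 3))))

  double-pent : ∀ m → + pent m ℤ.* + 2 ≡ + m ℤ.* (+ 3 ℤ.* + m ℤ.- + 1)
  double-pent zero = ≡.refl
  double-pent (suc m) = ≡.trans (≡.cong (ℤ._* + 2) (+pent-suc m)) (≡.trans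
    (solve 2 (λ P m → (P :+ (con (+ 1) :+ m :* con (+ 3))) :* con (+ 2) := P :* con (+ 2) :+ (con (+ 2) :+ m :* con (+ 6))) ≡.refl (+ pent m) (+ m))
    (≡.trans (≡.cong (ℤ._+ (+ 2 ℤ.+ + m ℤ.* + 6)) (double-pent m))
      (solve 1 (λ m → m :* (con (+ 3) :* m :- con (+ 1)) :+ (con (+ 2) :+ m :* con (+ 6))
        := (con (+ 1) :+ m) :* (con (+ 3) :* (con (+ 1) :+ m) :- con (+ 1))) ≡.refl (+ m))))

-- Written as differences of natural numbers, the exponents become products p^i q^j without a case
-- distinction on their sign.
θ-exponent₀ : ∀ m → (+ m ℤ.* (+ 3 ℤ.* + m ℤ.- + 5)) /ℕ 2 ≡ pent m ⊖ 2 ℕ.* m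
θ-exponent₀ m = ≡.trans (≡.cong (_/ℕ 2) (≡.trans
  (solve 1 (λ m → m :* (con (+ 3) :* m :- con (+ 5)) := m :* (con (+ 3) :* m :- con (+ 1)) :- con (+ 2) :* m :* con (+ 2)) ≡.refl (+ m))
  (≡.trans (≡.cong (ℤ._- (+ 2 ℤ.* + m ℤ.* + 2)) (≡.sym (double-pent m)))
    (solve 2 (λ P m → P :* con (+ 2) :- con (+ 2) :* m :* con (+ 2) := (P :- con (+ 2) :* m) :* con (+ 2)) ≡.refl (+ pent m) (+ m)))))
  (≡.trans (/ℕ-double (+ pent m ℤ.- + 2 ℤ.* + m)) (≡.trans (≡.cong (λ z → + pent m ℤ.- z) (≡.sym (ℤ.pos-* 2 m))) (ℤ.m-n≡m⊖n (pent m) (2 ℕ.* m))))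

θ-exponent₁ : ∀ m → (+ m ℤ.* (+ 3 ℤ.* + m ℤ.+ + 1)) /ℕ 2 ≡ (pent m ℕ.+ m) ⊖ 0
θ-exponent₁ m = ≡.trans (≡.cong (_/ℕ 2) (≡.trans
  (solve 1 (λ m → m :* (con (+ 3) :* m :+ con (+ 1)) := m :* (con (+ 3) :* m :- con (+ 1)) :+ m :* con (+ 2)) ≡.refl (+ m))
  (≡.trans (≡.cong (ℤ._+ (+ m ℤ.* + 2)) (≡.sym (double-pent m)))
    (≡.sym (ℤ.*-distribʳ-+ (+ 2) (+ pent m) (+ m))))))
  (≡.trans (/ℕ-double (+ pent m ℤ.+ + m)) (≡.sym (ℤ.pos-+ (pent m) m)))

θ-exponent₂ : ∀ m → ((+ m ℤ.- + 1) ℤ.* (+ 3 ℤ.* + m ℤ.+ + 2)) /ℕ 2 ≡ pent m ⊖ 1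
θ-exponent₂ m = ≡.trans (≡.cong (_/ℕ 2) (≡.trans
  (solve 1 (λ m → (m :- con (+ 1)) :* (con (+ 3) :* m :+ con (+ 2)) := m :* (con (+ 3) :* m :- con (+ 1)) :- con (+ 2)) ≡.refl (+ m))
  (≡.trans (≡.cong (ℤ._- + 2) (≡.sym (double-pent m)))
    (solve 1 (λ P → P :* con (+ 2) :- con (+ 2) := (P :- con (+ 1)) :* con (+ 2)) ≡.refl (+ pent m)))))
  (≡.trans (/ℕ-double (+ pent m ℤ.- + 1)) (ℤ.m-n≡m⊖n (pent m) 1))

-- The fractions `qbinom` and Gaussian binomials

oneMinus-power : ∀ s y → (∀ i → Xᵖ (s ℕ.* i) ≋ y ^ₚ i) → ∀ i → oneMinus (s ℕ.* i) ≋ Gaussian.⟪_⟫ polyRing y i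
oneMinus-power s y h i = +ₚ-cong (≋-refl {constₚ (+ 1)}) (scaleₚ-cong (ℤ.- (+ 1)) (h i))

prodₚ-snoc : ∀ f m → prodₚ (applyUpTo f (suc m)) ≋ prodₚ (applyUpTo f m) *ₚ f m
prodₚ-snoc f m = ≡.subst (λ fs → prodₚ fs ≋ prodₚ (applyUpTo f m) *ₚ f m) (List.applyUpTo-∷ʳ f m)
  (≋-trans (product-++ (applyUpTo f m) (f m ∷ []))
    (*ₚ-congˡ (prodₚ (applyUpTo f m)) (≋-trans (*ₚ-comm (f m) (constₚ (+ 1))) (*ₚ-identityˡ (f m)))))

-- Iterated lowering proves the quotient formula as an equation between products in ℤ[q]. In this
-- form it is usable also when Φ_n divides the denominator.
qbinom-gauss : ∀ s y → (∀ i → Xᵖ (s ℕ.* i) ≋ y ^ₚ i) → ∀ n m →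
  prodₚ (applyUpTo (λ i → oneMinus (s ℕ.* (n ∸ i))) m) ≋
  prodₚ (applyUpTo (λ i → oneMinus (s ℕ.* suc i)) m) *ₚ Gaussian.gauss polyRing y n m
qbinom-gauss s y h n zero = ≋-sym (*ₚ-identityˡ (constₚ (+ 1)))
qbinom-gauss s y h n (suc m) = begin
  prodₚ (applyUpTo upper (suc m))             ≈⟨ prodₚ-snoc upper m ⟩
  prodₚ (applyUpTo upper m) *ₚ upper m        ≈⟨ *ₚ-cong (qbinom-gauss s y h n m) (oneMinus-power s y h (n ∸ m)) ⟩
  L *ₚ gauss n m *ₚ ⟪ n ∸ m ⟫                 ≈⟨ *ₚ-assoc L (gauss n m) ⟪ n ∸ m ⟫ ⟩
  L *ₚ (gauss n m *ₚ ⟪ n ∸ m ⟫)               ≈⟨ *ₚ-congˡ L (gauss-lower n m) ⟨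
  L *ₚ (gauss n (suc m) *ₚ ⟪ suc m ⟫)         ≈⟨ *ₚ-congˡ L (*ₚ-comm (gauss n (suc m)) ⟪ suc m ⟫) ⟩
  L *ₚ (⟪ suc m ⟫ *ₚ gauss n (suc m))         ≈⟨ *ₚ-assoc L ⟪ suc m ⟫ (gauss n (suc m)) ⟨
  L *ₚ ⟪ suc m ⟫ *ₚ gauss n (suc m)           ≈⟨ *ₚ-cong (*ₚ-congˡ L (oneMinus-power s y h (suc m))) ≋-refl ⟨
  L *ₚ lower m *ₚ gauss n (suc m)             ≈⟨ *ₚ-cong (prodₚ-snoc lower m) ≋-refl ⟨
  prodₚ (applyUpTo lower (suc m)) *ₚ gauss n (suc m) ∎
  where
  open Gaussian polyRing y
  open SetoidReasoning ≋-setoid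
  upper lower : ℕ → Poly
  upper i = oneMinus (s ℕ.* (n ∸ i))
  lower i = oneMinus (s ℕ.* suc i)
  L = prodₚ (applyUpTo lower m)

qfraction : ℕ → ℕ → ℕ → Frac
qfraction s n m = prodₚ (applyUpTo (λ i → oneMinus (s ℕ.* (n ∸ i))) m) // prodₚ (applyUpTo (λ i → oneMinus (s ℕ.* suc i)) m)

qbinom-value : ∀ s n m → (n < m × qbinom s n m ≡ fromℤ (+ 0)) ⊎ qbinom s n m ≡ qfraction s n m
qbinom-value s n m with m ℕ.≤? n
... | no m≰n = inj₁ (ℕ.≰⇒> m≰n , ≡.refl)
... | yes _ = inj₂ (≡.cong₂ (λ ns ds → prodₚ ns // prodₚ ds)
  (List.map-upTo (λ i → oneMinus (s ℕ.* (n ∸ i))) m) (List.map-upTo (λ i → oneMinus (s ℕ.* suc i)) m))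

-- Values of rational functions in the local ring

module Representation (S : Poly → Set) (S-1 : S (constₚ (+ 1))) (S-* : ∀ {x y} → S x → S y → S (x *ₚ y)) (t : Poly) where
  open LocalQuotient polyRing S S-1 S-* t public renaming (num to numₖ; den to denₖ)
  open CommutativeRing localRing hiding (zero; distrib)
  open Exponents commutativeSemiring using (_^_; ^-congˡ)
  open Sums localRing using (∑; sign)
  open IntegerMultiples localRing using (_×ₙ_; 1+×)

  open Identities polyRing

  -- x ⇝ k : the rational function x has the value k. Since den x may share a factor with t, the
  -- equation cannot be asked modulo t: it has to hold in ℤ[q] for one representative of k.
  record _⇝_ (x : Frac) (k : Elem) : Set where
    constructor represents
    field
      {witness} : Elem
      same      : witness ≈ k
      crossed   : num x *ₚ denₖ witness ≋ den x *ₚ numₖ witness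
  infix 4 _⇝_

  ⇝-resp : ∀ {x k l} → x ⇝ k → k ≈ l → x ⇝ l
  ⇝-resp (represents s c) k≈l = represents (trans s k≈l) c

  ⇝-poly : ∀ {p r} → p ≋ r → fromPoly p ⇝ embed r
  ⇝-poly {p} {r} h = represents refl (≋-trans (*ₚ-comm p (constₚ (+ 1))) (*ₚ-congˡ (constₚ (+ 1)) h))

  ⇝-* : ∀ {x y k l} → x ⇝ k → y ⇝ l → x *f y ⇝ k * l
  ⇝-* {a // α} {b // β} (represents {elem c γ _} s h) (represents {elem d δ _} s′ h′) = represents (*-cong s s′)
    (≋-trans (medial a b γ δ) (≋-trans (*ₚ-cong h h′) (medial α c β d)))

  ⇝-+ : ∀ {x y k l} → x ⇝ k → y ⇝ l → x +f y ⇝ k + l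
  ⇝-+ {a // α} {b // β} (represents {elem c γ _} s h) (represents {elem d δ _} s′ h′) = represents (+-cong s s′)
    (sum-transfer a β b α γ δ c d h h′)

  ⇝-neg : ∀ {x k} → x ⇝ k → negf x ⇝ - k
  ⇝-neg {a // α} (represents {elem c γ _} s h) = represents (-‿cong s)
    (≋-trans (scaleₚ-* (ℤ.- (+ 1)) a γ) (≋-trans (scaleₚ-cong (ℤ.- (+ 1)) h) (≋-sym (*ₚ-scaleₚ (ℤ.- (+ 1)) α c))))

  ⇝-sum : ∀ m {f : ℕ → Frac} {g : ℕ → Elem} → (∀ i → f i ⇝ g i) → sumf (map f (upTo m)) ⇝ ∑ m g
  ⇝-sum m {f} {g} h = ≡.subst (λ fs → sumf fs ⇝ ∑ m g) (≡.sym (List.map-upTo f m)) (go m h)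
    where
    go : ∀ m {f : ℕ → Frac} {g : ℕ → Elem} → (∀ i → f i ⇝ g i) → sumf (applyUpTo f m) ⇝ ∑ m g
    go zero h = ⇝-poly 0∷[]≋[]
    go (suc m) h = ⇝-+ (h 0) (go m (h ∘ suc))

  embed-^ : ∀ y k → embed (y ^ₚ k) ≈ embed y ^ k
  embed-^ y zero = refl
  embed-^ y (suc k) = trans (embed-* y (y ^ₚ k)) (*-congˡ {embed y} (embed-^ y k))

  embed-gauss : ∀ {y z} → embed y ≈ z → ∀ n k → embed (Gaussian.gauss polyRing y n k) ≈ Gaussian.gauss localRing z n k
  embed-gauss h n zero = refl
  embed-gauss h zero (suc k) = refl
  embed-gauss {y} {z} h (suc n) (suc k) = trans (embed-+ (G.gauss n k) (y ^ₚ suc k *ₚ G.gauss n (suc k)))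
    (+-cong (embed-gauss h n k) (trans (embed-* (y ^ₚ suc k) (G.gauss n (suc k)))
      (*-cong (trans (embed-^ y (suc k)) (^-congˡ (suc k) h)) (embed-gauss h n (suc k)))))
    where module G = Gaussian polyRing y

  ⇝-quotient : ∀ {N D g k} → N ≋ D *ₚ g → embed g ≈ k → (N // D) ⇝ k
  ⇝-quotient {N} h e = represents e (≋-trans (*ₚ-comm N (constₚ (+ 1))) (≋-trans (*ₚ-identityˡ N) h))

  ⇝-qbinom : ∀ s {y z} → (∀ i → Xᵖ (s ℕ.* i) ≋ y ^ₚ i) → embed y ≈ z → ∀ n m → qbinom s n m ⇝ Gaussian.gauss localRing z n m
  ⇝-qbinom s {y} {z} h e n m = cases (qbinom-value s n m)
    where
    cases : (n < m × qbinom s n m ≡ fromℤ (+ 0)) ⊎ qbinom s n m ≡ qfraction s n m → qbinom s n m ⇝ Gaussian.gauss localRing z n m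
    cases (inj₁ (n<m , q≡)) = ≡.subst (_⇝ Gaussian.gauss localRing z n m) (≡.sym q≡)
      (⇝-resp (⇝-poly 0∷[]≋[]) (sym (Gaussian.gauss-> localRing z n<m)))
    cases (inj₂ q≡) = ≡.subst (_⇝ Gaussian.gauss localRing z n m) (≡.sym q≡)
      (⇝-quotient (qbinom-gauss s y h n m) (embed-gauss e n m))

  ⇝-sign : ∀ k → fromℤ (sgn k) ⇝ sign k
  ⇝-sign k = ⇝-resp (⇝-poly ≋-refl) (go k)
    where
    go : ∀ k → embed (constₚ (sgn k)) ≈ sign k
    go zero = refl
    go (suc k) = trans (embed-cong (∷-cong (≡.sym (ℤ.-1*i≡-i (sgn k))) ≋-refl)) (-‿cong (go k))

  ⇝-natural : ∀ k → fromℤ (+ k) ⇝ k ×ₙ 1#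
  ⇝-natural k = ⇝-resp (⇝-poly ≋-refl) (go k)
    where
    go : ∀ k → embed (constₚ (+ k)) ≈ k ×ₙ 1#
    go zero = embed-cong 0∷[]≋[]
    go (suc k) = trans (embed-+ (constₚ (+ 1)) (constₚ (+ k))) (trans (+-congˡ {embed (constₚ (+ 1))} (go k)) (sym (1+× k 1#)))

  -- The denominators of x and y, which may share factors with t, end up on the right side as
  -- `CongΦ²` requires. Only the denominators of the representatives, which lie in S, enter the
  -- multiplier Q.
  ⇝-congruent : ∀ {x y k l} → x ⇝ k → y ⇝ l → k ≈ l → Σ Poly λ P → Σ Poly λ Q →
    S Q × Q *ₚ (num x *ₚ den y -ₚ num y *ₚ den x) ≋ (den x *ₚ den y *ₚ t) *ₚ P
  ⇝-congruent {a // α} {b // β} (represents {elem c γ sγ} s h) (represents {elem d δ sδ} s′ h′) k≈l =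
    transfer (trans s (trans k≈l (sym s′)))
    where
    transfer : elem c γ sγ ≃ elem d δ sδ → Σ Poly λ P → Σ Poly λ Q → S Q × Q *ₚ (a *ₚ β -ₚ b *ₚ α) ≋ (α *ₚ β *ₚ t) *ₚ P
    transfer (congruent P Q sQ e) = P , Q *ₚ (γ *ₚ δ) , S-* sQ (S-* sγ sδ) , difference-transfer Q γ δ a β b α c d t P h h′ e

  embed-multiple : ∀ {r} y → r ≋ t *ₚ y → embed r ≈ 0#
  embed-multiple {r} y h = congruent y (constₚ (+ 1)) S-1 (≋-trans (*ₚ-identityˡ _)
    (≋-trans (+ₚ-identityʳ _) (≋-trans (*ₚ-comm r (constₚ (+ 1))) (≋-trans (*ₚ-identityˡ r) h))))

-- The branches of `ϑ′` with m as a variable in place of n / 3, so that n can later be replaced by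
-- 3m + r.
θ-form₀ θ-form₁ θ-form₂ : (ℤ → Frac) → ℕ → Frac
θ-form₀ x m = fromℤ (sgn m) *f (fromℤ (+ 1) +f x (+ (2 ℕ.* m))) *f x ((+ m ℤ.* (+ 3 ℤ.* + m ℤ.- + 5)) /ℕ 2)
θ-form₁ x m = fromℤ (sgn m) *f x ((+ m ℤ.* (+ 3 ℤ.* + m ℤ.+ + 1)) /ℕ 2)
θ-form₂ x m = fromℤ (sgn (suc m)) *f x (((+ m ℤ.- + 1) ℤ.* (+ 3 ℤ.* + m ℤ.+ + 2)) /ℕ 2)

ϑ′-cases : ∀ x n → Σ ℕ λ m → (n ≡ m ℕ.* 3 × ϑ′ x n ≡ θ-form₀ x m) ⊎ (n ≡ 1 ℕ.+ m ℕ.* 3 × ϑ′ x n ≡ θ-form₁ x m)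
                            ⊎ (n ≡ 2 ℕ.+ m ℕ.* 3 × ϑ′ x n ≡ θ-form₂ x m)
ϑ′-cases x n with n ℕ.% 3 | m≡m%n+[m/n]*n n 3 | m%n<n n 3
... | 0 | e | _ = n ℕ./ 3 , inj₁ (e , ≡.refl)
... | 1 | e | _ = n ℕ./ 3 , inj₂ (inj₁ (e , ≡.refl))
... | 2 | e | _ = n ℕ./ 3 , inj₂ (inj₂ (e , ≡.refl))
... | suc (suc (suc _)) | _ | s≤s (s≤s (s≤s ()))

half-bounds : ∀ n → n < suc (n ℕ./ 2) ℕ.+ suc (n ℕ./ 2) × n ℕ./ 2 ℕ.+ n ℕ./ 2 ≤ n
half-bounds n = ≡.subst₂ _<_ (≡.sym (m≡m%n+[m/n]*n n 2))
    (ℕ-solve 1 (λ h → ℕ-con 2 ⊞ h ⊠ ℕ-con 2 ≐ (ℕ-con 1 ⊞ h) ⊞ (ℕ-con 1 ⊞ h)) ≡.refl (n ℕ./ 2))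
    (ℕ.+-monoˡ-< ((n ℕ./ 2) ℕ.* 2) (m%n<n n 2))
  , ≡.subst (_≤ n) (ℕ-solve 1 (λ h → h ⊠ ℕ-con 2 ≐ h ⊞ h) ≡.refl (n ℕ./ 2)) (m/n*n≤m n 2)

Xᵖ-1* : ∀ i → Xᵖ (1 ℕ.* i) ≋ Xᵖ 1 ^ₚ i
Xᵖ-1* i = ≡.subst (λ k → Xᵖ k ≋ Xᵖ 1 ^ₚ i) (≡.sym (ℕ.*-identityˡ i)) (Xᵖ-^ i)

Xᵖ-2* : ∀ i → Xᵖ (2 ℕ.* i) ≋ (Xᵖ 1 ^ₚ 2) ^ₚ i
Xᵖ-2* i = ≋-trans (Xᵖ-^ (2 ℕ.* i)) (≋-sym (Exponents.^-assocʳ (CommutativeRing.commutativeSemiring polyRing) (Xᵖ 1) 2 i))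

-- Evaluation of both sides of the congruence

module Evaluation (S : Poly → Set) (S-1 : S (constₚ (+ 1))) (S-* : ∀ {x y} → S x → S y → S (x *ₚ y)) (t : Poly)
  (X∈S : S (Xᵖ 1)) where
  open Representation S S-1 S-* t public
  open CommutativeRing localRing hiding (zero; distrib)
  open Exponents commutativeSemiring using (_^_)
  open Sums localRing using (∑; sign)

  q p : Elem
  q = embed (Xᵖ 1)
  p = elem (constₚ (+ 1)) (Xᵖ 1) X∈S

  p*q≈1 : p * q ≈ 1#
  p*q≈1 = cross (*ₚ-assoc (constₚ (+ 1)) (Xᵖ 1) (constₚ (+ 1)))

  open Theta localRing q p p*q≈1

  ⇝-q^ : ∀ k → qpow (+ k) ⇝ q ^ k
  ⇝-q^ k = ⇝-resp (⇝-poly (Xᵖ-^ k)) (embed-^ (Xᵖ 1) k)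

  num-p^ : ∀ k → numₖ (p ^ k) ≋ constₚ (+ 1)
  num-p^ zero = ≋-refl
  num-p^ (suc k) = ≋-trans (*ₚ-identityˡ (numₖ (p ^ k))) (num-p^ k)

  den-p^ : ∀ k → denₖ (p ^ k) ≋ Xᵖ k
  den-p^ zero = ≋-refl
  den-p^ (suc k) = ≋-trans (*ₚ-congˡ (Xᵖ 1) (den-p^ k)) (≋-sym (Xᵖ-suc k))

  ⇝-p^ : ∀ k → qpow (ℤ.- (+ k)) ⇝ p ^ k
  ⇝-p^ zero = ⇝-q^ 0
  ⇝-p^ (suc k) = represents {witness = p ^ suc k} refl (≋-trans (*ₚ-identityˡ (denₖ (p ^ suc k))) (≋-trans (den-p^ (suc k))
    (≋-trans (≋-sym (*ₚ-identityˡ (Xᵖ (suc k)))) (≋-trans (*ₚ-comm (constₚ (+ 1)) (Xᵖ (suc k)))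
      (*ₚ-congˡ (Xᵖ (suc k)) (≋-sym (num-p^ (suc k))))))))

  ⇝-⊖ : ∀ i j → qpow (ℤ.- (i ⊖ j)) ⇝ p ^ i * q ^ j
  ⇝-⊖ i zero = ⇝-resp (⇝-p^ i) (sym (*-identityʳ (p ^ i)))
  ⇝-⊖ zero (suc j) = ⇝-resp (⇝-q^ (suc j)) (sym (*-identityˡ (q ^ suc j)))
  ⇝-⊖ (suc i) (suc j) = ≡.subst (λ z → qpow (ℤ.- z) ⇝ p ^ suc i * q ^ suc j) (≡.sym (ℤ.[1+m]⊖[1+n]≡m⊖n i j))
    (⇝-resp (⇝-⊖ i j) (sym (cancel-one i j)))

  ⇝-exponent : ∀ i j {z} → z ≡ i ⊖ j → qpow (ℤ.- z) ⇝ p ^ i * q ^ j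
  ⇝-exponent i j z≡ = ≡.subst (λ z → qpow (ℤ.- z) ⇝ p ^ i * q ^ j) (≡.sym z≡) (⇝-⊖ i j)

  ⇝-one : fromℤ (+ 1) ⇝ 1#
  ⇝-one = ⇝-poly ≋-refl

  ⇝-ϑ : ∀ n → 1 ≤ n → ϑ⁻ n ⇝ 1# + ∑ (n ℕ./ 2) (θterm n)
  ⇝-ϑ n 1≤n = cases n (n ℕ./ 2) 1≤n (proj₁ (half-bounds n)) (proj₂ (half-bounds n)) (ϑ′-cases (λ e → qpow (ℤ.- e)) n)
    where
    x : ℤ → Frac
    x e = qpow (ℤ.- e)
    sum : ∀ {y} n h → y ⇝ A (suc h) n - q * A h (n ∸ 2) → y ⇝ 1# + ∑ h (θterm n)
    sum n h r = ⇝-resp r (sym (θ-sum h n))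
    -- Here h stands for n / 2 and is known only through 2h ≤ n < 2(h+1); this leaves n free to be
    -- matched with 3m + r.
    cases : ∀ {y} n h → 1 ≤ n → n < suc h ℕ.+ suc h → h ℕ.+ h ≤ n →
      (Σ ℕ λ m → (n ≡ m ℕ.* 3 × y ≡ θ-form₀ x m) ⊎ (n ≡ 1 ℕ.+ m ℕ.* 3 × y ≡ θ-form₁ x m) ⊎ (n ≡ 2 ℕ.+ m ℕ.* 3 × y ≡ θ-form₂ x m)) →
      y ⇝ 1# + ∑ h (θterm n)
    cases _ h 1≤n _ _ (zero , inj₁ (≡.refl , _)) = ⊥-elim (ℕ.<⇒≱ 1≤n z≤n)
    cases _ h _ b _ (suc m , inj₁ (≡.refl , ≡.refl)) = sum (suc m ℕ.* 3) h
      (⇝-resp (⇝-* (⇝-* (⇝-sign (suc m)) (⇝-+ ⇝-one (⇝-p^ (2 ℕ.* suc m))))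
        (⇝-exponent (pent (suc m)) (2 ℕ.* suc m) (θ-exponent₀ (suc m)))) (sym (θ-value₀ h m b)))
    cases _ h _ b b′ (m , inj₂ (inj₁ (≡.refl , ≡.refl))) = sum (1 ℕ.+ m ℕ.* 3) h
      (⇝-resp (⇝-* (⇝-sign m) (⇝-exponent (pent m ℕ.+ m) 0 (θ-exponent₁ m))) (sym (θ-value₁ h m b b′)))
    cases _ h _ b _ (m , inj₂ (inj₂ (≡.refl , ≡.refl))) = sum (2 ℕ.+ m ℕ.* 3) h
      (⇝-resp (⇝-* (⇝-sign (suc m)) (⇝-exponent (pent m) 1 (θ-exponent₂ m))) (sym (θ-value₂ h m b)))

  embed-minus : ∀ i → embed (constₚ (+ 1) -ₚ Xᵖ 1 ^ₚ i) ≈ 1# - q ^ i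
  embed-minus i = trans (embed-+ (constₚ (+ 1)) (negₚ (Xᵖ 1 ^ₚ i))) (+-congˡ {1#} (-‿cong (embed-^ (Xᵖ 1) i)))

  square-zero : ∀ n y → (constₚ (+ 1) -ₚ Xᵖ 1 ^ₚ n) *ₚ (constₚ (+ 1) -ₚ Xᵖ 1 ^ₚ n) ≋ t *ₚ y → (1# - q ^ n) * (1# - q ^ n) ≈ 0#
  square-zero n y h = trans (*-cong (sym (embed-minus n)) (sym (embed-minus n)))
    (trans (sym (embed-* f f)) (embed-multiple y h))
    where f = constₚ (+ 1) -ₚ Xᵖ 1 ^ₚ n

  invert : ∀ i → S (constₚ (+ 1) -ₚ Xᵖ 1 ^ₚ i) → Σ Elem λ u → (1# - q ^ i) * u ≈ 1#
  invert i s = u , trans (*-congʳ {u} (sym (embed-minus i)))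
    (cross (≋-trans (*ₚ-assoc f (constₚ (+ 1)) (constₚ (+ 1))) (≋-trans (*ₚ-comm f (constₚ (+ 1) *ₚ constₚ (+ 1)))
      (*ₚ-assoc (constₚ (+ 1)) (constₚ (+ 1)) f))))
    where
    f = constₚ (+ 1) -ₚ Xᵖ 1 ^ₚ i
    u = elem (constₚ (+ 1)) f s

  module _ (n : ℕ) (1≤n : 1 ≤ n) (e²≈0 : (1# - q ^ n) * (1# - q ^ n) ≈ 0#)
    (unit : ∀ i → ¬ n ∣ i → Σ Elem λ u → (1# - q ^ i) * u ≈ 1#) where
    open Congruence localRing q p p*q≈1 n e²≈0 unit
    open IntegerMultiples localRing using (_×ₙ_)
    open Gaussian localRing using (gauss-sym)

    ⇝-qbinom₁ : ∀ N k → qbinom 1 N k ⇝ Gaussian.gauss localRing q N k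
    ⇝-qbinom₁ = ⇝-qbinom 1 Xᵖ-1* refl

    ⇝-qbinom₂ : ∀ N k → qbinom 2 N k ⇝ Gaussian.gauss localRing (q ^ 2) N k
    ⇝-qbinom₂ = ⇝-qbinom 2 Xᵖ-2* (embed-^ (Xᵖ 1) 2)

    module _ (m b : ℕ) where
      h = n ℕ./ 2

      -- N and D are arguments so that the congruence, obtained for (a-b)n + bn and (a-b)n, can be
      -- transported to an and an ∸ bn.
      left right : ℕ → ℕ → Frac
      left N D = sumf (map (λ i → let k = D ∸ h ℕ.+ i in
        fromℤ (sgn k) *f qpow (+ (k ℕ.* (k ∸ 1))) *f qbinom 2 N k *f qbinom 1 (2 ℕ.* N ∸ 2 ℕ.* k) (D ∸ k)) (upTo (suc h)))
      right N D = fromℤ (sgn D) *f qpow (+ (D ℕ.* (D ∸ 1))) *f qbinom 2 N (b ℕ.* n)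
        *f (fromℤ (+ 1) -f (fromℤ (+ (2 ℕ.* m)) *f (fromℤ (+ 1) -f ϑ⁻ n)))

      ⇝-left : left (N m b) (D m b) ⇝ ∑ (suc h) (λ i → term m b (D m b ∸ h ℕ.+ i))
      ⇝-left = ⇝-sum (suc h) (λ i → let k = D m b ∸ h ℕ.+ i in
        ⇝-* (⇝-* (⇝-* (⇝-sign k) (⇝-q^ (k ℕ.* (k ∸ 1)))) (⇝-qbinom₂ (N m b) k))
          (⇝-qbinom₁ (2 ℕ.* N m b ∸ 2 ℕ.* k) (D m b ∸ k)))

      ⇝-right : right (N m b) (D m b) ⇝ prefactor m b * (1# - ((2 ℕ.* m) ×ₙ 1#) * (1# - (1# + ∑ h (θterm n))))
      ⇝-right = ⇝-* (⇝-* (⇝-* (⇝-sign (D m b)) (⇝-q^ (D m b ℕ.* (D m b ∸ 1))))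
          (⇝-resp (⇝-qbinom₂ (N m b) (B m b)) (gauss-sym (q ^ 2) (N m b) (B m b) (D m b) (ℕ.+-comm (B m b) (D m b)))))
        (⇝-+ ⇝-one (⇝-neg (⇝-* (⇝-natural (2 ℕ.* m)) (⇝-+ ⇝-one (⇝-neg (⇝-ϑ n 1≤n))))))

      Congruent : ℕ → ℕ → Set
      Congruent N D = Σ Poly λ P → Σ Poly λ Q → S Q ×
        Q *ₚ (num (left N D) *ₚ den (right N D) -ₚ num (right N D) *ₚ den (left N D)) ≋ (den (left N D) *ₚ den (right N D) *ₚ t) *ₚ P

      left-right : 1 ≤ m → Congruent (N m b) (D m b)
      left-right 1≤m = ⇝-congruent ⇝-left ⇝-right (sum-mod m b h 2h≤n h≤D)
        where
        2h≤n : 2 ℕ.* h ≤ n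
        2h≤n = ≡.subst (_≤ n) (≡.cong (h ℕ.+_) (≡.sym (ℕ.+-identityʳ h))) (proj₂ (half-bounds n))
        h≤D : h ≤ D m b
        h≤D = ℕ.≤-trans (ℕ.m+n≤o⇒m≤o h 2h≤n) (≡.subst (_≤ D m b) (ℕ.*-identityˡ n) (ℕ.*-monoˡ-≤ n 1≤m))

theorem1p7 : (a b n : ℕ) → 1 ≤ a → 1 ≤ b → 1 ≤ n → b < a →
    CongΦ² n (t1′ a b n) (rhs a b n)
theorem1p7 a b n@(suc n′) _ _ 1≤n b<a = P , Q , (u , v , c , c≢0 , at (≋-trans identity value≋c)) , at equation
  where
  C : IsCyclotomic n
  C = cyclotomic n 1≤n

  x∈S : Coprime (Xᵖ 1) (Φ n)
  -- The factorisation q^n - 1 = Δ Φ, read as q^(n-1) q - Δ Φ = 1.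
  x∈S = bezout {u = Xᵖ 1 ^ₚ n′} {v = negₚ (Δ n)} (+ 1 , (λ ()) , ≋-refl)
    (Identities.factor-unit polyRing (Xᵖ 1) (Xᵖ 1 ^ₚ n′) (Δ n) (Φ n) (factor C))

  open Evaluation (λ Q → Coprime Q (Φ n)) coprime-1 coprime-* (Φ n *ₚ Φ n) x∈S

  unit∈S : ∀ i → ¬ n ∣ i → Coprime (constₚ (+ 1) -ₚ Xᵖ 1 ^ₚ i) (Φ n)
  unit∈S i n∤i = coprime-divisor (factored (Identities.times-minus-one polyRing (Xᵖ 1 ^ₚ i))) (coprime C i n∤i)

  m = a ∸ b

  D≡ : m ℕ.* n ≡ a ℕ.* n ∸ b ℕ.* n
  D≡ = ℕ.*-distribʳ-∸ n a b

  N≡ : m ℕ.* n ℕ.+ b ℕ.* n ≡ a ℕ.* n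
  N≡ = ≡.trans (≡.sym (ℕ.*-distribʳ-+ n m b)) (≡.cong (ℕ._* n) (ℕ.m∸n+n≡m (ℕ.<⇒≤ b<a)))

  e²≈0 = square-zero n (Δ n *ₚ Δ n) (Identities.factor-square polyRing (Xᵖ 1 ^ₚ n) (Δ n) (Φ n) (factor C))

  unit = λ i n∤i → invert i (unit∈S i n∤i)

  result : Congruent n 1≤n e²≈0 unit m b (a ℕ.* n) (a ℕ.* n ∸ b ℕ.* n)
  result = ≡.subst₂ (Congruent n 1≤n e²≈0 unit m b) N≡ D≡ (left-right n 1≤n e²≈0 unit m b (ℕ.m<n⇒0<n∸m b<a))

  P = proj₁ result
  Q = proj₁ (proj₂ result)
  open Coprime (proj₁ (proj₂ (proj₂ result))) using (u; v; identity) renaming (constant to value-constant)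
  c = proj₁ value-constant
  c≢0 = proj₁ (proj₂ value-constant)
  value≋c = proj₂ (proj₂ value-constant)
  equation = proj₂ (proj₂ (proj₂ result))
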